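{- For each non-null recursive ordinal $\alpha<\omega_1^{\mathrm{CK}}$ there exist a $\mathbf{\Sigma}^0_\alpha$-complete $\omega$-language and a $\mathbf{\Pi}^0_\alpha$-complete $\omega$-language in the class $\mathbf{r}\text{ - }\mathbf{BCL}(4)_\omega$. Moreover, the supremum of the set of Borel ranks of (Borel) $\omega$-languages in the class $\mathbf{r}\text{ - }\mathbf{BCL}(4)_\omega$ is the ordinal $\gamma^1_2$.
   Context: **Blind counter automata.** For $k\ge 1$, a real time $k$-blind-counter machine is $\mathcal M=(K,\Sigma,\Delta,q_0)$ with $K$ a finite set of states, $\Sigma$ a finite alphabet, $q_0\in K$, and $\Delta\subseteq K\times\Sigma\times\{0,1\}^k\times K\times\{0,1,-1\}^k$, such that if $(q,a,i_1,\dots,i_k,q',j_1,\dots,j_k)\in\Delta$ and $i_m=0$ then $j_m\in\{0,1\}$, and the tuple obtained by replacing $i_m=0$ by $i_m=1$ (all other entries unchanged) is also in $\Delta$. Configurations are tuples $(q,c_1,\dots,c_k)$ with $q\in K$, $c_i\in\mathbb N$. Write $a:(q,c_1,\dots,c_k)\mapsto_{\mathcal M}(q',c_1+j_1,\dots,c_k+j_k)$ if $(q,a,i_1,\dots,i_k,q',j_1,\dots,j_k)\in\Delta$ where $i_m=0$ if $c_m=0$ and $i_m=1$ if $c_m>0$. A run on $\sigma=a_1a_2\cdots\in\Sigma^\omega$ is an infinite sequence of configurations $(r_i)_{i\ge1}$ with $r_1=(q_0,0,\dots,0)$ and $a_i:r_i\mapsto_{\mathcal M}r_{i+1}$ for all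 $i\ge1$. A (non-deterministic) real time Büchi $k$-blind-counter automaton is such a machine together with a set $F\subseteq K$; it accepts the set of $\sigma\in\Sigma^\omega$ having a run in which some state of $F$ occurs infinitely often. $\mathbf{r}\text{ - }\mathbf{BCL}(k)_\omega$ is the class of $\omega$-languages, over finite alphabets, accepted by these automata. **Topology.** $\Sigma^\omega$ carries the Cantor (product) topology. $\mathbf\Sigma^0_\alpha,\mathbf\Pi^0_\alpha$ ($1\le\alpha<\omega_1$) are the usual (boldface) Borel classes. A set $F\subseteq\Sigma^\omega$ is $\mathbf\Sigma^0_\alpha$-complete (resp. $\mathbf\Pi^0_\alpha$-complete) iff for every finite alphabet $Y$ and every $E\subseteq Y^\omega$: $E\in\mathbf\Sigma^0_\alpha$ (resp. $\mathbf\Pi^0_\alpha$) iff there is a continuous $f:Y^\omega\to\Sigma^\omega$ with $E=f^{ -1}(F)$. The Borel rank of a Borel set is the least $\alpha\geq 1$ such that it belongs to $\mathbf\Sigma^0_\alpha\cup\mathbf\Pi^0_\alpha$. $\omega_1^{\mathrm{CK}}$ is the first non-recursive ordinal. **The ordinal $\gamma^1_2$.** It is the ordinal of Kechris, Marker and Sami, who proved that it is the supremum of the set of Borel ranks of the (Borel) lightface $\Pi^1_1$ sets, and equivalently of the (Borel) lightface $\Sigma^1_1$ sets; this property determines $\gamma^1_2$. Here $L\subseteq\Sigma^\omega$ is lightface $\Sigma^1_1$ (effective analytic) iff there is a recursive $R\subseteq\mathbb N\times\{0,1\}^\star\times\Sigma^\star$ with $L=\{\sigma\in\Sigma^\omega\mid\exists\tau\in\{0,1\}^\omega\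 \forall n\ \exists m\ (n,\tau[m],\sigma[m])\in R\}$, where $\sigma[m]$ denotes the prefix of length $m$; $\Pi^1_1$ sets are the complements. -}

module Defs where

open import Data.Bool.Base using (Bool; true; false)
open import Data.Fin.Base using (Fin; toℕ)
import Data.Fin.Induction as Fin
import Data.Fin.Properties as Fin
open import Data.Fin.Subset using (Subset; _∈_)
open import Data.Integer.Base as ℤ using (ℤ; +_; 0ℤ; 1ℤ; -1ℤ)
open import Data.List.Base using (List; []; _∷_; applyUpTo)
open import Data.Nat.Base as ℕ using (ℕ; zero; suc)
open import Data.Product using (∃; ∃₂; _×_; _,_; proj₁)
open import Data.Sum.Base using (_⊎_)
open import Data.Vec.Base as Vec using (Vec; []; _∷_; lookup; _[_]≔_; replicate)
open import Data.Vec.Relation.Binary.Pointwise.Inductive using (Pointwise)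
open import Function.Bundles using (_⇔_)
open import Induction.WellFounded using (WellFounded)
open import Level using (Level; 0ℓ; _⊔_) renaming (suc to lsuc)
open import Relation.Binary.Bundles using (StrictTotalOrder)
open import Relation.Binary.Morphism.Structures
  using (IsOrderMonomorphism; IsOrderIsomorphism)
open import Relation.Binary.PropositionalEquality using (_≡_; _≢_)
open import Relation.Nullary using (¬_)
open import Relation.Unary using (Pred; _≐_; _⊢_; ∁; ⋃)

------------------------------------------------------------------------
-- Words and ω-languages.  A finite alphabet is Fin n.

Word : ℕ → Set
Word n = List (Fin n)

ωWord : ℕ → Set
ωWord n = ℕ → Fin n

-- No extensionality is imposed on Lang: every class of languages below
-- contains only languages closed under pointwise equality of ω-words.

Lang : ℕ → Set₁
Lang n = Pred (ωWord n) 0ℓ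

prefix : ∀ {n} → ωWord n → ℕ → Word n
prefix σ m = applyUpTo σ m

------------------------------------------------------------------------
-- Ordinals, represented by well-ordered (set-level) types.  The ordinal
-- denoted is the order type, so equality of ordinals is _≅_.

record Ordinal : Set₁ where
  field
    strictTotalOrder : StrictTotalOrder 0ℓ 0ℓ 0ℓ
  open StrictTotalOrder strictTotalOrder public
    using (Carrier; _≈_; _<_)
  field
    wellFounded : WellFounded _<_

open Ordinal using (Carrier)

infix 4 _≅_ _≺_ _≼_

_≅_ : Ordinal → Ordinal → Set
α ≅ β = ∃ λ (f : Carrier α → Carrier β) →
  IsOrderIsomorphism A._≈_ B._≈_ A._<_ B._<_ f
  where module A = Ordinal α; module B = Ordinal β

-- α is isomorphic to the proper initial segment of β below some b.

_≺_ : Ordinal → Ordinal → Set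
α ≺ β = ∃₂ λ (f : Carrier α → Carrier β) (b : Carrier β) →
  IsOrderMonomorphism A._≈_ B._≈_ A._<_ B._<_ f ×
  (∀ y → (y B.< b) ⇔ (∃ λ x → f x B.≈ y))
  where module A = Ordinal α; module B = Ordinal β

_≼_ : Ordinal → Ordinal → Set
α ≼ β = α ≺ β ⊎ α ≅ β

𝟙 : Ordinal
𝟙 = record
  { strictTotalOrder = Fin.<-strictTotalOrder 1
  ; wellFounded      = Fin.<-wellFounded
  }

IsSupremum : ∀ {ℓ} → Pred Ordinal ℓ → Ordinal → Set (lsuc 0ℓ ⊔ ℓ)
IsSupremum S γ =
  (∀ α → S α → α ≼ γ) ×
  (∀ δ → (∀ α → S α → α ≼ δ) → γ ≼ δ)

------------------------------------------------------------------------
-- Partial recursive functions.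

data PR : ℕ → Set where
  zeroᶠ : PR 0
  sucᶠ  : PR 1
  proj  : ∀ {k} → Fin k → PR k
  comp  : ∀ {k l} → PR l → Vec (PR k) l → PR k
  rec   : ∀ {k} → PR k → PR (2 ℕ.+ k) → PR (1 ℕ.+ k)
  μ     : ∀ {k} → PR (1 ℕ.+ k) → PR k

infix 4 _[_]⇓_

data _[_]⇓_ : ∀ {k} → PR k → Vec ℕ k → ℕ → Set where
  ⇓zero : zeroᶠ [ [] ]⇓ 0
  ⇓suc  : ∀ {x} → sucᶠ [ x ∷ [] ]⇓ suc x
  ⇓proj : ∀ {k} {i : Fin k} {xs} → proj i [ xs ]⇓ lookup xs i
  ⇓comp : ∀ {k l} {f : PR l} {gs : Vec (PR k) l} {xs ys y} →
          Pointwise (λ g z → g [ xs ]⇓ z) gs ys →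
          f [ ys ]⇓ y →
          comp f gs [ xs ]⇓ y
  ⇓rec₀ : ∀ {k} {f : PR k} {g xs y} →
          f [ xs ]⇓ y →
          rec f g [ 0 ∷ xs ]⇓ y
  ⇓rec₊ : ∀ {k} {f : PR k} {g n xs y z} →
          rec f g [ n ∷ xs ]⇓ y →
          g [ n ∷ y ∷ xs ]⇓ z →
          rec f g [ suc n ∷ xs ]⇓ z
  ⇓μ    : ∀ {k} {f : PR (1 ℕ.+ k)} {xs y} →
          f [ y ∷ xs ]⇓ 0 →
          (∀ z → z ℕ.< y → ∃ λ v → f [ z ∷ xs ]⇓ suc v) →
          μ f [ xs ]⇓ y

-- On the input xs, f computes the truth value (1 or 0) of P.

ComputesTruth : ∀ {k} → PR k → Vec ℕ k → Set → Set
ComputesTruth f xs P = (P × f [ xs ]⇓ 1) ⊎ (¬ P × f [ xs ]⇓ 0)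

IsRecursive₁ : Pred ℕ 0ℓ → Set
IsRecursive₁ D = ∃ λ f → ∀ m → ComputesTruth f (m ∷ []) (D m)

IsRecursive₂ : (ℕ → ℕ → Set) → Set
IsRecursive₂ R = ∃ λ f → ∀ m n → ComputesTruth f (m ∷ n ∷ []) (R m n)

-- Bijective base-n numeration, the least significant digit first.

⌜_⌝ : ∀ {n} → Word n → ℕ
⌜ [] ⌝ = 0
⌜_⌝ {n} (a ∷ w) = suc (toℕ a) ℕ.+ n ℕ.* ⌜ w ⌝

IsRecursiveʷ : ∀ {n} → (ℕ → Word 2 → Word n → Set) → Set
IsRecursiveʷ R =
  ∃ λ f → ∀ k u v → ComputesTruth f (k ∷ ⌜ u ⌝ ∷ ⌜ v ⌝ ∷ []) (R k u v)

-- α is the order type of a recursive well-ordering R of a recursive set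
-- D of natural numbers; f is the isomorphism from α onto (D , R).

IsRecursiveOrdinal : Ordinal → Set₁
IsRecursiveOrdinal α =
  ∃₂ λ (D : Pred ℕ 0ℓ) (R : ℕ → ℕ → Set) →
  IsRecursive₁ D × IsRecursive₂ R ×
  ∃ λ (f : Carrier α → ℕ) →
    IsOrderMonomorphism A._≈_ _≡_ A._<_ R f ×
    (∀ m → D m ⇔ (∃ λ x → f x ≡ m))
  where module A = Ordinal α

------------------------------------------------------------------------
-- The Cantor topology and the Borel hierarchy.

IsOpen : ∀ {n} → Lang n → Set
IsOpen E = ∀ σ → E σ → ∃ λ m → ∀ τ → prefix σ m ≡ prefix τ m → E τ

IsContinuous : ∀ {m n} → (ωWord m → ωWord n) → Set
IsContinuous f = ∀ σ k → ∃ λ l → ∀ τ →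
  prefix σ l ≡ prefix τ l → prefix (f σ) k ≡ prefix (f τ) k

-- The argument α is not required to be countable: for uncountable α,
-- Σ⁰ α is the class of all Borel sets, so that neither Borel sets nor
-- Borel ranks are affected.

data Σ⁰ {n} (α : Ordinal) (E : Lang n) : Set₁ where
  open-set : α ≅ 𝟙 → IsOpen E → Σ⁰ α E
  union    : (β : ℕ → Ordinal) (G : ℕ → Lang n) →
             (∀ i → 𝟙 ≼ β i) → (∀ i → β i ≺ α) →
             (∀ i → Σ⁰ (β i) (∁ (G i))) →
             E ≐ ⋃ ℕ G →
             Σ⁰ α E

Π⁰ : ∀ {n} → Ordinal → Lang n → Set₁
Π⁰ α E = Σ⁰ α (∁ E)

IsComplete : (∀ {m} → Lang m → Set₁) → ∀ {n} → Lang n → Set₁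
IsComplete 𝒞 F = ∀ {m} (E : Lang m) →
  𝒞 E ⇔ (∃ λ f → IsContinuous f × E ≐ (f ⊢ F))

IsΣ⁰-complete : Ordinal → ∀ {n} → Lang n → Set₁
IsΣ⁰-complete α = IsComplete (Σ⁰ α)

IsΠ⁰-complete : Ordinal → ∀ {n} → Lang n → Set₁
IsΠ⁰-complete α = IsComplete (Π⁰ α)

HasBorelRank : ∀ {n} → Lang n → Ordinal → Set₁
HasBorelRank E α =
  𝟙 ≼ α × (Σ⁰ α E ⊎ Π⁰ α E) ×
  (∀ β → 𝟙 ≼ β → Σ⁰ β E ⊎ Π⁰ β E → α ≼ β)

BorelRanks : ∀ {ℓ} → (∀ {n} → Lang n → Set ℓ) → Pred Ordinal (lsuc 0ℓ ⊔ ℓ)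
BorelRanks 𝒞 α = ∃₂ λ n (E : Lang n) → 𝒞 E × HasBorelRank E α

------------------------------------------------------------------------
-- Lightface classes and the ordinal of Kechris, Marker and Sami.

IsΣ¹₁ : ∀ {n} → Lang n → Set₁
IsΣ¹₁ {n} E = ∃ λ (R : ℕ → Word 2 → Word n → Set) →
  IsRecursiveʷ R ×
  E ≐ (λ σ → ∃ λ (τ : ωWord 2) → ∀ k → ∃ λ m → R k (prefix τ m) (prefix σ m))

IsΠ¹₁ : ∀ {n} → Lang n → Set₁
IsΠ¹₁ E = IsΣ¹₁ (∁ E)

-- The Σ¹₁ sets have the same Borel ranks, by complementation.

Isγ¹₂ : Ordinal → Set₁
Isγ¹₂ = IsSupremum (BorelRanks IsΠ¹₁)

------------------------------------------------------------------------
-- Real time Büchi blind counter automata.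

data Move : Set where
  stay up down : Move

⟦_⟧ : Move → ℤ
⟦ stay ⟧ = 0ℤ
⟦ up   ⟧ = 1ℤ
⟦ down ⟧ = -1ℤ

-- The sign bit of a counter: false is 0 and true is 1.

positive : ℕ → Bool
positive zero    = false
positive (suc _) = true

record BlindCounterMachine (k n : ℕ) : Set₁ where
  field
    states  : ℕ
    Δ       : Fin states → Fin n → Vec Bool k → Fin states → Vec Move k → Set
    q₀      : Fin states
    no-down : ∀ {q a is q′ js} → Δ q a is q′ js →
              ∀ m → lookup is m ≡ false → lookup js m ≢ down
    blind   : ∀ {q a is q′ js} → Δ q a is q′ js →
              ∀ m → lookup is m ≡ false → Δ q a (is [ m ]≔ true) q′ js

  Config : Set
  Config = Fin states × Vec ℕ k

  Step : Fin n → Config → Config → Set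
  Step a (q , cs) (q′ , cs′) = ∃ λ js →
    Δ q a (Vec.map positive cs) q′ js ×
    (∀ m → + lookup cs′ m ≡ + lookup cs m ℤ.+ ⟦ lookup js m ⟧)

  IsRun : ωWord n → (ℕ → Config) → Set
  IsRun σ r = r 0 ≡ (q₀ , replicate k 0) × (∀ i → Step (σ i) (r i) (r (suc i)))

record BüchiBlindCounterAutomaton (k n : ℕ) : Set₁ where
  field
    machine : BlindCounterMachine k n
  open BlindCounterMachine machine public
  field
    F : Subset states

  Accepts : Lang n
  Accepts σ = ∃ λ r → IsRun σ r ×
    ∃ λ q → q ∈ F × (∀ N → ∃ λ i → N ℕ.≤ i × proj₁ (r i) ≡ q)

r-BCLω : ℕ → ∀ {n} → Lang n → Set₁
r-BCLω k {n} L = ∃ λ (A : BüchiBlindCounterAutomaton k n) →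
  L ≐ BüchiBlindCounterAutomaton.Accepts A

{-# OPTIONS --safe #-}
-- An effective analytic set K consists of the words x for which a tree recursive in x has an infinite
-- branch.  A register machine that explores the tree with oracle x is laid out as a space-time diagram,
-- row t of which has t cells.  An automaton with four blind counters guesses a pointer in every row; as
-- the lengths of the rows are known, two pairs of counters are enough to compare the positions of
-- consecutive pointers exactly, and the jumps of the pointers describe the branch.  An error in a diagram
-- is found in finite time, so that the automaton accepts O ∪ {diagrams of x | x ∈ K} with O open, which
-- has the Borel classes of K beyond the first.  The languages of the automata are themselves effective
-- analytic, so both families have the same supremum of ranks.  Complete sets are obtained from games in
-- which the labels decrease along a recursive well-order of type α: the winner is read off a truth table
-- that can be checked locally, whence both outcomes are effective analytic.
module Submission where

open import Defs
open import Axiom.ExcludedMiddle using (ExcludedMiddle)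
open import Data.Bool.Base using (Bool; true; false; not; _∧_; _∨_; if_then_else_; T)
open import Data.Bool.Properties using (∨-identityʳ; ∨-zeroʳ)
open import Data.Empty using (⊥; ⊥-elim)
open import Data.Fin.Base as Fin using (Fin; zero; suc; toℕ; fromℕ<)
import Data.Fin.Induction as FinI
import Data.Fin.Properties as FinP
import Data.Fin.Subset as Subset
import Data.Integer.Base as ℤ
import Data.Integer.Properties as ℤP
open import Data.List.Base using ([]; _∷_; applyUpTo)
open import Data.List.Properties using (∷-injectiveˡ; ∷-injectiveʳ)
open import Data.Maybe.Base as Maybe using (Maybe; just; nothing)
open import Data.Nat.Base as ℕ using (ℕ; zero; suc; pred; _+_; _*_; _∸_; _⊔_; _⊓_; _≤_; _<_; z≤n; s≤s; z<s; s<s; _≡ᵇ_; _<ᵇ_; _≤ᵇ_; ≤′-refl; ≤′-step)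
open import Data.Nat.Induction using (<-wellFounded)
open import Data.Nat.Properties
open import Data.Product using (Σ; ∃; ∃₂; _×_; _,_; proj₁; proj₂)
open import Data.Sum.Base as Sum using (_⊎_; inj₁; inj₂)
open import Data.Unit.Base using (⊤; tt)
open import Data.Vec.Base as Vec using (Vec; []; _∷_; lookup; tabulate; replicate)
open import Data.Vec.Properties using (lookup-map; lookup∘tabulate; []=⇒lookup; lookup⇒[]=; lookup-replicate; tabulate-cong; tabulate-∘; tabulate∘lookup) renaming (∷-injectiveˡ to ∷-injectiveᵛˡ; ∷-injectiveʳ to ∷-injectiveᵛʳ)
open import Data.Vec.Relation.Binary.Pointwise.Inductive using (Pointwise; []; _∷_)
open import Function.Base using (_∘_; id; case_of_)
open import Function.Bundles using (_⇔_; mk⇔; Equivalence)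
open import Induction.WellFounded using (Acc; acc)
open import Relation.Binary.Bundles using (StrictTotalOrder)
import Relation.Binary.Construct.On as On
open import Relation.Binary.Definitions using (Trichotomous; tri<; tri≈; tri>)
open import Relation.Binary.Morphism.Structures using (IsOrderMonomorphism; IsOrderIsomorphism)
open import Relation.Binary.PropositionalEquality using (_≡_; _≢_; refl; sym; trans; cong; cong₂; subst; subst₂; module ≡-Reasoning)
open import Relation.Nullary using (Dec; yes; no; ¬_)
open import Relation.Nullary.Decidable using (⌊_⌋)
open import Relation.Unary using (_≐_; _⊢_; ∁; ⋃)
open import Relation.Unary.Properties using (≐-sym; ≐-trans)

-- A blind counter blocks a run but cannot be tested for zero: a pair of them yields two
-- inequalities, which amount to an equality only because the lengths of consecutive rows are known.
-- Nor can the accepting run verify a diagram. Rather a wrong cell enables another run, with an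
-- unconstrained pointer, to end in an accepting sink, while a row that is too long merely blocks.
-- So malformed words occur on both sides: the language is `O ∪ (C ∩ K)`, with `K` read off the word
-- and `C` closed and disjoint from the open `O`, and its complement contains words outside both.
-- Classes beyond the first absorb such combinations, the first does not; hence two separate
-- automata for `α ≅ 𝟙`, and the detour through level 2 in the comparison of ranks. A tree fits into
-- this scheme because only equality of positions in consecutive rows has to be checked: registers
-- are kept in unary, the numbers of nodes are announced one after the other, and a pointer at a
-- father moves to a son in the row in which both are shown.

module Classical (em : ∀ {ℓ} → ExcludedMiddle ℓ) where

  dne : ∀ {ℓ} {P : Set ℓ} → ¬ ¬ P → P
  dne {P = P} ¬¬p with em {P = P}
  ... | yes p = p
  ... | no ¬p = ⊥-elim (¬¬p ¬p)

  ¬∀⇒∃¬ : ∀ {a b} {A : Set a} {P : A → Set b} → ¬ (∀ x → P x) → ∃ λ x → ¬ P x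
  ¬∀⇒∃¬ ¬∀ = dne λ ¬∃ → ¬∀ λ x → dne λ ¬p → ¬∃ (x , ¬p)

  ⌊em⌋-cong : ∀ {A B : Set} → (A → B) → (B → A) → ⌊ em {P = A} ⌋ ≡ ⌊ em {P = B} ⌋
  ⌊em⌋-cong {A} {B} g h with em {P = A} | em {P = B}
  ... | yes _ | yes _ = refl
  ... | no _ | no _ = refl
  ... | yes a | no ¬b = ⊥-elim (¬b (g a))
  ... | no ¬a | yes b = ⊥-elim (¬a (h b))

-- Comparison of well-orders by the ranks of their elements

module OrdinalComparison (em : ∀ {ℓ} → ExcludedMiddle ℓ) where

  open Classical em public
  open Ordinal using (Carrier; wellFounded)

  lt : (α : Ordinal) → Carrier α → Carrier α → Set
  lt = Ordinal._<_

  eq : (α : Ordinal) → Carrier α → Carrier α → Set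
  eq = Ordinal._≈_

  module STO (α : Ordinal) = StrictTotalOrder (Ordinal.strictTotalOrder α)

  minimal : ∀ {b} (α : Ordinal) (P : Carrier α → Set b) → ∃ P →
            ∃ λ x → P x × (∀ y → lt α y x → ¬ P y)
  minimal α P (x , px) = go (wellFounded α x) px
    where
    go : ∀ {x} → Acc (lt α) x → P x → ∃ λ x → P x × (∀ y → lt α y x → ¬ P y)
    go {x} (acc rs) px with em {P = ∃ λ y → lt α y x × P y}
    ... | yes (y , y<x , py) = go (rs y<x) py
    ... | no ¬∃ = x , px , λ y y<x py → ¬∃ (y , y<x , py)

  module _ (α β : Ordinal) where

    -- Inequality of ranks as a simulation, so that elements of different well-orders can be
    -- compared before any map between the orders is available.
    RankLe : ∀ {x} → Acc (lt α) x → Carrier β → Set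
    RankLe {x} (acc rs) y =
      ∀ x′ (x′<x : lt α x′ x) → ∃ λ y′ → lt β y′ y × RankLe (rs x′<x) y′

    RankLe-irr : ∀ {x} (a a′ : Acc (lt α) x) {y} → RankLe a y → RankLe a′ y
    RankLe-irr (acc rs) (acc rs′) r x′ x′<x with r x′ x′<x
    ... | y′ , y′<y , r′ = y′ , y′<y , RankLe-irr (rs x′<x) (rs′ x′<x) r′

  _∙_⊑_∙_ : (α : Ordinal) → Carrier α → (β : Ordinal) → Carrier β → Set
  α ∙ x ⊑ β ∙ y = RankLe α β (wellFounded α x) y

  _∙_⊏_∙_ : (α : Ordinal) → Carrier α → (β : Ordinal) → Carrier β → Set
  α ∙ x ⊏ β ∙ y = ∃ λ y′ → lt β y′ y × α ∙ x ⊑ β ∙ y′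

  module _ {α β : Ordinal} where

    ⊑-intro : ∀ {x y} → (∀ x′ → lt α x′ x → α ∙ x′ ⊏ β ∙ y) → α ∙ x ⊑ β ∙ y
    ⊑-intro {x} h with wellFounded α x
    ... | acc rs = λ x′ x′<x → case h x′ x′<x of λ where
      (y′ , y′<y , r) → y′ , y′<y , RankLe-irr α β _ (rs x′<x) r

    ⊑-elim : ∀ {x y} → α ∙ x ⊑ β ∙ y → ∀ x′ → lt α x′ x → α ∙ x′ ⊏ β ∙ y
    ⊑-elim {x} r x′ x′<x with wellFounded α x
    ... | acc rs with r x′ x′<x
    ... | y′ , y′<y , r′ = y′ , y′<y , RankLe-irr α β (rs x′<x) _ r′

    wf-ind : ∀ {b} (P : Carrier α → Set b) →
             (∀ x → (∀ y → lt α y x → P y) → P x) → ∀ x → P x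
    wf-ind P step x = go (wellFounded α x)
      where
      go : ∀ {x} → Acc (lt α) x → P x
      go (acc rs) = step _ λ y y<x → go (rs y<x)

  module _ {α β γ : Ordinal} where

    ⊑-trans : ∀ x {y z} → α ∙ x ⊑ β ∙ y → β ∙ y ⊑ γ ∙ z → α ∙ x ⊑ γ ∙ z
    ⊑-trans = wf-ind {α} {α} _ λ x ih {y} {z} p q → ⊑-intro {α} {γ} λ x′ x′<x →
      let (y′ , y′<y , p′) = ⊑-elim {α} {β} p x′ x′<x
          (z′ , z′<z , q′) = ⊑-elim {β} {γ} q y′ y′<y
      in z′ , z′<z , ih x′ x′<x p′ q′

    ⊏-⊑-trans : ∀ {x y z} → α ∙ x ⊏ β ∙ y → β ∙ y ⊑ γ ∙ z → α ∙ x ⊏ γ ∙ z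
    ⊏-⊑-trans (y′ , y′<y , p) q =
      let (z′ , z′<z , q′) = ⊑-elim {β} {γ} q y′ y′<y in z′ , z′<z , ⊑-trans _ p q′

    ⊑-⊏-trans : ∀ {x y z} → α ∙ x ⊑ β ∙ y → β ∙ y ⊏ γ ∙ z → α ∙ x ⊏ γ ∙ z
    ⊑-⊏-trans p (z′ , z′<z , q) = z′ , z′<z , ⊑-trans _ p q

  ⊑-refl : ∀ {α} x → α ∙ x ⊑ α ∙ x
  ⊑-refl {α} = wf-ind {α} {α} _ λ x ih → ⊑-intro {α} {α} λ y y<x → y , y<x , ih y y<x

  ⊏⇒⊑ : ∀ {α β x y} → α ∙ x ⊏ β ∙ y → α ∙ x ⊑ β ∙ y
  ⊏⇒⊑ {α} {β} {x} {y} (y′ , y′<y , p) = ⊑-intro {α} {β} λ x′ x′<x →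
    let (y″ , y″<y′ , q) = ⊑-elim {α} {β} p x′ x′<x
    in y″ , STO.trans β y″<y′ y′<y , q

  ⊏-irrefl : ∀ {α} x → ¬ (α ∙ x ⊏ α ∙ x)
  ⊏-irrefl {α} = wf-ind {α} {α} _ λ x ih (x′ , x′<x , p) → ih x′ x′<x (⊑-elim {α} {α} p x′ x′<x)

  -- Induction on `x`: an `x′` below `x` that matches no `y′` below `y` has, by the induction
  -- hypothesis, rank at least that of `y`, and so witnesses the conclusion.
  ⊑-total : ∀ {α β} x {y} → ¬ (α ∙ x ⊑ β ∙ y) → β ∙ y ⊏ α ∙ x
  ⊑-total {α} {β} = wf-ind {α} {α} _ λ x ih {y} ¬p → dne λ ¬q →
    ¬p (⊑-intro {α} {β} λ x′ x′<x → dne λ ¬r →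
      ¬q (x′ , x′<x , ⊑-intro {β} {α} λ y′ y′<y →
        ih x′ x′<x λ s → ¬r (y′ , y′<y , s)))

  ≈⇒⊑ : ∀ {α x y} → eq α x y → α ∙ x ⊑ α ∙ y
  ≈⇒⊑ {α} x≈y = ⊑-intro {α} {α} λ z z<x → z , STO.<-respʳ-≈ α x≈y z<x , ⊑-refl {α} z

  <⇒⊏ : ∀ {α x y} → lt α x y → α ∙ x ⊏ α ∙ y
  <⇒⊏ {α} x<y = _ , x<y , ⊑-refl {α} _

  ⊏⇒< : ∀ {α x y} → α ∙ x ⊏ α ∙ y → lt α x y
  ⊏⇒< {α} {x} {y} p with STO.compare α x y
  ... | tri< x<y _ _ = x<y
  ... | tri≈ _ x≈y _ = ⊥-elim (⊏-irrefl {α} x (⊏-⊑-trans {α} {α} {α} p (≈⇒⊑ {α} (STO.Eq.sym α x≈y))))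
  ... | tri> _ _ y<x = ⊥-elim (⊏-irrefl {α} x (⊏-⊑-trans {α} {α} {α} p (⊏⇒⊑ {α} {α} (<⇒⊏ {α} y<x))))

  ⊑×⊒⇒≈ : ∀ {α x y} → α ∙ x ⊑ α ∙ y → α ∙ y ⊑ α ∙ x → eq α x y
  ⊑×⊒⇒≈ {α} {x} {y} p q with STO.compare α x y
  ... | tri< x<y _ _ = ⊥-elim (⊏-irrefl {α} x (⊏-⊑-trans {α} {α} {α} (<⇒⊏ {α} x<y) q))
  ... | tri≈ _ x≈y _ = x≈y
  ... | tri> _ _ y<x = ⊥-elim (⊏-irrefl {α} y (⊏-⊑-trans {α} {α} {α} (<⇒⊏ {α} y<x) p))

  SameRank : (α : Ordinal) → Carrier α → (β : Ordinal) → Carrier β → Set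
  SameRank α x β y = α ∙ x ⊑ β ∙ y × β ∙ y ⊑ α ∙ x

  -- The least element of `β` whose rank reaches that of `x` has exactly this rank. This choice
  -- defines the canonical map in `Le⇒≼`.
  ⊑⇒SameRank : ∀ {α β x y} → α ∙ x ⊑ β ∙ y → ∃ λ y′ → β ∙ y′ ⊑ β ∙ y × SameRank α x β y′
  ⊑⇒SameRank {α} {β} {x} {y} p with minimal β (λ y′ → α ∙ x ⊑ β ∙ y′) (y , p)
  ... | y′ , q , least = y′ , y′⊑y , q , ⊑-intro {β} {α} λ z z<y′ → ⊑-total {α} {β} x (least z z<y′)
    where
    y′⊑y : β ∙ y′ ⊑ β ∙ y
    y′⊑y = dne λ ¬r → least y (⊏⇒< {β} (⊑-total {β} {β} y′ ¬r)) p

  -- `Le` and `Lt` compare order types without maps and compose directly; `Le⇒≼` and `Lt⇒≺`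
  -- translate back.
  Le : Ordinal → Ordinal → Set
  Le α β = ∀ x → ∃ λ y → α ∙ x ⊑ β ∙ y

  Lt : Ordinal → Ordinal → Set
  Lt α β = ∃ λ y → ∀ x → α ∙ x ⊏ β ∙ y

  Le-refl : ∀ {α} → Le α α
  Le-refl {α} x = x , ⊑-refl {α} x

  Le-trans : ∀ {α β γ} → Le α β → Le β γ → Le α γ
  Le-trans {α} {β} {γ} p q x =
    let (y , r) = p x; (z , s) = q y in z , ⊑-trans {α} {β} {γ} x r s

  Lt⇒Le : ∀ {α β} → Lt α β → Le α β
  Lt⇒Le {α} {β} (y , p) x = y , ⊏⇒⊑ {α} {β} (p x)

  Lt-Le-trans : ∀ {α β γ} → Lt α β → Le β γ → Lt α γ
  Lt-Le-trans {α} {β} {γ} (y , p) q =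
    let (z , s) = q y in z , λ x → ⊏-⊑-trans {α} {β} {γ} (p x) s

  Le-Lt-trans : ∀ {α β γ} → Le α β → Lt β γ → Lt α γ
  Le-Lt-trans {α} {β} {γ} p (z , q) = z , λ x →
    ⊑-⊏-trans {α} {β} {γ} (proj₂ (p x)) (q (proj₁ (p x)))

  Lt-irrefl : ∀ {α} → ¬ Lt α α
  Lt-irrefl {α} (y , p) = ⊏-irrefl {α} y (p y)

  ¬Le⇒Lt : ∀ {α β} → ¬ Le α β → Lt β α
  ¬Le⇒Lt {α} {β} ¬p with ¬∀⇒∃¬ ¬p
  ... | x , ¬q = x , λ y → ⊑-total {α} {β} x λ r → ¬q (y , r)

  module _ {α β : Ordinal} where

    private
      module A = Ordinal α
      module B = Ordinal β

    mono⇒⊑ : (f : A.Carrier → B.Carrier) → (∀ {x y} → x A.< y → f x B.< f y) →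
             ∀ x → α ∙ x ⊑ β ∙ f x
    mono⇒⊑ f mono = wf-ind {α} {α} _ λ x ih → ⊑-intro {α} {β} λ y y<x → f y , mono y<x , ih y y<x

    ≺⇒Lt : α ≺ β → Lt α β
    ≺⇒Lt (f , b , iso , below) = b , λ x →
      f x , Equivalence.from (below (f x)) (x , STO.Eq.refl β) ,
      mono⇒⊑ f (IsOrderMonomorphism.mono iso) x

    ≅⇒Le : α ≅ β → Le α β
    ≅⇒Le (f , iso) x = f x , mono⇒⊑ f (IsOrderIsomorphism.mono iso) x

    ≅⇒Ge : α ≅ β → Le β α
    ≅⇒Ge (f , iso) y with IsOrderIsomorphism.surjective iso y
    ... | x , f≈ = x , ⊑-trans {β} {β} {α} y (≈⇒⊑ {β} (STO.Eq.sym β (f≈ (STO.Eq.refl α)))) (go x)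
      where
      go : ∀ x → β ∙ f x ⊑ α ∙ x
      go = wf-ind {α} {α} _ λ x ih → ⊑-intro {β} {α} λ z z<fx →
        let (x′ , g≈) = IsOrderIsomorphism.surjective iso z
            e = STO.Eq.sym β (g≈ (STO.Eq.refl α))
            x′<x = IsOrderIsomorphism.cancel iso (STO.<-respˡ-≈ β e z<fx)
        in x′ , x′<x , ⊑-trans {β} {β} {α} z (≈⇒⊑ {β} e) (ih x′ x′<x)

    ≼⇒Le : α ≼ β → Le α β
    ≼⇒Le (inj₁ p) = Lt⇒Le {α} {β} (≺⇒Lt p)
    ≼⇒Le (inj₂ p) = ≅⇒Le p

    module _ (le : Le α β) where

      private
        f : A.Carrier → B.Carrier
        f x = proj₁ (⊑⇒SameRank {α} {β} (proj₂ (le x)))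

        same : ∀ x → SameRank α x β (f x)
        same x = proj₂ (proj₂ (⊑⇒SameRank {α} {β} (proj₂ (le x))))

        f-mono : ∀ {x y} → x A.< y → f x B.< f y
        f-mono {x} {y} x<y = ⊏⇒< {β} (⊑-⊏-trans {β} {α} {β} (proj₂ (same x))
          (⊏-⊑-trans {α} {α} {β} (<⇒⊏ {α} x<y) (proj₁ (same y))))

        f-iso : IsOrderMonomorphism A._≈_ B._≈_ A._<_ B._<_ f
        f-iso = record
          { isOrderHomomorphism = record
              { cong = λ {x} {y} x≈y → ⊑×⊒⇒≈ {β} (move x≈y) (move (STO.Eq.sym α x≈y))
              ; mono = f-mono }
          ; injective = λ {x} {y} e → ⊑×⊒⇒≈ {α} (back e) (back (STO.Eq.sym β e))
          ; cancel = λ {x} {y} p → ⊏⇒< {α} (⊑-⊏-trans {α} {β} {α} (proj₁ (same x))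
              (⊏-⊑-trans {β} {β} {α} (<⇒⊏ {β} p) (proj₂ (same y))))
          }
          where
          move : ∀ {x y} → x A.≈ y → β ∙ f x ⊑ β ∙ f y
          move {x} {y} e = ⊑-trans {β} {α} {β} (f x) (proj₂ (same x))
            (⊑-trans {α} {α} {β} x (≈⇒⊑ {α} e) (proj₁ (same y)))
          back : ∀ {x y} → f x B.≈ f y → α ∙ x ⊑ α ∙ y
          back {x} {y} e = ⊑-trans {α} {β} {α} x (proj₁ (same x))
            (⊑-trans {β} {β} {α} (f x) (≈⇒⊑ {β} e) (proj₂ (same y)))

        image-down : ∀ {b} x → b B.< f x → ∃ λ x′ → f x′ B.≈ b
        image-down {b} x b<fx =
          let (x₁ , x₁<x , q) = ⊏-⊑-trans {β} {β} {α} (<⇒⊏ {β} b<fx) (proj₂ (same x))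
              (x′ , _ , (r , s)) = ⊑⇒SameRank {β} {α} q
          in x′ , ⊑×⊒⇒≈ {β} (⊑-trans {β} {α} {β} (f x′) (proj₂ (same x′)) s)
                            (⊑-trans {β} {α} {β} b r (proj₁ (same x′)))

      -- Sending every element to the one of the same rank embeds `α` onto a subset that is closed
      -- downwards by `image-down`. Either this is everything, or the least element outside bounds
      -- it.
      Le⇒≼ : α ≼ β
      Le⇒≼ with em {P = ∀ y → ∃ λ x → f x B.≈ y}
      ... | yes onto = inj₂ (f , record
            { isOrderMonomorphism = f-iso
            ; surjective = λ y → proj₁ (onto y) , λ e → STO.Eq.trans β
                (IsOrderMonomorphism.cong f-iso e) (proj₂ (onto y)) })
      ... | no ¬onto with minimal β (λ y → ¬ ∃ λ x → f x B.≈ y) (¬∀⇒∃¬ ¬onto)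
      ... | b , b∉ , least = inj₁ (f , b , f-iso , λ y → mk⇔
            (λ y<b → dne (least y y<b))
            (λ (x , e) → below x y e))
        where
        below : ∀ x y → f x B.≈ y → y B.< b
        below x y e with STO.compare β y b
        ... | tri< y<b _ _ = y<b
        ... | tri≈ _ y≈b _ = ⊥-elim (b∉ (x , STO.Eq.trans β e y≈b))
        ... | tri> _ _ b<y = ⊥-elim (b∉ (image-down x (STO.<-respʳ-≈ β (STO.Eq.sym β e) b<y)))

  Lt⇒≺ : ∀ {α β} → Lt α β → α ≺ β
  Lt⇒≺ {α} {β} p with Le⇒≼ {α} {β} (Lt⇒Le {α} {β} p)
  ... | inj₁ q = q
  ... | inj₂ q = ⊥-elim (Lt-irrefl {α} (Lt-Le-trans {α} {β} {α} p (≅⇒Ge {α} {β} q)))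

  Le×Ge⇒≅ : ∀ {α β} → Le α β → Le β α → α ≅ β
  Le×Ge⇒≅ {α} {β} p q with Le⇒≼ {α} {β} p
  ... | inj₁ r = ⊥-elim (Lt-irrefl {α} (Lt-Le-trans {α} {β} {α} (≺⇒Lt {α} {β} r) q))
  ... | inj₂ r = r

-- Initial segments, minima and suprema of ordinals

module OrdinalConstructions (em : ∀ {ℓ} → ExcludedMiddle ℓ) where

  open OrdinalComparison em
  open Ordinal using (Carrier; wellFounded)

  seg : (α : Ordinal) → Carrier α → Ordinal
  seg α a = record
    { strictTotalOrder = On.strictTotalOrder (Ordinal.strictTotalOrder α) (proj₁ {B = λ x → lt α x a})
    ; wellFounded      = On.wellFounded proj₁ (wellFounded α)
    }

  module _ {α : Ordinal} {a : Carrier α} where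

    seg-⊑ : ∀ x → seg α a ∙ x ⊑ α ∙ proj₁ x
    seg-⊑ = mono⇒⊑ {seg α a} {α} proj₁ id

    seg-⊒ : ∀ x (x<a : lt α x a) → α ∙ x ⊑ seg α a ∙ (x , x<a)
    seg-⊒ = wf-ind {α} {α} _ λ x ih x<a → ⊑-intro {α} {seg α a} λ y y<x →
      (y , STO.trans α y<x x<a) , y<x , ih y y<x _

  seg-Lt : ∀ {α a} → Lt (seg α a) α
  seg-Lt {α} {a} = a , λ x → proj₁ x , proj₂ x , seg-⊑ {α} {a} x

  seg-Le : ∀ {α a β b} → α ∙ a ⊑ β ∙ b → Le (seg α a) (seg β b)
  seg-Le {α} {a} {β} {b} p (x , x<a) with ⊑-elim {α} {β} p x x<a
  ... | y , y<b , q = (y , y<b) , ⊑-trans {seg α a} {β} {seg β b} (x , x<a)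
    (⊑-trans {seg α a} {α} {β} (x , x<a) (seg-⊑ {α} {a} (x , x<a)) q) (seg-⊒ {β} {b} y y<b)

  -- The segment is cut at the least `b` above all ranks of `α`; by minimality every element below
  -- `b` is bounded by some rank of `α`.
  Lt⇒seg : ∀ {α β} → Lt α β → ∃ λ b → α ≅ seg β b
  Lt⇒seg {α} {β} p with minimal β (λ b → ∀ x → α ∙ x ⊏ β ∙ b) p
  ... | b , above , least = b , Le×Ge⇒≅ {α} {seg β b} le ge
    where
    le : Le α (seg β b)
    le x with above x
    ... | y , y<b , q = (y , y<b) , ⊑-trans {α} {β} {seg β b} x q (seg-⊒ {β} {b} y y<b)
    ge : Le (seg β b) α
    ge (y , y<b) with ¬∀⇒∃¬ (least y y<b)
    ... | x , ¬q = x , ⊑-trans {seg β b} {β} {α} (y , y<b) (seg-⊑ {β} {b} (y , y<b))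
                         (dne λ ¬r → ¬q (⊑-total {β} {α} y ¬r))

  seg-mono : ∀ {α a b} → lt α a b → Lt (seg α a) (seg α b)
  seg-mono {α} {a} {b} a<b = (a , a<b) , λ x →
    ⊏-⊑-trans {seg α a} {α} {seg α b} (proj₁ x , proj₂ x , seg-⊑ {α} {a} x) (seg-⊒ {α} {b} a a<b)

  seg-reflects : ∀ {α a b} → Lt (seg α a) (seg α b) → lt α a b
  seg-reflects {α} {a} {b} p = ⊏⇒< {α} (dne λ ¬q →
    Lt-irrefl {seg α a} (Lt-Le-trans {seg α a} {seg α b} {seg α a} p
      (seg-Le {α} {b} {α} {a} (dne λ ¬r → ¬q (⊑-total {α} {α} b ¬r)))))

  -- Everything smaller than `α` is a segment of `α`, so the minimum is found by well-foundedness of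
  -- the single order `α`. This provides Borel ranks.
  least-ordinal : ∀ {ℓ} (P : Ordinal → Set ℓ) → (∀ {α β} → α ≅ β → P α → P β) →
                  ∀ {α} → P α → ∃ λ β → P β × (∀ δ → P δ → Le β δ)
  least-ordinal P resp {α} pα with em {P = ∃ λ a → P (seg α a)}
  ... | yes ∃a with minimal α (P ∘ seg α) ∃a
  ...   | a , pa , least = seg α a , pa , λ δ pδ → dne λ ¬le →
            let lt′ = ¬Le⇒Lt {seg α a} {δ} ¬le
                (b , iso) = Lt⇒seg {δ} {α} (Lt-Le-trans {δ} {seg α a} {α} lt′
                                              (Lt⇒Le {seg α a} {α} (seg-Lt {α} {a})))
                b<a = seg-reflects {α} {b} {a} (Le-Lt-trans {seg α b} {δ} {seg α a}
                                              (≅⇒Ge {δ} {seg α b} iso) lt′)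
            in least b b<a (resp {δ} {seg α b} iso pδ)
  least-ordinal P resp {α} pα | no ¬∃a = α , pα , λ δ pδ → dne λ ¬le →
    let (b , iso) = Lt⇒seg {δ} {α} (¬Le⇒Lt {α} {δ} ¬le) in ¬∃a (b , resp {δ} {seg α b} iso pδ)

  𝟘 : Ordinal
  𝟘 = record { strictTotalOrder = FinP.<-strictTotalOrder 0 ; wellFounded = FinI.<-wellFounded }

  𝟚 : Ordinal
  𝟚 = record { strictTotalOrder = FinP.<-strictTotalOrder 2 ; wellFounded = FinI.<-wellFounded }

  𝟘-Le : ∀ {α} → Le 𝟘 α
  𝟘-Le ()

  Lt𝟙⇒Le𝟘 : ∀ {α} → Lt α 𝟙 → Le α 𝟘
  Lt𝟙⇒Le𝟘 (zero , p) x with p x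
  ... | _ , () , _
  Lt𝟙⇒Le𝟘 (suc () , p) x

  𝟙-Le : ∀ {α} → Carrier α → Le 𝟙 α
  𝟙-Le {α} a x = a , ⊑-intro {𝟙} {α} λ x′ x′<x → ⊥-elim (no-lt x′ x x′<x)
    where
    no-lt : ∀ (x′ x : Fin 1) → ¬ (x′ Fin.< x)
    no-lt zero zero ()

  𝟙-Lt-𝟚 : Lt 𝟙 𝟚
  𝟙-Lt-𝟚 = suc zero , λ x → zero , s≤s z≤n , proj₂ (𝟙-Le {𝟚} zero x)

  module Supremum {I : Set} (F : I → Ordinal) where

    private
      S : Set
      S = Σ I (Carrier ∘ F)

      _⊑ˢ_ _<ˢ_ : S → S → Set
      (i , x) ⊑ˢ (j , y) = F i ∙ x ⊑ F j ∙ y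
      (i , x) <ˢ (j , y) = F i ∙ x ⊏ F j ∙ y

      -- Generalised to all elements of rank at most that of `y`, so that induction within the one
      -- order `F j` covers predecessors coming from all the others.
      acc-below : ∀ j (y : Carrier (F j)) (s : S) → s ⊑ˢ (j , y) → Acc _<ˢ_ s
      acc-below j = wf-ind {F j} {F j} _ λ y ih (i , x) p → acc λ { {k , z} (x′ , x′<x , q) →
        let (y′ , y′<y , r) = ⊑-elim {F i} {F j} p x′ x′<x
        in ih y′ y′<y (k , z) (⊑-trans {F k} {F i} {F j} z q r) }

    sup : Ordinal
    sup = record
      { strictTotalOrder = record
          { Carrier = S
          ; _≈_ = λ s t → s ⊑ˢ t × t ⊑ˢ s
          ; _<_ = _<ˢ_
          ; isStrictTotalOrder = record
              { isStrictPartialOrder = record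
                  { isEquivalence = record
                      { refl = λ {s} → ⊑-refl {F (proj₁ s)} _ , ⊑-refl {F (proj₁ s)} _
                      ; sym = λ (p , q) → q , p
                      ; trans = λ {s} {t} {u} (p , q) (p′ , q′) →
                          ⊑-trans {F (proj₁ s)} {F (proj₁ t)} {F (proj₁ u)} _ p p′ ,
                          ⊑-trans {F (proj₁ u)} {F (proj₁ t)} {F (proj₁ s)} _ q′ q
                      }
                  ; irrefl = λ {s} {t} (p , q) r →
                      ⊏-irrefl {F (proj₁ s)} _ (⊏-⊑-trans {F (proj₁ s)} {F (proj₁ t)} {F (proj₁ s)} r q)
                  ; trans = λ {s} {t} {u} p q →
                      ⊏-⊑-trans {F (proj₁ s)} {F (proj₁ t)} {F (proj₁ u)} p
                        (⊏⇒⊑ {F (proj₁ t)} {F (proj₁ u)} q)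
                  ; <-resp-≈ =
                      (λ {s} {t} {u} (p , q) r →
                        ⊏-⊑-trans {F (proj₁ s)} {F (proj₁ t)} {F (proj₁ u)} r p) ,
                      (λ {s} {t} {u} (p , q) r →
                        ⊑-⊏-trans {F (proj₁ u)} {F (proj₁ t)} {F (proj₁ s)} q r)
                  }
              ; compare = compare
              }
          }
      ; wellFounded = λ (i , x) → acc-below i x (i , x) (⊑-refl {F i} x)
      }
      where
      compare : Trichotomous (λ s t → s ⊑ˢ t × t ⊑ˢ s) _<ˢ_
      compare (i , x) (j , y) with em {P = F i ∙ x ⊑ F j ∙ y} | em {P = F j ∙ y ⊑ F i ∙ x}
      ... | yes p | yes q = tri≈
              (λ r → ⊏-irrefl {F i} x (⊏-⊑-trans {F i} {F j} {F i} r q)) (p , q)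
              (λ r → ⊏-irrefl {F i} x (⊑-⊏-trans {F i} {F j} {F i} p r))
      ... | no ¬p | _ = tri> (¬p ∘ ⊏⇒⊑ {F i} {F j}) (¬p ∘ proj₁) (⊑-total {F i} {F j} x ¬p)
      ... | yes p | no ¬q = tri< (⊑-total {F j} {F i} y ¬q) (¬q ∘ proj₂) (¬q ∘ ⊏⇒⊑ {F j} {F i})

    sup-upper : ∀ i → Le (F i) sup
    sup-upper i x = (i , x) , mono⇒⊑ {F i} {sup} (i ,_) (<⇒⊏ {F i}) x

    sup-least : ∀ {δ} → (∀ i → Le (F i) δ) → Le sup δ
    sup-least {δ} h (i , x) = proj₁ (h i x) , below (proj₁ (h i x)) (i , x) (proj₂ (h i x))
      where
      below : ∀ y (s : S) → F (proj₁ s) ∙ proj₂ s ⊑ δ ∙ y → sup ∙ s ⊑ δ ∙ y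
      below = wf-ind {δ} {δ} _ λ y ih (j , z) p → ⊑-intro {sup} {δ} λ { (k , u) (z′ , z′<z , q) →
        let (y′ , y′<y , r) = ⊑-elim {F j} {δ} p z′ z′<z
        in y′ , y′<y , ih y′ y′<y (k , u) (⊑-trans {F k} {F j} {δ} u q r) }

-- Prefixes, continuity and open sets

module _ {A : Set} where

  applyUpTo-cong : ∀ {f g : ℕ → A} m → (∀ i → i < m → f i ≡ g i) → applyUpTo f m ≡ applyUpTo g m
  applyUpTo-cong zero h = refl
  applyUpTo-cong (suc m) h = cong₂ _∷_ (h 0 z<s) (applyUpTo-cong m λ i i<m → h (suc i) (s<s i<m))

  applyUpTo-inj : ∀ {f g : ℕ → A} m → applyUpTo f m ≡ applyUpTo g m → ∀ i → i < m → f i ≡ g i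
  applyUpTo-inj (suc m) e zero _ = ∷-injectiveˡ e
  applyUpTo-inj (suc m) e (suc i) (s≤s i<m) = applyUpTo-inj m (∷-injectiveʳ e) i i<m

module _ {n : ℕ} where

  Agree : ℕ → ωWord n → ωWord n → Set
  Agree m σ τ = ∀ i → i < m → σ i ≡ τ i

  prefix⇒Agree : ∀ {σ τ : ωWord n} m → prefix σ m ≡ prefix τ m → Agree m σ τ
  prefix⇒Agree = applyUpTo-inj

  Agree⇒prefix : ∀ {σ τ : ωWord n} m → Agree m σ τ → prefix σ m ≡ prefix τ m
  Agree⇒prefix = applyUpTo-cong

  prefix-≤ : ∀ {σ τ : ωWord n} {l m} → l ≤ m → prefix σ m ≡ prefix τ m → prefix σ l ≡ prefix τ l
  prefix-≤ {l = l} {m} l≤m e = Agree⇒prefix l λ i i<l → prefix⇒Agree m e i (<-≤-trans i<l l≤m)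

pointwise-continuous : ∀ {m n} (f : ωWord m → ωWord n) →
  (∀ σ i → ∃ λ l → ∀ τ → Agree l σ τ → f σ i ≡ f τ i) → IsContinuous f
pointwise-continuous f h σ k = l k , λ τ e → Agree⇒prefix k (agree k τ (prefix⇒Agree (l k) e))
  where
  l : ℕ → ℕ
  l zero = 0
  l (suc k) = l k ⊔ proj₁ (h σ k)
  agree : ∀ k τ → Agree (l k) σ τ → Agree k (f σ) (f τ)
  agree (suc k) τ a i i<1+k with m≤n⇒m<n∨m≡n (≤-pred i<1+k)
  ... | inj₁ i<k = agree k τ (λ j j<l → a j (<-≤-trans j<l (m≤m⊔n _ _))) i i<k
  ... | inj₂ refl = proj₂ (h σ k) τ λ j j<l → a j (<-≤-trans j<l (m≤n⊔m (l k) _))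

open-∪ : ∀ {n} {E U : Lang n} → IsOpen E → IsOpen U → IsOpen (λ σ → E σ ⊎ U σ)
open-∪ oE oU σ (inj₁ p) = proj₁ (oE σ p) , λ τ e → inj₁ (proj₂ (oE σ p) τ e)
open-∪ oE oU σ (inj₂ p) = proj₁ (oU σ p) , λ τ e → inj₂ (proj₂ (oU σ p) τ e)

open-preimage : ∀ {m n} {f : ωWord m → ωWord n} {E : Lang n} →
                IsContinuous f → IsOpen E → IsOpen (f ⊢ E)
open-preimage {f = f} cf oE σ p =
  let (k , h) = oE (f σ) p; (l , g) = cf σ k in l , λ τ e → h (f τ) (g τ e)

interleave : ∀ {a} {A : Set a} → (ℕ → A) → (ℕ → A) → ℕ → A
interleave f g zero = f 0
interleave f g (suc zero) = g 0
interleave f g (suc (suc i)) = interleave (f ∘ suc) (g ∘ suc) i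

module _ {a p} {A : Set a} (P : A → Set p) where

  interleave-all : ∀ f g → (∀ i → P (f i)) → (∀ i → P (g i)) → ∀ i → P (interleave f g i)
  interleave-all f g pf pg zero = pf 0
  interleave-all f g pf pg (suc zero) = pg 0
  interleave-all f g pf pg (suc (suc i)) = interleave-all (f ∘ suc) (g ∘ suc) (pf ∘ suc) (pg ∘ suc) i

  interleave-left : ∀ f g i → P (f i) → ∃ λ j → P (interleave f g j)
  interleave-left f g zero p = 0 , p
  interleave-left f g (suc i) p =
    let (j , q) = interleave-left (f ∘ suc) (g ∘ suc) i p in suc (suc j) , q

  interleave-right : ∀ f g i → P (g i) → ∃ λ j → P (interleave f g j)
  interleave-right f g zero p = 1 , p
  interleave-right f g (suc i) p =
    let (j , q) = interleave-right (f ∘ suc) (g ∘ suc) i p in suc (suc j) , q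

  interleave-split : ∀ f g i → P (interleave f g i) → ∃ (P ∘ f) ⊎ ∃ (P ∘ g)
  interleave-split f g zero p = inj₁ (0 , p)
  interleave-split f g (suc zero) p = inj₂ (0 , p)
  interleave-split f g (suc (suc i)) p with interleave-split (f ∘ suc) (g ∘ suc) i p
  ... | inj₁ (j , q) = inj₁ (suc j , q)
  ... | inj₂ (j , q) = inj₂ (suc j , q)

-- Closure properties of the Borel classes

module BorelClasses (em : ∀ {ℓ} → ExcludedMiddle ℓ) where

  open OrdinalComparison em
  open OrdinalConstructions em

  ≼-trans : ∀ {α β γ} → α ≼ β → β ≼ γ → α ≼ γ
  ≼-trans {α} {β} {γ} p q = Le⇒≼ {α} {γ} (Le-trans {α} {β} {γ} (≼⇒Le {α} {β} p) (≼⇒Le {β} {γ} q))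

  ≼-refl : ∀ {α} → α ≼ α
  ≼-refl {α} = Le⇒≼ {α} {α} (Le-refl {α})

  ≺-≼-trans : ∀ {α β γ} → α ≺ β → β ≼ γ → α ≺ γ
  ≺-≼-trans {α} {β} {γ} p q = Lt⇒≺ {α} {γ} (Lt-Le-trans {α} {β} {γ} (≺⇒Lt {α} {β} p) (≼⇒Le {β} {γ} q))

  ≼-≺-trans : ∀ {α β γ} → α ≼ β → β ≺ γ → α ≺ γ
  ≼-≺-trans {α} {β} {γ} p q = Lt⇒≺ {α} {γ} (Le-Lt-trans {α} {β} {γ} (≼⇒Le {α} {β} p) (≺⇒Lt {β} {γ} q))

  ≅-sym : ∀ {α β} → α ≅ β → β ≅ α
  ≅-sym {α} {β} p = Le×Ge⇒≅ {β} {α} (≅⇒Ge {α} {β} p) (≅⇒Le {α} {β} p)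

  ≅-trans : ∀ {α β γ} → α ≅ β → β ≅ γ → α ≅ γ
  ≅-trans {α} {β} {γ} p q = Le×Ge⇒≅ {α} {γ}
    (Le-trans {α} {β} {γ} (≅⇒Le {α} {β} p) (≅⇒Le {β} {γ} q))
    (Le-trans {γ} {β} {α} (≅⇒Ge {β} {γ} q) (≅⇒Ge {α} {β} p))

  module _ {n : ℕ} where

    open-≐ : {E E′ : Lang n} → E ≐ E′ → IsOpen E → IsOpen E′
    open-≐ (f , g) o σ p = proj₁ (o σ (g p)) , λ τ e → f (proj₂ (o σ (g p)) τ e)

    Σ⁰-≐ : ∀ {α} {E E′ : Lang n} → E ≐ E′ → Σ⁰ α E → Σ⁰ α E′
    Σ⁰-≐ e (open-set iso o) = open-set iso (open-≐ e o)
    Σ⁰-≐ (f , g) (union β G l u s (h , k)) = union β G l u s ((h ∘ g) , (f ∘ k))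

    ∁-≐ : {E E′ : Lang n} → E ≐ E′ → ∁ E ≐ ∁ E′
    ∁-≐ (f , g) = (λ ¬p q → ¬p (g q)) , (λ ¬p q → ¬p (f q))

    ∁∁-≐ : {E : Lang n} → E ≐ ∁ (∁ E)
    ∁∁-≐ = (λ p ¬p → ¬p p) , dne

    Σ⁰⇒𝟙≼ : ∀ {α} {E : Lang n} → Σ⁰ α E → 𝟙 ≼ α
    Σ⁰⇒𝟙≼ {α} (open-set iso _) = inj₂ (≅-sym {α} {𝟙} iso)
    Σ⁰⇒𝟙≼ {α} (union β _ l u _ _) = inj₁ (≼-≺-trans {𝟙} {β 0} {α} (l 0) (u 0))

    open⇒Σ⁰₁ : {E : Lang n} → IsOpen E → Σ⁰ 𝟙 E
    open⇒Σ⁰₁ = open-set (Le×Ge⇒≅ {𝟙} {𝟙} (Le-refl {𝟙}) (Le-refl {𝟙}))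

    -- The union of the basic open sets of depth `i` inside `E`. It is clopen, which turns an open
    -- set into a countable union of closed ones.
    Cylinder : Lang n → ℕ → Lang n
    Cylinder E i σ = ∀ τ → prefix σ i ≡ prefix τ i → E τ

    Cylinder-∁-open : ∀ {E} i → IsOpen (∁ (Cylinder E i))
    Cylinder-∁-open i σ ¬p = i , λ τ e q → ¬p λ υ e′ → q υ (trans (sym e) e′)

    open≐⋃Cylinder : {E : Lang n} → IsOpen E → E ≐ ⋃ ℕ (Cylinder E)
    open≐⋃Cylinder o = (λ p → o _ p) , λ (i , h) → h _ refl

    open⇒Σ⁰ : ∀ {α} {E : Lang n} → 𝟙 ≼ α → IsOpen E → Σ⁰ α E
    open⇒Σ⁰ {α} (inj₂ iso) o = open-set (≅-sym {𝟙} {α} iso) o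
    open⇒Σ⁰ {E = E} (inj₁ 𝟙≺α) o =
      union (λ _ → 𝟙) (Cylinder E) (λ _ → ≼-refl {𝟙}) (λ _ → 𝟙≺α)
            (λ i → open⇒Σ⁰₁ (Cylinder-∁-open i)) (open≐⋃Cylinder o)

    Σ⁰-mono : ∀ {α β} {E : Lang n} → α ≼ β → Σ⁰ α E → Σ⁰ β E
    Σ⁰-mono {α} {β} p (open-set iso o) =
      open⇒Σ⁰ {β} (≼-trans {𝟙} {α} {β} (inj₂ (≅-sym {α} {𝟙} iso)) p) o
    Σ⁰-mono {α} {β} p (union γ G l u s e) =
      union γ G l (λ i → ≺-≼-trans {γ i} {α} {β} (u i) p) s e

    Σ⁰-∪-open : ∀ {α} {E U : Lang n} → Σ⁰ α E → IsOpen U → Σ⁰ α (λ σ → E σ ⊎ U σ)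
    Σ⁰-∪-open (open-set iso o) oU = open-set iso (open-∪ o oU)
    Σ⁰-∪-open {α} {E} {U} (union β G l u s (f , g)) oU =
      union (proj₁ ∘ fam) (proj₂ ∘ fam)
        (interleave-all (λ (β , _) → 𝟙 ≼ β) GE GU l (λ _ → ≼-refl {𝟙}))
        (interleave-all (λ (β , _) → β ≺ α) GE GU u
           (λ _ → ≼-≺-trans {𝟙} {β 0} {α} (l 0) (u 0)))
        (interleave-all (λ (β , G) → Σ⁰ β (∁ G)) GE GU s (λ i → open⇒Σ⁰₁ (Cylinder-∁-open i)))
        (to , from)
      where
      GE GU fam : ℕ → Ordinal × Lang n
      GE i = β i , G i
      GU i = 𝟙 , Cylinder U i
      fam = interleave GE GU
      to : ∀ {σ} → E σ ⊎ U σ → ∃ λ i → proj₂ (fam i) σ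
      to {σ} (inj₁ p) = let (i , q) = f p in interleave-left (λ (_ , G) → G σ) GE GU i q
      to {σ} (inj₂ p) =
        let (i , q) = proj₁ (open≐⋃Cylinder oU) p in interleave-right (λ (_ , G) → G σ) GE GU i q
      from : ∀ {σ} → (∃ λ i → proj₂ (fam i) σ) → E σ ⊎ U σ
      from {σ} (i , p) with interleave-split (λ (_ , G) → G σ) GE GU i p
      ... | inj₁ q = inj₁ (g q)
      ... | inj₂ q = inj₂ (proj₂ (open≐⋃Cylinder oU) q)

    -- This is the shape of the language of the automaton, with `Z` everything, and of its
    -- complement, with `Z` the complement of the open part. The closed pieces of `Z` and `U` enter
    -- the union at the first level, hence `𝟙 ≺ α`.
    Σ⁰-closed∩open∪closed∩ : ∀ {α} {E Z U C : Lang n} → 𝟙 ≺ α →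
      IsOpen (∁ Z) → IsOpen U → IsOpen (∁ C) → Σ⁰ α E →
      Σ⁰ α (λ σ → (Z σ × U σ) ⊎ (C σ × E σ))
    Σ⁰-closed∩open∪closed∩ {α} 𝟙≺α oZ oU oC (open-set iso o) =
      ⊥-elim (Lt-irrefl {𝟙} (Lt-Le-trans {𝟙} {α} {𝟙} (≺⇒Lt {𝟙} {α} 𝟙≺α) (≅⇒Le {α} {𝟙} iso)))
    Σ⁰-closed∩open∪closed∩ {α} {E} {Z} {U} {C} 𝟙≺α oZ oU oC (union β G l u s (f , g)) =
      union (proj₁ ∘ fam) (proj₂ ∘ fam)
        (interleave-all (λ (β , _) → 𝟙 ≼ β) GE GU l (λ _ → ≼-refl {𝟙}))
        (interleave-all (λ (β , _) → β ≺ α) GE GU u (λ _ → 𝟙≺α))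
        (interleave-all (λ (β , G) → Σ⁰ β (∁ G)) GE GU
          (λ i → Σ⁰-≐ (deMorgan C (G i)) (Σ⁰-∪-open (s i) oC))
          (λ i → Σ⁰-≐ (deMorgan Z (Cylinder U i))
                   (Σ⁰-∪-open (open⇒Σ⁰₁ (Cylinder-∁-open i)) oZ)))
        (to , from)
      where
      _∩′_ : Lang n → Lang n → Lang n
      (A ∩′ B) σ = A σ × B σ
      GE GU fam : ℕ → Ordinal × Lang n
      GE i = β i , C ∩′ G i
      GU i = 𝟙 , Z ∩′ Cylinder U i
      fam = interleave GE GU
      deMorgan : ∀ A B → (λ σ → ∁ B σ ⊎ ∁ A σ) ≐ ∁ (A ∩′ B)
      deMorgan A B = (λ { (inj₁ ¬b) (_ , b) → ¬b b ; (inj₂ ¬a) (a , _) → ¬a a }) ,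
                     λ {σ} h → case em {P = B σ} of λ where
                       (yes b) → inj₂ λ a → h (a , b)
                       (no ¬b) → inj₁ ¬b
      to : ∀ {σ} → (Z σ × U σ) ⊎ (C σ × E σ) → ∃ λ i → proj₂ (fam i) σ
      to {σ} (inj₂ (c , p)) = let (i , q) = f p in interleave-left (λ (_ , G) → G σ) GE GU i (c , q)
      to {σ} (inj₁ (z , p)) = let (i , q) = proj₁ (open≐⋃Cylinder oU) p in
                              interleave-right (λ (_ , G) → G σ) GE GU i (z , q)
      from : ∀ {σ} → (∃ λ i → proj₂ (fam i) σ) → (Z σ × U σ) ⊎ (C σ × E σ)
      from {σ} (i , p) with interleave-split (λ (_ , G) → G σ) GE GU i p
      ... | inj₁ (j , c , q) = inj₂ (c , g (j , q))
      ... | inj₂ (j , z , q) = inj₁ (z , proj₂ (open≐⋃Cylinder oU) (j , q))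

  Σ⁰-preimage : ∀ {α m n} {f : ωWord m → ωWord n} {E : Lang n} →
                IsContinuous f → Σ⁰ α E → Σ⁰ α (f ⊢ E)
  Σ⁰-preimage cf (open-set iso o) = open-set iso (open-preimage cf o)
  Σ⁰-preimage {f = f} cf (union β G l u s (h , k)) =
    union β (λ i → f ⊢ G i) l u (λ i → Σ⁰-preimage cf (s i)) (h , k)

  borel-rank : ∀ {n} {E : Lang n} {α} → Σ⁰ α E ⊎ Π⁰ α E → ∃ (HasBorelRank E)
  borel-rank {E = E} {α} p =
    let (β , q , least) = least-ordinal (λ α → Σ⁰ α E ⊎ Π⁰ α E) resp {α} p
    in β , Sum.[_,_]′ (Σ⁰⇒𝟙≼ {α = β}) (Σ⁰⇒𝟙≼ {α = β}) q , q , λ δ _ r → Le⇒≼ {β} {δ} (least δ r)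
    where
    resp : ∀ {α β} → α ≅ β → Σ⁰ α E ⊎ Π⁰ α E → Σ⁰ β E ⊎ Π⁰ β E
    resp {α} {β} iso = Sum.map (Σ⁰-mono {α = α} {β} (inj₂ iso)) (Σ⁰-mono {α = α} {β} (inj₂ iso))

  complete : ∀ {α m} {K : Lang m} → IsΣ⁰-complete α K → IsΠ⁰-complete α (∁ K)
  complete {α} {K = K} c E = mk⇔
    (λ p → let (f , cf , (h , k)) = Equivalence.to (c (∁ E)) p in
           f , cf , (λ {σ} e q → k q e) , λ {σ} ¬q → dne λ ¬e → ¬q (h ¬e))
    (λ (f , cf , (h , k)) → Equivalence.from (c (∁ E))
      (f , cf , (λ {σ} ¬e → dne λ ¬q → ¬e (k ¬q)) , λ {σ} q e → h e q))

-- Finite types, and counter automata without sign vectors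

record Finite (A : Set) : Set where
  field
    size    : ℕ
    enc     : A → Fin size
    dec     : Fin size → A
    -- Only a retraction: surplus codes decode to some element as well, so every word over a coded
    -- alphabet has a meaning.
    dec-enc : ∀ a → dec (enc a) ≡ a

open Finite

retract : ∀ {A B : Set} (f : A → B) (g : B → A) → (∀ a → g (f a) ≡ a) → Finite B → Finite A
retract f g gf fin = record
  { size = size fin ; enc = enc fin ∘ f ; dec = g ∘ dec fin
  ; dec-enc = λ a → trans (cong g (dec-enc fin (f a))) (gf a) }

Fin-finite : ∀ n → Finite (Fin n)
Fin-finite n = record { size = n ; enc = id ; dec = id ; dec-enc = λ _ → refl }

⊤-finite : Finite ⊤
⊤-finite = retract (λ _ → zero) (λ _ → tt) (λ _ → refl) (Fin-finite 1)

⊎-finite : ∀ {A B : Set} → Finite A → Finite B → Finite (A ⊎ B)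
⊎-finite a b = record
  { size = size a + size b
  ; enc = λ x → Fin.join _ _ (Sum.map (enc a) (enc b) x)
  ; dec = λ i → Sum.map (dec a) (dec b) (Fin.splitAt (size a) i)
  ; dec-enc = λ { (inj₁ x) → trans (cong (Sum.map _ _) (FinP.splitAt-↑ˡ _ (enc a x) _)) (cong inj₁ (dec-enc a x))
                ; (inj₂ y) → trans (cong (Sum.map _ _) (FinP.splitAt-↑ʳ (size a) _ (enc b y))) (cong inj₂ (dec-enc b y)) }
  }

×-finite : ∀ {A B : Set} → Finite A → Finite B → Finite (A × B)
×-finite a b = record
  { size = size a * size b
  ; enc = λ (x , y) → Fin.combine (enc a x) (enc b y)
  ; dec = λ i → let (p , q) = Fin.remQuot (size b) i in dec a p , dec b q
  ; dec-enc = λ (x , y) → trans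
      (cong (λ (p , q) → dec a p , dec b q) (FinP.remQuot-combine (enc a x) (enc b y)))
      (cong₂ _,_ (dec-enc a x) (dec-enc b y))
  }

Bool-finite : Finite Bool
Bool-finite = retract (λ { true → inj₁ tt ; false → inj₂ tt }) (λ { (inj₁ _) → true ; (inj₂ _) → false })
  (λ { true → refl ; false → refl }) (⊎-finite ⊤-finite ⊤-finite)

Maybe-finite : ∀ {A : Set} → Finite A → Finite (Maybe A)
Maybe-finite a = retract (λ { nothing → inj₁ tt ; (just x) → inj₂ x })
  (λ { (inj₁ _) → nothing ; (inj₂ x) → just x }) (λ { nothing → refl ; (just _) → refl })
  (⊎-finite ⊤-finite a)

Vec-finite : ∀ {A : Set} → Finite A → ∀ n → Finite (Vec A n)
Vec-finite a zero = retract (λ _ → tt) (λ _ → []) (λ { [] → refl }) ⊤-finite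
Vec-finite a (suc n) = retract (λ { (x ∷ xs) → x , xs }) (λ (x , xs) → x ∷ xs) (λ { (x ∷ xs) → refl })
  (×-finite a (Vec-finite a n))

Move-finite : Finite Move
Move-finite = retract (λ { stay → nothing ; up → just true ; down → just false })
  (λ { nothing → stay ; (just true) → up ; (just false) → down })
  (λ { stay → refl ; up → refl ; down → refl }) (Maybe-finite Bool-finite)

bounded : ∀ {n} (g : Fin n → ℕ) → ∃ λ M → ∀ q → g q ≤ M
bounded {zero} g = 0 , λ ()
bounded {suc n} g = let (M , h) = bounded (g ∘ suc) in
  g zero ⊔ M , λ { zero → m≤m⊔n _ _ ; (suc q) → ≤-trans (h q) (m≤n⊔m _ _) }

InfinitelyOften : ∀ {ℓ} → (ℕ → Set ℓ) → Set ℓ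
InfinitelyOften S = ∀ N → ∃ λ i → N ≤ i × S i

module Pigeonhole (em : ∀ {ℓ} → ExcludedMiddle ℓ) where

  open Classical em

  -- Otherwise each value has a last occurrence in `S`, and these are bounded together. It mediates
  -- between returning to a set of accepting states and returning to a single one, as acceptance
  -- demands.
  pigeonhole : ∀ {n} (f : ℕ → Fin n) (S : ℕ → Set) → InfinitelyOften S →
               ∃ λ q → InfinitelyOften (λ i → S i × f i ≡ q)
  pigeonhole f S inf = dne λ ¬∃ →
    let late q = ¬∀⇒∃¬ {P = λ N → ∃ λ i → N ≤ i × S i × f i ≡ q} (λ h → ¬∃ (q , h))
        (M , h) = bounded (proj₁ ∘ late)
        (i , M≤i , s) = inf M
    in proj₂ (late (f i)) (i , ≤-trans (h (f i)) M≤i , s , refl)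

-- Over ℕ a decrement of zero is impossible by its form, which expresses the sign condition without
-- sign bits.
Moved : Move → ℕ → ℕ → Set
Moved stay c c′ = c′ ≡ c
Moved up   c c′ = c′ ≡ suc c
Moved down c c′ = c ≡ suc c′

Moved⇒ℤ : ∀ j {c c′} → Moved j c c′ → ℤ.+ c′ ≡ ℤ.+ c ℤ.+ ⟦ j ⟧
Moved⇒ℤ stay {c} refl = cong ℤ.+_ (sym (+-identityʳ c))
Moved⇒ℤ up {c} refl = cong ℤ.+_ (+-comm 1 c)
Moved⇒ℤ down refl = refl

ℤ⇒Moved : ∀ j {c c′} → (positive c ≡ false → j ≢ down) → ℤ.+ c′ ≡ ℤ.+ c ℤ.+ ⟦ j ⟧ → Moved j c c′
ℤ⇒Moved stay {c} _ e = trans (ℤP.+-injective e) (+-identityʳ c)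
ℤ⇒Moved up {c} _ e = trans (ℤP.+-injective e) (+-comm c 1)
ℤ⇒Moved down {zero} ok e = ⊥-elim (ok refl refl)
ℤ⇒Moved down {suc c} ok e = cong suc (sym (ℤP.+-injective e))

Moved-positive : ∀ j {c c′} → Moved j c c′ → positive c ≡ false → j ≢ down
Moved-positive down refl () refl

data StepOf {k : ℕ} {Γ Q : Set} (Trans : Q → Γ → Q → Vec Move k → Set) : Γ → Q × Vec ℕ k → Q × Vec ℕ k → Set where
  moving : ∀ {a q cs q′ cs′ js} → Trans q a q′ js →
         (∀ m → Moved (lookup js m) (lookup cs m) (lookup cs′ m)) → StepOf Trans a (q , cs) (q′ , cs′)

record CounterAutomaton (k : ℕ) (Γ : Set) : Set₁ where
  field
    Q        : Set
    finiteQ  : Finite Q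
    Trans    : Q → Γ → Q → Vec Move k → Set
    initial  : Q
    accepting : Q → Bool

  Conf : Set
  Conf = Q × Vec ℕ k

  start : Conf
  start = initial , replicate k 0

  Step : Γ → Conf → Conf → Set
  Step = StepOf Trans

  module _ (finiteΓ : Finite Γ) where

    StepBy : Fin (size finiteΓ) → Conf → Conf → Set
    StepBy a c c′ = Step (dec finiteΓ a) c c′

    Run : ωWord (size finiteΓ) → (ℕ → Conf) → Set
    Run w r = r 0 ≡ start × (∀ i → StepBy (w i) (r i) (r (suc i)))

    Recognised : Lang (size finiteΓ)
    Recognised w = ∃ λ r → Run w r × InfinitelyOften (λ i → accepting (proj₁ (r i)) ≡ true)

    automaton : BüchiBlindCounterAutomaton k (size finiteΓ)
    automaton = record
      { machine = record
          { states = size finiteQ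
          ; Δ = λ q a is q′ js →
              Trans (dec finiteQ q) (dec finiteΓ a) (dec finiteQ q′) js ×
              -- Signs are consulted only to forbid the decrement of zero, so setting a sign keeps a
              -- transition admissible; this is blindness.
              (∀ m → lookup is m ≡ false → lookup js m ≢ down)
          ; q₀ = enc finiteQ initial
          ; no-down = proj₂
          ; blind = λ {q} {a} {is} (t , ok) m _ → t , λ m′ e → ok m′ (unset is m m′ e)
          }
      ; F = tabulate (accepting ∘ dec finiteQ)
      }
      where
      unset : ∀ {n} (is : Vec Bool n) (m m′ : Fin n) → lookup (is Vec.[ m ]≔ true) m′ ≡ false → lookup is m′ ≡ false
      unset (b ∷ is) zero zero ()
      unset (b ∷ is) zero (suc m′) e = e
      unset (b ∷ is) (suc m) zero e = e
      unset (b ∷ is) (suc m) (suc m′) e = unset is m m′ e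

    module _ (em : ∀ {ℓ} → ExcludedMiddle ℓ) where

      open Pigeonhole em

      private
        module A = BüchiBlindCounterAutomaton automaton

        decConf : A.Config → Conf
        decConf (q , cs) = dec finiteQ q , cs

        encConf : Conf → A.Config
        encConf (q , cs) = enc finiteQ q , cs

        dec-encConf : ∀ c → decConf (encConf c) ≡ c
        dec-encConf (q , cs) = cong (_, cs) (dec-enc finiteQ q)

        step-dec : ∀ {a} c c′ → A.Step a c c′ → StepBy a (decConf c) (decConf c′)
        step-dec (q , cs) _ (js , (t , ok) , h) =
          moving t λ m → ℤ⇒Moved (lookup js m) (λ p → ok m (trans (lookup-map m positive cs) p)) (h m)

        dec-step : ∀ {a} c c′ → StepBy a (decConf c) (decConf c′) → A.Step a c c′
        dec-step (q , cs) _ (moving {js = js} t h) =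
          js , (t , λ m p → Moved-positive (lookup js m) (h m) (trans (sym (lookup-map m positive cs)) p)) ,
          λ m → Moved⇒ℤ (lookup js m) (h m)

        ∈F : ∀ q → q Subset.∈ A.F → accepting (dec finiteQ q) ≡ true
        ∈F q q∈ = trans (sym (lookup∘tabulate _ q)) ([]=⇒lookup q∈)

        F∋ : ∀ q → accepting (dec finiteQ q) ≡ true → q Subset.∈ A.F
        F∋ q e = lookup⇒[]= q A.F (trans (lookup∘tabulate _ q) e)

      recognised-r-BCL : r-BCLω k Recognised
      recognised-r-BCL = automaton , to , from
        where
        to : ∀ {w} → Recognised w → A.Accepts w
        to {w} (r , (r0 , step) , inf) with pigeonhole (proj₁ ∘ encConf ∘ r) _ inf
        ... | q , inf′ = encConf ∘ r , (cong encConf r0 , λ i → dec-step (encConf (r i)) (encConf (r (suc i)))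
                (subst₂ (StepBy (w i)) (sym (dec-encConf (r i))) (sym (dec-encConf (r (suc i)))) (step i))) ,
              q , (let (i , _ , a , e) = inf′ 0 in F∋ q (trans (cong (accepting ∘ dec finiteQ) (sym e))
                     (trans (cong accepting (dec-enc finiteQ _)) a))) ,
              λ N → let (i , N≤i , _ , e) = inf′ N in i , N≤i , e
        from : ∀ {w} → A.Accepts w → Recognised w
        from (r , (r0 , step) , q , q∈ , inf) = decConf ∘ r ,
          (trans (cong decConf r0) (dec-encConf start) , λ i → step-dec (r i) (r (suc i)) (step i)) ,
          λ N → let (i , N≤i , e) = inf N in
            i , N≤i , trans (cong (accepting ∘ dec finiteQ) e) (∈F q q∈)

-- Positions in rows, and space-time diagrams

anyUpTo : ℕ → (ℕ → Bool) → Bool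
anyUpTo zero f = false
anyUpTo (suc k) f = anyUpTo k f ∨ f k

-- Row `t` occupies `t + 1` positions: its cells are followed by a separator.
rowStart : ℕ → ℕ
rowStart zero = 0
rowStart (suc t) = rowStart t + suc t

nextPosition : ℕ × ℕ → ℕ × ℕ
nextPosition (t , k) = if k <ᵇ t then (t , suc k) else (suc t , 0)

position : ℕ → ℕ × ℕ
position zero = 0 , 0
position (suc i) = nextPosition (position i)

<⇒<ᵇ≡true : ∀ {k t} → k < t → (k <ᵇ t) ≡ true
<⇒<ᵇ≡true {k} {t} k<t with k <ᵇ t in e
... | true = refl
... | false = ⊥-elim (subst T e (<⇒<ᵇ k<t))

≥⇒<ᵇ≡false : ∀ {k t} → t ≤ k → (k <ᵇ t) ≡ false
≥⇒<ᵇ≡false {k} {t} t≤k with k <ᵇ t in e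
... | false = refl
... | true = ⊥-elim (<⇒≱ (<ᵇ⇒< k t (subst T (sym e) tt)) t≤k)

nextPosition-< : ∀ {t k} → k < t → nextPosition (t , k) ≡ (t , suc k)
nextPosition-< k<t rewrite <⇒<ᵇ≡true k<t = refl

nextPosition-≡ : ∀ t → nextPosition (t , t) ≡ (suc t , 0)
nextPosition-≡ t rewrite ≥⇒<ᵇ≡false (≤-refl {t}) = refl

position-rowStart : ∀ t k → k ≤ t → position (rowStart t + k) ≡ (t , k)
position-rowStart zero zero _ = refl
position-rowStart (suc t) zero _
  rewrite +-identityʳ (rowStart t + suc t) | +-suc (rowStart t) t | position-rowStart t t ≤-refl
  = nextPosition-≡ t
position-rowStart t (suc k) k<t rewrite +-suc (rowStart t) k | position-rowStart t k (<⇒≤ k<t) = nextPosition-< k<t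

rowStart-position : ∀ i → let (t , k) = position i in k ≤ t × rowStart t + k ≡ i
rowStart-position zero = z≤n , refl
rowStart-position (suc i) with position i | rowStart-position i
... | t , k | k≤t , e with m≤n⇒m<n∨m≡n k≤t
... | inj₁ k<t rewrite nextPosition-< k<t = k<t , trans (+-suc _ k) (cong suc e)
... | inj₂ refl rewrite nextPosition-≡ t = z≤n , trans (+-identityʳ _) (trans (+-suc _ t) (cong suc e))

rowStart-mono : ∀ {s t} → s ≤ t → rowStart s ≤ rowStart t
rowStart-mono {s} {t} s≤t = go (≤⇒≤′ s≤t)
  where
  go : ∀ {t} → s ℕ.≤′ t → rowStart s ≤ rowStart t
  go ≤′-refl = ≤-refl
  go (≤′-step p) = ≤-trans (go p) (m≤m+n _ _)

row-≥ : ∀ N t k → k ≤ t → rowStart N ≤ rowStart t + k → N ≤ t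
row-≥ N t k k≤t h = ≮⇒≥ λ t<N → <⇒≱
  (<-≤-trans (+-monoʳ-< (rowStart t) (s≤s k≤t)) (rowStart-mono t<N)) h

-- The space-time diagrams of a one-dimensional cellular automaton whose global state is updated by
-- an existential test of the current row.  Row t has t cells, the k-th of which holds the letter x k.
record RowSystem (n : ℕ) : Set₁ where
  field
    Control     : Set
    Content     : Set
    finControl  : Finite Control
    finContent  : Finite Content
    control₀    : Control
    guard       : Control → Fin n → Content → Bool
    next        : Control → Bool → Control
    content     : Control → Maybe Content → Maybe Content → Content
    announcing  : Control → Bool
    source target : Content → Bool
    someLetter  : Fin n

  Letter : Set
  Letter = Maybe (Fin n × Content)

  finLetter : Finite Letter
  finLetter = Maybe-finite (×-finite (Fin-finite n) finContent)

  module _ (x : ωWord n) where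

    -- Contents are defined for all `k` but belong to row `t` only for `k < t`. The values beyond
    -- never influence a row: `midOf` cuts them off, and the left neighbour of a cell of row `t + 1`
    -- lies in row `t`.
    cellControl : ℕ → Control × (ℕ → Content)
    controlAt : ℕ → Control
    contentAt : ℕ → ℕ → Content
    leftOf midOf : ℕ → ℕ → Maybe Content

    leftOf t zero = nothing
    leftOf t (suc k) = just (contentAt t k)

    midOf t k = if k <ᵇ t then just (contentAt t k) else nothing

    controlAt t = proj₁ (cellControl t)
    contentAt t = proj₂ (cellControl t)

    cellControl zero = control₀ , λ _ → content control₀ nothing nothing
    cellControl (suc t) =
      next (controlAt t) (anyUpTo t λ k → guard (controlAt t) (x k) (contentAt t k)) ,
      λ k → content (controlAt t) (leftOf t k) (midOf t k)

    letterAt : ℕ → ℕ → Letter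
    letterAt t k = if k <ᵇ t then just (x k , contentAt t k) else nothing

    diagram : ℕ → Letter
    diagram i = let (t , k) = position i in letterAt t k

    letterAt-< : ∀ {t k} → k < t → letterAt t k ≡ just (x k , contentAt t k)
    letterAt-< k<t rewrite <⇒<ᵇ≡true k<t = refl

    letterAt-≡ : ∀ t → letterAt t t ≡ nothing
    letterAt-≡ t rewrite ≥⇒<ᵇ≡false (≤-refl {t}) = refl

    midOf≡ : ∀ t k → Maybe.map proj₂ (letterAt t k) ≡ midOf t k
    midOf≡ t k with k <ᵇ t
    ... | true = refl
    ... | false = refl

    diagram-rowStart : ∀ t k → k ≤ t → diagram (rowStart t + k) ≡ letterAt t k
    diagram-rowStart t k k≤t = cong (λ (t , k) → letterAt t k) (position-rowStart t k k≤t)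

    -- A pointer that stays in place from row to row, except that in announcing rows it may jump from a
    -- source cell to a target cell, which it does infinitely often.
    record Walk : Set where
      field
        pointer : ℕ → ℕ
        jumps   : ℕ → Bool
        begin   : pointer 0 ≡ 0
        inRow   : ∀ t → pointer (suc t) ≤ t
        stays   : ∀ t → jumps t ≡ false → pointer (suc t) ≡ pointer t
        jump    : ∀ t → jumps t ≡ true → announcing (controlAt t) ≡ true ×
                  (pointer t < t × source (contentAt t (pointer t)) ≡ true) ×
                  (pointer (suc t) < t × target (contentAt t (pointer (suc t))) ≡ true)
        often   : InfinitelyOften (λ t → jumps t ≡ true)

-- The pointer automaton

data Tag : Set where
  bef at aft : Tag

-- A `free` pointer is unconstrained from row to row and serves to detect errors. As it remains
-- free, such a run can be accepted only through the sink.
data Kind : Set where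
  staying jumping free : Kind

data Flag : Bool → Tag → Bool → Set where
  bef : Flag false bef false
  at  : Flag false at true
  aft : Flag true aft true

arrange : ∀ {A : Set} → Bool → A → A → A → A → Vec A 4
arrange false p q p′ q′ = p ∷ q ∷ p′ ∷ q′ ∷ []
arrange true  p q p′ q′ = p′ ∷ q′ ∷ p ∷ q ∷ []

arrange-not : ∀ {A : Set} par {p q p′ q′ : A} → arrange (not par) p′ q′ p q ≡ arrange par p q p′ q′
arrange-not false = refl
arrange-not true = refl

-- The letter at the new pointer is recorded in Q′, whereas the letter at the old pointer consumes
-- nothing: this makes up for the one letter by which a row exceeds its predecessor.
oldP oldQ newP newQ : Tag → Move
oldP bef = down
oldP _ = stay
oldQ aft = down
oldQ _ = stay
newP bef = up
newP _ = stay
newQ bef = stay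
newQ _ = up

-- The automaton guesses a pointer in every row.  Of the four counters, P and Q hold the numbers of
-- letters of the previous row before its pointer and from its pointer on; they are consumed along the
-- present row by the letters before and after its old pointer, whose positions therefore agree as soon
-- as the present row is longer by one.  Meanwhile P′ and Q′ record the new pointer, and the two pairs
-- are exchanged at the end of the row.
module PointerAutomaton (em : ∀ {ℓ} → ExcludedMiddle ℓ) {n : ℕ} (R : RowSystem n) where

  open RowSystem R

  -- What the cell below the pointer must hold in the next row. Its letter is left open below the
  -- separator, where the next row is extended by a new letter of the oracle.
  Expectation : Set
  Expectation = Maybe (Fin n) × Content

  expect : Control → Maybe Content → Letter → Expectation
  expect c prev L = Maybe.map proj₁ L , content c prev (Maybe.map proj₂ L)

  Meets : Expectation → Letter → Set
  Meets (a? , b) nothing = ⊥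
  Meets (a? , b) (just (a , b′)) = (∀ a′ → a? ≡ just a′ → a ≡ a′) × b′ ≡ b

  Violates : Maybe Expectation → Letter → Set
  Violates ex L = ∃ λ e → ex ≡ just e × ¬ Meets e L

  violates : Maybe Expectation → Letter → Bool
  violates ex L = ⌊ em {P = Violates ex L} ⌋

  -- `par` tells which pair of counters is the old one, `test` accumulates the existential test of
  -- the row, `past` tells whether the old pointer has been passed and `err` whether the letter
  -- there violated `ex`; `nx` is the expectation formed at the new pointer.
  record St : Set where
    constructor st
    field
      par  : Bool
      kind : Kind
      ctrl : Control
      test : Bool
      past : Bool
      err  : Bool
      prev : Maybe Content
      ex   : Maybe Expectation
      nx   : Maybe Expectation

  Kind-finite : Finite Kind
  Kind-finite = retract (λ { staying → nothing ; jumping → just true ; free → just false })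
    (λ { nothing → staying ; (just true) → jumping ; (just false) → free })
    (λ { staying → refl ; jumping → refl ; free → refl }) (Maybe-finite Bool-finite)

  St-finite : Finite St
  St-finite = retract
    (λ (st a b c d e f g h i) → a , b , c , d , e , f , g , h , i)
    (λ (a , b , c , d , e , f , g , h , i) → st a b c d e f g h i) (λ _ → refl)
    (×-finite Bool-finite (×-finite Kind-finite (×-finite finControl (×-finite Bool-finite
      (×-finite Bool-finite (×-finite Bool-finite (×-finite (Maybe-finite finContent)
      (×-finite fex fex))))))))
    where
    fex : Finite (Maybe Expectation)
    fex = Maybe-finite (×-finite (Maybe-finite (Fin-finite n)) finContent)

  data Choose (c : Control) (prev : Maybe Content) (L : Letter) : Maybe Expectation → Tag → Maybe Expectation → Set where
    bef : Choose c prev L nothing bef nothing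
    at  : Choose c prev L nothing at (just (expect c prev L))
    aft : ∀ {e} → Choose c prev L (just e) aft (just e)

  Marked : (Content → Bool) → Letter → Set
  Marked J L = ∃ λ a → ∃ λ b → L ≡ just (a , b) × J b ≡ true

  Allowed : Kind → Tag → Tag → Letter → Set
  Allowed free to tn L = ⊤
  Allowed staying to tn L = to ≡ tn
  Allowed jumping to tn L = (to ≡ at → Marked source L) × (tn ≡ at → Marked target L)

  errAfter : Bool → Tag → Maybe Expectation → Letter → Bool
  errAfter err at ex L = violates ex L
  errAfter err _ ex L = err

  NextKind : Kind → Control → Kind → Set
  NextKind free c κ = κ ≡ free
  NextKind _ c jumping = announcing c ≡ true
  NextKind _ c _ = ⊤

  moves : Bool → Tag → Tag → Vec Move 4
  moves par to tn = arrange par (oldP to) (oldQ to) (newP tn) (newQ tn)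

  -- A violation leads to the sink only at the separator, since the counters certify the place of
  -- the tested letter only when the whole row has been consumed. `row` also demands that both
  -- pointers have been placed.
  data Trans : Maybe St → Letter → Maybe St → Vec Move 4 → Set where
    read : ∀ {par κ c g o o′ err prev ex nx nx′ x b} to tn →
           Flag o to o′ → Choose c prev (just (x , b)) nx tn nx′ →
           Allowed κ to tn (just (x , b)) →
           Trans (just (st par κ c g o err prev ex nx)) (just (x , b))
                 (just (st par κ c (g ∨ guard c x b) o′ (errAfter err to ex (just (x , b))) (just b) ex nx′))
                 (moves par to tn)
    row  : ∀ {par κ κ′ c g o err prev ex nx e} to tn →
           Flag o to true → Choose c prev nothing nx tn (just e) →
           Allowed κ to tn nothing → NextKind κ (next c g) κ′ →
           Trans (just (st par κ c g o err prev ex nx)) nothing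
                 (just (st (not par) κ′ (next c g) false false false nothing (just e) nothing))
                 (moves par to tn)
    fail : ∀ {par κ c g o err prev ex nx} to tn →
           Flag o to true → errAfter err to ex nothing ≡ true →
           Trans (just (st par κ c g o err prev ex nx)) nothing nothing (moves par to tn)
    sink : ∀ {L} → Trans nothing L nothing (replicate 4 stay)

  initialSt : St
  initialSt = st false staying control₀ false false false nothing nothing nothing

  isJumping : Kind → Bool
  isJumping jumping = true
  isJumping _ = false

  pointerAutomaton : CounterAutomaton 4 Letter
  pointerAutomaton = record
    { Q = Maybe St
    ; finiteQ = Maybe-finite St-finite
    ; Trans = Trans
    ; initial = just initialSt
    ; accepting = λ { nothing → true ; (just s) → isJumping (St.kind s) }
    }

  open CounterAutomaton pointerAutomaton public using (Conf; start; Step; accepting)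

  conf : St → (P Q P′ Q′ : ℕ) → Conf
  conf s P Q P′ Q′ = just s , arrange (St.par s) P Q P′ Q′

  AllMoved : Vec Move 4 → Vec ℕ 4 → Vec ℕ 4 → Set
  AllMoved js cs cs′ = ∀ m → Moved (lookup js m) (lookup cs m) (lookup cs′ m)

  record Counted (par : Bool) (to tn : Tag) (P Q P′ Q′ : ℕ) (cs : Vec ℕ 4) : Set where
    constructor counted
    field
      {P₁ Q₁ P₁′ Q₁′} : ℕ
      result : cs ≡ arrange par P₁ Q₁ P₁′ Q₁′
      movedP  : Moved (oldP to) P P₁
      movedQ  : Moved (oldQ to) Q Q₁
      movedP′ : Moved (newP tn) P′ P₁′
      movedQ′ : Moved (newQ tn) Q′ Q₁′

  count : ∀ par to tn {P Q P′ Q′ cs} → AllMoved (moves par to tn) (arrange par P Q P′ Q′) cs →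
          Counted par to tn P Q P′ Q′ cs
  count false to tn {cs = p ∷ q ∷ p′ ∷ q′ ∷ []} h =
    counted refl (h zero) (h (suc zero)) (h (suc (suc zero))) (h (suc (suc (suc zero))))
  count true to tn {cs = p′ ∷ q′ ∷ p ∷ q ∷ []} h =
    counted refl (h (suc (suc zero))) (h (suc (suc (suc zero)))) (h zero) (h (suc zero))

  allMoved : ∀ par to tn {P Q P′ Q′ P₁ Q₁ P₁′ Q₁′} →
             Moved (oldP to) P P₁ → Moved (oldQ to) Q Q₁ → Moved (newP tn) P′ P₁′ → Moved (newQ tn) Q′ Q₁′ →
             AllMoved (moves par to tn) (arrange par P Q P′ Q′) (arrange par P₁ Q₁ P₁′ Q₁′)
  allMoved false to tn a b c d zero = a
  allMoved false to tn a b c d (suc zero) = b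
  allMoved false to tn a b c d (suc (suc zero)) = c
  allMoved false to tn a b c d (suc (suc (suc zero))) = d
  allMoved true to tn a b c d zero = c
  allMoved true to tn a b c d (suc zero) = d
  allMoved true to tn a b c d (suc (suc zero)) = a
  allMoved true to tn a b c d (suc (suc (suc zero))) = b

-- Invariants along a row

data Advance (k : ℕ) : Maybe ℕ → Tag → Maybe ℕ → Set where
  bef : Advance k nothing bef nothing
  at  : Advance k nothing at (just k)
  aft : ∀ {b} → Advance k (just b) aft (just b)

advance-unique : ∀ {k m t m₁ m₂} → Advance k m t m₁ → Advance k m t m₂ → m₁ ≡ m₂
advance-unique bef bef = refl
advance-unique at at = refl
advance-unique aft aft = refl

-- `P₀` and `Q₀` are the contents at the beginning of the row, `b` is the place at which the run
-- claims its old pointer. The `suc` accounts for the letter there, which consumes nothing.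
data OldTrack (k P₀ Q₀ : ℕ) : Bool → Maybe ℕ → (P Q : ℕ) → Set where
  before : ∀ {P} → P + k ≡ P₀ → OldTrack k P₀ Q₀ false nothing P Q₀
  after  : ∀ {b P Q} → b < k → P + b ≡ P₀ → Q + k ≡ suc (Q₀ + b) → OldTrack k P₀ Q₀ true (just b) P Q

oldTrack-step : ∀ {k P₀ Q₀ o m P Q to o′ P₁ Q₁} → OldTrack k P₀ Q₀ o m P Q → Flag o to o′ →
  Moved (oldP to) P P₁ → Moved (oldQ to) Q Q₁ →
  ∃ λ m′ → Advance k m to m′ × OldTrack (suc k) P₀ Q₀ o′ m′ P₁ Q₁
oldTrack-step {k} {P₁ = P₁} (before e) bef refl refl = nothing , bef , before (trans (+-suc P₁ k) e)
oldTrack-step {k} {Q₀ = Q₀} (before e) at refl refl = just k , at , after ≤-refl e (+-suc Q₀ k)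
oldTrack-step {k} {Q₁ = Q₁} (after b<k e f) aft refl refl = _ , aft , after (m<n⇒m<1+n b<k) e (trans (+-suc Q₁ k) f)

-- That `P` is not negative gives `b ≤ P₀`, that `Q` is not negative gives `P₀ ≤ b`: on a row of
-- known length two blocking counters amount to a test for equality.
oldTrack-end : ∀ {t P₀ Q₀ b P Q} → P₀ + Q₀ ≡ t → OldTrack (suc t) P₀ Q₀ true (just b) P Q →
               b ≡ P₀ × P ≡ 0 × Q ≡ 0
oldTrack-end {t} {P₀} {Q₀} {b} {P} {Q} refl (after _ e f) = b≡P₀ , P≡0 , Q≡0
  where
  Q+P₀≡b : Q + P₀ ≡ b
  Q+P₀≡b = +-cancelʳ-≡ Q₀ (Q + P₀) b (trans (+-assoc Q P₀ Q₀)
    (trans (suc-injective (trans (sym (+-suc Q (P₀ + Q₀))) f)) (+-comm Q₀ b)))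
  b≡P₀ : b ≡ P₀
  b≡P₀ = ≤-antisym (subst (b ≤_) e (m≤n+m b P)) (subst (P₀ ≤_) Q+P₀≡b (m≤n+m P₀ Q))
  P≡0 : P ≡ 0
  P≡0 = +-cancelʳ-≡ b P 0 (trans e (sym b≡P₀))
  Q≡0 : Q ≡ 0
  Q≡0 = +-cancelʳ-≡ P₀ Q 0 (trans Q+P₀≡b b≡P₀)

-- A row that exceeds its predecessor by more than one letter exhausts the old pair of counters.
oldTrack-long : ∀ {t P₀ Q₀ o m P Q to o′ P₁ Q₁} → P₀ + Q₀ ≡ t → OldTrack (suc t) P₀ Q₀ o m P Q →
                Flag o to o′ → Moved (oldP to) P P₁ → ¬ Moved (oldQ to) Q Q₁
oldTrack-long {t} {P₀} {Q₀} {P = P} refl (before e) f _ _ =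
  <⇒≱ (≤-trans (s≤s (m≤m+n P₀ Q₀)) (m≤n+m (suc (P₀ + Q₀)) P)) (≤-reflexive e)
oldTrack-long e o@(after _ _ _) aft _ mq with oldTrack-end e o
... | _ , _ , refl with mq
... | ()

module PointerInvariant (em : ∀ {ℓ} → ExcludedMiddle ℓ) {n : ℕ} (R : RowSystem n) where

  open RowSystem R
  open PointerAutomaton em R public

  module _ (x : ωWord n) where

    expectAt : ℕ → ℕ → Expectation
    expectAt t k = expect (controlAt x t) (leftOf x t k) (letterAt x t k)

    testUpTo : ℕ → ℕ → Bool
    testUpTo t k = anyUpTo k λ k → guard (controlAt x t) (x k) (contentAt x t k)

    meets : ∀ t k → k ≤ t → Meets (expectAt t k) (letterAt x (suc t) k)
    meets t k k≤t rewrite letterAt-< x (s≤s k≤t) = same , cong (content (controlAt x t) (leftOf x t k)) (sym (midOf≡ x t k))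
      where
      same : ∀ a′ → Maybe.map proj₁ (letterAt x t k) ≡ just a′ → x k ≡ a′
      same a′ e with k <ᵇ t
      same a′ refl | true = refl

    Expected : ℕ → ℕ → Maybe Expectation → Set
    Expected zero P₀ ex = ex ≡ nothing
    Expected (suc t) P₀ ex = P₀ ≤ t × ex ≡ just (expectAt t P₀)

    expected-met : ∀ t {P₀ ex} → Expected t P₀ ex → violates ex (letterAt x t P₀) ≡ false
    expected-met t {P₀} {ex} h with em {P = Violates ex (letterAt x t P₀)}
    ... | no _ = refl
    expected-met zero refl | yes (e , () , _)
    expected-met (suc t) (P₀≤t , refl) | yes (e , refl , ¬m) = ⊥-elim (¬m (meets t _ P₀≤t))

    data NewTrack (t k : ℕ) : Maybe Expectation → Maybe ℕ → (P′ Q′ : ℕ) → Set where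
      before : NewTrack t k nothing nothing k 0
      after  : ∀ {p Q′} → p < k → Q′ + p ≡ k → NewTrack t k (just (expectAt t p)) (just p) p Q′

    newTrack-step : ∀ {t k L nx m P′ Q′ tn nx′ P₁′ Q₁′} → NewTrack t k nx m P′ Q′ → L ≡ letterAt x t k →
      Choose (controlAt x t) (leftOf x t k) L nx tn nx′ →
      Moved (newP tn) P′ P₁′ → Moved (newQ tn) Q′ Q₁′ →
      ∃ λ m′ → Advance k m tn m′ × NewTrack t (suc k) nx′ m′ P₁′ Q₁′
    newTrack-step before _ bef refl refl = _ , bef , before
    newTrack-step before refl at refl refl = _ , at , after ≤-refl refl
    newTrack-step (after p<k e) _ aft refl refl = _ , aft , after (m<n⇒m<1+n p<k) (cong suc e)

    HoldsAt : (Content → Bool) → ℕ → Maybe ℕ → Set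
    HoldsAt J t m = ∀ b → m ≡ just b → b < t × J (contentAt x t b) ≡ true

    Link : Kind → ℕ → Maybe ℕ → Maybe ℕ → Set
    Link free t mo mn = ⊤
    Link staying t mo mn = mo ≡ mn
    Link jumping t mo mn = announcing (controlAt x t) ≡ true × HoldsAt source t mo × HoldsAt target t mn

    marked : ∀ J {t k} → Marked J (letterAt x t k) → k < t × J (contentAt x t k) ≡ true
    marked J {t} {k} (a , b , e , j) with k <ᵇ t in k<t
    marked J {t} {k} (a , b , refl , j) | true = <ᵇ⇒< k t (subst T (sym k<t) tt) , j

    holdsAt-step : ∀ J {t k m tag m′} → HoldsAt J t m → Advance k m tag m′ →
                   (tag ≡ at → Marked J (letterAt x t k)) → HoldsAt J t m′
    holdsAt-step J h at mk b refl = marked J (mk refl)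
    holdsAt-step J h aft mk b e = h b e

    link-step : ∀ κ {t k mo mn to tn mo′ mn′} → Link κ t mo mn → Allowed κ to tn (letterAt x t k) →
                Advance k mo to mo′ → Advance k mn tn mn′ → Link κ t mo′ mn′
    link-step free _ _ _ _ = tt
    link-step staying refl refl a b = advance-unique a b
    link-step jumping (c , h , h′) (f , f′) a b =
      c , holdsAt-step source h a f , holdsAt-step target h′ b f′

    -- On a correct diagram an error is registered only at a misplaced pointer, and by
    -- `oldTrack-end` a misplaced pointer does not survive the row.
    Wrong : ℕ → Bool → Maybe ℕ → Set
    Wrong P₀ err m = err ≡ true → ∃ λ b → m ≡ just b × b ≢ P₀

    wrong-step : ∀ {t k P₀ ex err m to m′} → Expected t P₀ ex → Wrong P₀ err m → Advance k m to m′ →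
                 Wrong P₀ (errAfter err to ex (letterAt x t k)) m′
    wrong-step h w bef e = case w e of λ ()
    wrong-step {t} {k} h w at e = k , refl , λ { refl → case trans (sym e) (expected-met t h) of λ () }
    wrong-step h w aft e = w e

    -- The invariant of all runs on a correct diagram before letter `k` of row `t`. The true old
    -- pointer is `P₀`; `mo` and `mn` are the claimed places of the old and the new pointer.
    record Mid (t k P₀ : ℕ) (κ : Kind) (c : Conf) : Set where
      constructor mid
      field
        {par o err} : Bool
        {ex nx} : Maybe Expectation
        {P Q P′ Q′ Q₀} : ℕ
        {mo mn} : Maybe ℕ
        shape : c ≡ conf (st par κ (controlAt x t) (testUpTo t k) o err (leftOf x t k) ex nx) P Q P′ Q′
        total : P₀ + Q₀ ≡ t
        expected : Expected t P₀ ex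
        old : OldTrack k P₀ Q₀ o mo P Q
        new : NewTrack t k nx mn P′ Q′
        wrong : Wrong P₀ err mo
        link : Link κ t mo mn

    mid-start : Mid 0 0 0 staying start
    mid-start = mid refl refl refl (before refl) before (λ ()) refl

    record RowEnd (t P₀ : ℕ) (κ : Kind) (P₀′ : ℕ) (κ′ : Kind) : Set where
      field
        inRow : P₀′ ≤ t
        ifStaying : κ ≡ staying → P₀′ ≡ P₀
        ifJumping : κ ≡ jumping → announcing (controlAt x t) ≡ true ×
          (P₀ < t × source (contentAt x t P₀) ≡ true) × (P₀′ < t × target (contentAt x t P₀′) ≡ true)
        ifFree : κ ≡ free → κ′ ≡ free

    mid-step : ∀ {t k P₀ κ L c c′} → Mid t k P₀ κ c → k < t → L ≡ letterAt x t k → Step L c c′ →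
               Mid t (suc k) P₀ κ c′
    mid-step {t} {k} {c′ = q , cs′} (mid {par} refl total expected old new wrong link) k<t eL
             (moving (read {b = b} to tn f ch al) mv)
      with count par to tn {cs = cs′} mv | trans eL (letterAt-< x k<t)
    mid-step {t} {k} {κ = κ} (mid {par} refl total expected old new wrong link) k<t eL
             (moving (read to tn f ch al) mv)
      | counted refl a b c d | refl =
      let (mo′ , adv , old′) = oldTrack-step old f a b
          (mn′ , adv′ , new′) = newTrack-step new eL ch c d
          al′ = subst (Allowed κ to tn) eL al
      in mid refl total expected old′ new′
           (subst (λ L → Wrong _ (errAfter _ to _ L) mo′) (sym eL) (wrong-step expected wrong adv))
           (link-step κ link al′ adv adv′)
    mid-step {t} {k} (mid refl _ _ _ _ _ _) k<t eL (moving (row _ _ _ _ _ _) _) = case trans eL (letterAt-< x k<t) of λ ()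
    mid-step {t} {k} (mid refl _ _ _ _ _ _) k<t eL (moving (fail _ _ _ _) _) = case trans eL (letterAt-< x k<t) of λ ()

    mid-end : ∀ {t P₀ κ L c c′} → Mid t t P₀ κ c → L ≡ letterAt x t t → Step L c c′ →
              ∃₂ λ P₀′ κ′ → Mid (suc t) 0 P₀′ κ′ c′ × RowEnd t P₀ κ P₀′ κ′
    mid-end {t} (mid refl _ _ _ _ _ _) eL (moving (read _ _ _ _ _) _) = case trans eL (letterAt-≡ x t) of λ ()
    mid-end {t} {c′ = q , cs′} (mid {par} refl total expected old new wrong link) eL
            (moving (row to tn f ch al nk) mv)
      with count par to tn {cs = cs′} mv
    mid-end {t} {P₀} {κ} (mid {par} refl total expected old new wrong link) eL
            (moving (row {κ′ = κ′} to tn f ch al nk) mv) | counted refl a b c d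
      with oldTrack-step old f a b | newTrack-step new eL ch c d
    ... | .(just _) , adv , old′@(after _ _ _) | .(just _) , adv′ , new′@(after {p} p<1+t e)
      with oldTrack-end total old′ | link-step κ link (subst (Allowed κ to tn) eL al) adv adv′
    ... | refl , refl , refl | link′ = p , κ′ ,
      mid (cong₂ _,_ refl (sym (arrange-not par))) (trans (+-comm p _) e) (≤-pred p<1+t , refl)
          (before (+-identityʳ p)) before (λ ()) (nextLink κ κ′ nk) ,
      record { inRow = ≤-pred p<1+t ; ifStaying = stayed κ link′ ; ifJumping = jumped κ link′ ; ifFree = freed κ nk }
      where
      nextLink : ∀ κ κ′ → NextKind κ (controlAt x (suc t)) κ′ → Link κ′ (suc t) nothing nothing
      nextLink κ staying _ = refl
      nextLink κ free _ = tt
      nextLink staying jumping ann = ann , (λ _ ()) , (λ _ ())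
      nextLink jumping jumping ann = ann , (λ _ ()) , (λ _ ())
      stayed : ∀ κ → Link κ t (just P₀) (just p) → κ ≡ staying → p ≡ P₀
      stayed staying refl _ = refl
      jumped : ∀ κ → Link κ t (just P₀) (just p) → κ ≡ jumping → _
      jumped jumping (ann , h , h′) _ = ann , h P₀ refl , h′ p refl
      freed : ∀ κ → NextKind κ (controlAt x (suc t)) κ′ → κ ≡ free → κ′ ≡ free
      freed free e _ = e
    mid-end {t} {c′ = q , cs′} (mid {par} refl total expected old new wrong link) eL
            (moving (fail to tn f e) mv) with count par to tn {cs = cs′} mv
    ... | counted refl a b c d with oldTrack-step old f a b
    ... | .(just _) , adv , old′@(after _ _ _)
      with oldTrack-end total old′ | wrong-step expected wrong adv (trans (cong (errAfter _ to _) (sym eL)) e)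
    ... | b≡P₀ , _ | b , refl , b≢P₀ = ⊥-elim (b≢P₀ b≡P₀)

-- Runs with prescribed pointers

∸-pred : ∀ {m n} → m < n → n ∸ m ≡ suc (n ∸ suc m)
∸-pred m<n = +-∸-assoc 1 m<n

data TagView (p k : ℕ) : Tag → Set where
  bef : k < p → TagView p k bef
  at  : k ≡ p → TagView p k at
  aft : p < k → TagView p k aft

tagOf : ℕ → ℕ → Tag
tagOf p k with <-cmp k p
... | tri< _ _ _ = bef
... | tri≈ _ _ _ = at
... | tri> _ _ _ = aft

tagView : ∀ p k → TagView p k (tagOf p k)
tagView p k with <-cmp k p
... | tri< k<p _ _ = bef k<p
... | tri≈ _ k≡p _ = at k≡p
... | tri> _ _ p<k = aft p<k

flag-tag : ∀ {p k tag} → TagView p k tag → Flag (p <ᵇ k) tag (p <ᵇ suc k)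
flag-tag {p} {k} (bef k<p) rewrite ≥⇒<ᵇ≡false (<⇒≤ k<p) | ≥⇒<ᵇ≡false k<p = bef
flag-tag {p} (at refl) rewrite ≥⇒<ᵇ≡false (≤-refl {p}) | <⇒<ᵇ≡true (n<1+n p) = at
flag-tag {p} (aft p<k) rewrite <⇒<ᵇ≡true p<k | <⇒<ᵇ≡true (m<n⇒m<1+n p<k) = aft

movedP-tag : ∀ {p k tag} → TagView p k tag → Moved (oldP tag) (p ∸ k) (p ∸ suc k)
movedP-tag (bef k<p) = ∸-pred k<p
movedP-tag {p} (at refl) = trans (m≤n⇒m∸n≡0 (n≤1+n p)) (sym (n∸n≡0 p))
movedP-tag {p} {k} (aft p<k) = trans (m≤n⇒m∸n≡0 (m≤n⇒m≤1+n (<⇒≤ p<k))) (sym (m≤n⇒m∸n≡0 (<⇒≤ p<k)))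

movedQ-tag : ∀ {t p k tag} → k ≤ t → TagView p k tag →
             Moved (oldQ tag) ((t ∸ p) ∸ (k ∸ suc p)) ((t ∸ p) ∸ (k ∸ p))
movedQ-tag {t} {p} {k} _ (bef k<p) = cong ((t ∸ p) ∸_)
  (trans (m≤n⇒m∸n≡0 (<⇒≤ k<p)) (sym (m≤n⇒m∸n≡0 (m≤n⇒m≤1+n (<⇒≤ k<p)))))
movedQ-tag {t} {p} _ (at refl) = cong ((t ∸ p) ∸_)
  (trans (n∸n≡0 p) (sym (m≤n⇒m∸n≡0 (n≤1+n p))))
movedQ-tag {t} {p} {k} k≤t (aft p<k) rewrite ∸-pred p<k =
  ∸-pred (≤-trans (≤-reflexive (sym (∸-pred p<k))) (∸-monoˡ-≤ p k≤t))

movedP′-tag : ∀ {p k tag} → TagView p k tag → Moved (newP tag) (k ⊓ p) (suc k ⊓ p)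
movedP′-tag (bef k<p) = trans (m≤n⇒m⊓n≡m k<p) (cong suc (sym (m≤n⇒m⊓n≡m (<⇒≤ k<p))))
movedP′-tag {p} (at refl) = trans (m≥n⇒m⊓n≡n (n≤1+n p)) (sym (⊓-idem p))
movedP′-tag (aft p<k) = trans (m≥n⇒m⊓n≡n (m≤n⇒m≤1+n (<⇒≤ p<k))) (sym (m≥n⇒m⊓n≡n (<⇒≤ p<k)))

movedQ′-tag : ∀ {p k tag} → TagView p k tag → Moved (newQ tag) (k ∸ p) (suc k ∸ p)
movedQ′-tag (bef k<p) = trans (m≤n⇒m∸n≡0 k<p) (sym (m≤n⇒m∸n≡0 (<⇒≤ k<p)))
movedQ′-tag {p} (at refl) = +-∸-assoc 1 (≤-refl {p})
movedQ′-tag (aft p<k) = +-∸-assoc 1 (<⇒≤ p<k)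

module PointerRuns (em : ∀ {ℓ} → ExcludedMiddle ℓ) {n : ℕ} (R : RowSystem n) where

  open RowSystem R
  open PointerInvariant em R public

  read-step : ∀ {par κ c g o o′ err err′ prev ex nx nx′ x b L P Q P′ Q′ P₁ Q₁ P₁′ Q₁′} to tn →
    L ≡ just (x , b) → Flag o to o′ → Choose c prev L nx tn nx′ → Allowed κ to tn L →
    errAfter err to ex L ≡ err′ →
    AllMoved (moves par to tn) (arrange par P Q P′ Q′) (arrange par P₁ Q₁ P₁′ Q₁′) →
    Step L (conf (st par κ c g o err prev ex nx) P Q P′ Q′)
           (conf (st par κ c (g ∨ guard c x b) o′ err′ (just b) ex nx′) P₁ Q₁ P₁′ Q₁′)
  read-step {par} to tn refl f ch al refl mv = moving (read to tn f ch al) mv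

  row-step : ∀ {par κ κ′ c g o o′ err prev ex nx nx′ e L P Q P′ Q′ cs p q z} to tn →
    L ≡ nothing → Flag o to o′ → o′ ≡ true → Choose c prev L nx tn nx′ → nx′ ≡ just e →
    Allowed κ to tn L → NextKind κ (next c g) κ′ →
    AllMoved (moves par to tn) (arrange par P Q P′ Q′) cs → cs ≡ arrange (not par) p q 0 z →
    Step L (conf (st par κ c g o err prev ex nx) P Q P′ Q′)
           (conf (st (not par) κ′ (next c g) false false false nothing (just e) nothing) p q 0 z)
  row-step {par} to tn refl f refl ch refl al nk mv refl = moving (row to tn f ch al nk) mv

  -- A prescribed sequence of pointers: pointer t is the old pointer of row t.
  module Prescribed (x : ωWord n) (pointer : ℕ → ℕ) (kind : ℕ → Kind)
                    (begin : pointer 0 ≡ 0) (kind₀ : kind 0 ≡ staying)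
                    (inRow : ∀ t → pointer (suc t) ≤ t)
                    (nextKind : ∀ t → NextKind (kind t) (controlAt x (suc t)) (kind (suc t)))
                    (stays : ∀ t → kind t ≡ staying → pointer (suc t) ≡ pointer t)
                    (jump : ∀ t → kind t ≡ jumping →
                      (pointer t < t × source (contentAt x t (pointer t)) ≡ true) ×
                      (pointer (suc t) < t × target (contentAt x t (pointer (suc t))) ≡ true)) where

    parity : ℕ → Bool
    parity zero = false
    parity (suc t) = not (parity t)

    expected : ℕ → Maybe Expectation
    expected zero = nothing
    expected (suc t) = just (expectAt x t (pointer (suc t)))

    expected-Expected : ∀ t → Expected x t (pointer t) (expected t)
    expected-Expected zero = refl
    expected-Expected (suc t) = inRow t , refl

    chosen : ℕ → ℕ → Maybe Expectation
    chosen t k = if pointer (suc t) <ᵇ k then just (expectAt x t (pointer (suc t))) else nothing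

    confWith : Bool → ℕ → ℕ → Conf
    confWith err t k = conf
      (st (parity t) (kind t) (controlAt x t) (testUpTo x t k) (pointer t <ᵇ k) err (leftOf x t k)
          (expected t) (chosen t k))
      -- Truncated subtraction keeps the first counter at zero past the pointer, and the second one
      -- untouched up to and including the pointer.
      (pointer t ∸ k) ((t ∸ pointer t) ∸ (k ∸ suc (pointer t)))
      (k ⊓ pointer (suc t)) (k ∸ pointer (suc t))

    confAt : ℕ → ℕ → Conf
    confAt = confWith false

    oldTag newTag : ℕ → ℕ → Tag
    oldTag t k = tagOf (pointer t) k
    newTag t k = tagOf (pointer (suc t)) k

    choose-tag : ∀ t k → Choose (controlAt x t) (leftOf x t k) (letterAt x t k)
                                (chosen t k) (newTag t k) (chosen t (suc k))
    choose-tag t k with newTag t k | tagView (pointer (suc t)) k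
    ... | _ | bef k<p rewrite ≥⇒<ᵇ≡false (<⇒≤ k<p) | ≥⇒<ᵇ≡false k<p = bef
    ... | _ | at refl rewrite ≥⇒<ᵇ≡false (≤-refl {k}) | <⇒<ᵇ≡true (n<1+n k) = at
    ... | _ | aft p<k rewrite <⇒<ᵇ≡true p<k | <⇒<ᵇ≡true (m<n⇒m<1+n p<k) = aft

    moved-tag : ∀ t k → k ≤ t → AllMoved (moves (parity t) (oldTag t k) (newTag t k))
      (proj₂ (confAt t k))
      (arrange (parity t) (pointer t ∸ suc k) ((t ∸ pointer t) ∸ (k ∸ pointer t))
                          (suc k ⊓ pointer (suc t)) (suc k ∸ pointer (suc t)))
    moved-tag t k k≤t = allMoved (parity t) (oldTag t k) (newTag t k)
      (movedP-tag vo) (movedQ-tag k≤t vo) (movedP′-tag vn) (movedQ′-tag vn)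
      where
      vo = tagView (pointer t) k
      vn = tagView (pointer (suc t)) k

    marked-cell : ∀ J {t k} → k < t → J (contentAt x t k) ≡ true → Marked J (letterAt x t k)
    marked-cell J k<t j = _ , _ , letterAt-< x k<t , j

    allowed : ∀ t k → Allowed (kind t) (oldTag t k) (newTag t k) (letterAt x t k)
    allowed t k with kind t in eq
    ... | free = tt
    ... | staying = cong (λ p → tagOf p k) (sym (stays t eq))
    ... | jumping = (λ e → src (tagView (pointer t) k) e) , (λ e → tgt (tagView (pointer (suc t)) k) e)
      where
      src : ∀ {tag} → TagView (pointer t) k tag → tag ≡ at → Marked source (letterAt x t k)
      src (at refl) _ = let ((lt , j) , _) = jump t eq in marked-cell source lt j
      tgt : ∀ {tag} → TagView (pointer (suc t)) k tag → tag ≡ at → Marked target (letterAt x t k)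
      tgt (at refl) _ = let (_ , (lt , j)) = jump t eq in marked-cell target lt j

    errAfter-false : ∀ t k → errAfter false (oldTag t k) (expected t) (letterAt x t k) ≡ false
    errAfter-false t k with oldTag t k | tagView (pointer t) k
    ... | _ | bef _ = refl
    ... | _ | at refl = expected-met x t (expected-Expected t)
    ... | _ | aft _ = refl

    confAt-step : ∀ t k → k < t → Step (letterAt x t k) (confAt t k) (confAt t (suc k))
    confAt-step t k k<t = read-step (oldTag t k) (newTag t k) (letterAt-< x k<t)
      (flag-tag (tagView (pointer t) k)) (choose-tag t k) (allowed t k) (errAfter-false t k)
      (moved-tag t k (<⇒≤ k<t))

    pointer≤ : ∀ t → pointer t ≤ t
    pointer≤ zero = ≤-reflexive begin
    pointer≤ (suc t) = m≤n⇒m≤1+n (inRow t)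

    confAt-row : ∀ t → Step (letterAt x t t) (confAt t t) (confAt (suc t) 0)
    confAt-row t = row-step (oldTag t t) (newTag t t) (letterAt-≡ x t)
      (flag-tag (tagView (pointer t) t)) (<⇒<ᵇ≡true (s≤s (pointer≤ t)))
      (choose-tag t t)
      (cong (λ b → if b then just (expectAt x t (pointer (suc t))) else nothing) (<⇒<ᵇ≡true (s≤s (inRow t))))
      (allowed t t) (nextKind t) (moved-tag t t ≤-refl) counters
      where
      counters : arrange (parity t) (pointer t ∸ suc t) ((t ∸ pointer t) ∸ (t ∸ pointer t))
                         (suc t ⊓ pointer (suc t)) (suc t ∸ pointer (suc t))
               ≡ arrange (not (parity t)) (pointer (suc t)) (suc t ∸ pointer (suc t)) 0 (0 ∸ pointer (suc (suc t)))
      counters rewrite 0∸n≡0 (pointer (suc (suc t))) | m≤n⇒m∸n≡0 (m≤n⇒m≤1+n (pointer≤ t)) | n∸n≡0 (t ∸ pointer t)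
                     | m≥n⇒m⊓n≡n (m≤n⇒m≤1+n (inRow t)) =
        sym (arrange-not (parity t))

    run : ℕ → Conf
    run i = let (t , k) = position i in confAt t k

    run-start : run 0 ≡ start
    run-start rewrite begin | kind₀ | 0∸n≡0 (pointer 1) = refl

    run-step : ∀ i → Step (diagram x i) (run i) (run (suc i))
    run-step i with position i | proj₁ (rowStart-position i)
    ... | t , k | k≤t with m≤n⇒m<n∨m≡n k≤t
    ... | inj₁ k<t rewrite nextPosition-< k<t = confAt-step t k k<t
    ... | inj₂ refl rewrite nextPosition-≡ t = confAt-row t

-- Detection of errors by the pointer automaton

module PointerLanguage (em : ∀ {ℓ} → ExcludedMiddle ℓ) {n : ℕ} (R : RowSystem n) where

  open RowSystem R
  open PointerRuns em R
  open Classical em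

  Word∞ : Set
  Word∞ = ℕ → Letter

  relabel : ∀ {L L′ c c′} → L ≡ L′ → Step L c c′ → Step L′ c c′
  relabel refl s = s

  data Reach (v : Word∞) : ℕ → Conf → Set where
    here  : Reach v 0 start
    there : ∀ {i c c′} → Reach v i c → Step (v i) c c′ → Reach v (suc i) c′

  Reach-resp : ∀ {v w i c} → (∀ j → j < i → v j ≡ w j) → Reach v i c → Reach w i c
  Reach-resp h here = here
  Reach-resp {i = suc i} h (there r s) =
    there (Reach-resp (λ j j<i → h j (m<n⇒m<1+n j<i)) r) (relabel (h i ≤-refl) s)

  Fails : Word∞ → Set
  Fails v = ∃₂ λ i cs → Reach v i (nothing , cs)

  Follows : Word∞ → (ℕ → Conf) → Set
  Follows v r = r 0 ≡ start × (∀ i → Step (v i) (r i) (r (suc i)))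

  Acc∞ : Word∞ → Set
  Acc∞ v = ∃ λ r → Follows v r × InfinitelyOften (λ i → accepting (proj₁ (r i)) ≡ true)

  follows-reach : ∀ {v r} → Follows v r → ∀ i → Reach v i (r i)
  follows-reach (e , s) zero = subst (Reach _ 0) (sym e) here
  follows-reach f@(e , s) (suc i) = there (follows-reach f i) (s i)

  reach⇒sequence : ∀ {v i c} → Reach v i c → ∃ λ (r : ℕ → Conf) →
    r 0 ≡ start × (∀ j → j < i → Step (v j) (r j) (r (suc j))) × (∀ j → i ≤ j → r j ≡ c)
  reach⇒sequence here = (λ _ → start) , refl , (λ _ ()) , λ _ _ → refl
  reach⇒sequence {v} {suc i} {c} (there rch s) with reach⇒sequence rch
  ... | r , r0 , steps , stable = r′ , r0 , steps′ , r′-above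
    where
    r′ : ℕ → Conf
    r′ j = if i <ᵇ j then c else r j
    r′-above : ∀ j → i < j → r′ j ≡ c
    r′-above j i<j rewrite <⇒<ᵇ≡true i<j = refl
    r′-below : ∀ j → j ≤ i → r′ j ≡ r j
    r′-below j j≤i rewrite ≥⇒<ᵇ≡false j≤i = refl
    steps′ : ∀ j → j < suc i → Step (v j) (r′ j) (r′ (suc j))
    steps′ j (s≤s j≤i) with m≤n⇒m<n∨m≡n j≤i
    ... | inj₁ j<i = subst₂ (Step (v j)) (sym (r′-below j j≤i)) (sym (r′-below (suc j) j<i)) (steps j j<i)
    ... | inj₂ refl = subst₂ (Step (v j)) (sym (trans (r′-below j ≤-refl) (stable j ≤-refl)))
                        (sym (r′-above (suc j) ≤-refl)) s

  fails⇒acc : ∀ {v} → Fails v → Acc∞ v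
  fails⇒acc {v} (i , cs , rch) with reach⇒sequence rch
  ... | r , r0 , steps , stable = r , (r0 , steps′) , λ N → N ⊔ i , m≤m⊔n N i ,
        cong (accepting ∘ proj₁) (stable (N ⊔ i) (m≤n⊔m N i))
    where
    steps′ : ∀ j → Step (v j) (r j) (r (suc j))
    steps′ j with <-≤-connex j i
    ... | inj₁ j<i = steps j j<i
    ... | inj₂ i≤j rewrite stable j i≤j | stable (suc j) (m≤n⇒m≤1+n i≤j) =
      moving sink λ m → subst (λ z → Moved z (lookup cs m) (lookup cs m)) (sym (lookup-replicate m stay)) refl

  module _ {x : ωWord n} {v : Word∞} where

    mid-reach : ∀ {i c} → (∀ j → j < i → v j ≡ diagram x j) → Reach v i c →
                let (t , k) = position i in ∃₂ λ P₀ κ → Mid x t k P₀ κ c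
    mid-reach h here = 0 , staying , mid-start x
    mid-reach {suc i} h (there r s)
      with position i | proj₁ (rowStart-position i) | mid-reach (λ j j<i → h j (m<n⇒m<1+n j<i)) r | h i ≤-refl
    ... | t , k | k≤t | P₀ , κ , m | e with m≤n⇒m<n∨m≡n k≤t
    ... | inj₁ k<t rewrite nextPosition-< k<t = P₀ , κ , mid-step x m k<t e s
    ... | inj₂ refl rewrite nextPosition-≡ t =
      let (P₀′ , κ′ , m′ , _) = mid-end x m e s in P₀′ , κ′ , m′

  diagram-¬Fails : ∀ {x v} → (∀ i → v i ≡ diagram x i) → ¬ Fails v
  diagram-¬Fails h (i , cs , rch) with mid-reach (λ j _ → h j) rch
  ... | _ , _ , mid () _ _ _ _ _ _

  -- The part of the invariant that concerns the number of letters only; unlike `Mid` it persists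
  -- when the present row contains wrong letters.
  record Scan (t k : ℕ) (c : Conf) : Set where
    constructor scan
    field
      {s} : St
      {P Q P′ Q′ P₀ Q₀} : ℕ
      {mo} : Maybe ℕ
      shape : c ≡ conf s P Q P′ Q′
      total : P₀ + Q₀ ≡ t
      old   : OldTrack k P₀ Q₀ (St.past s) mo P Q

  mid⇒scan : ∀ {x t k P₀ κ c} → Mid x t k P₀ κ c → Scan t k c
  mid⇒scan (mid shape total _ old _ _ _) = scan shape total old

  scan-step : ∀ {t k y c c′} → Scan t k c → Step (just y) c c′ → Scan t (suc k) c′
  scan-step {c′ = _ , cs′} (scan refl total old) (moving (read {par = par} to tn f ch al) mv)
    with count par to tn {cs = cs′} mv
  ... | counted refl a b c d = scan refl total (proj₂ (proj₂ (oldTrack-step old f a b)))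

  scan-long : ∀ {t L c c′} → Scan t (suc t) c → ¬ Step L c c′
  scan-long {c′ = _ , cs′} (scan refl total old) (moving (read {par = par} to tn f ch al) mv)
    with count par to tn {cs = cs′} mv
  ... | counted refl a b c d = oldTrack-long total old f a b
  scan-long {c′ = _ , cs′} (scan refl total old) (moving (row {par = par} to tn f ch al _) mv)
    with count par to tn {cs = cs′} mv
  ... | counted refl a b c d = oldTrack-long total old f a b
  scan-long {c′ = _ , cs′} (scan refl total old) (moving (fail {par = par} to tn f _) mv)
    with count par to tn {cs = cs′} mv
  ... | counted refl a b c d = oldTrack-long total old f a b

  -- A run that goes on for ever cannot outlast its counters, so the separator comes in time. The
  -- run that detects an error depends on this, as it must reach the end of the row.
  row-ends : ∀ {v : Word∞} {r : ℕ → Conf} {t} → (∀ i → Step (v i) (r i) (r (suc i))) → ∀ d {k i} → k + d ≡ t → Scan t k (r i) →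
             ∃ λ j → j ≤ d × v (i + j) ≡ nothing × (∀ j′ → j′ < j → ∃ λ y → v (i + j′) ≡ just y)
  row-ends {v} {r} steps d {k} {i} e sc with v i in vi
  ... | nothing = 0 , z≤n , trans (cong v (+-identityʳ i)) vi , λ _ ()
  row-ends {v} {r} steps zero {k} {i} e sc | just y =
    ⊥-elim (scan-long (subst (λ k → Scan _ (suc k) _) (trans (sym (+-identityʳ k)) e)
      (scan-step sc (relabel vi (steps i)))) (steps (suc i)))
  row-ends {v} {r} steps (suc d) {k} {i} e sc | just y
    with row-ends {v} {r} steps d {suc k} {suc i} (trans (sym (+-suc k d)) e)
           (scan-step sc (relabel vi (steps i)))
  ... | j , j≤d , vj , cells = suc j , s≤s j≤d , trans (cong v (+-suc i j)) vj , λ where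
        zero _ → y , trans (cong v (+-identityʳ i)) vi
        (suc j′) (s≤s j′<j) → let (y , e) = cells j′ j′<j in y , trans (cong v (+-suc i j′)) e

  spare : ∀ nx P′ Q′ → ∃ λ tag → ∃₂ λ P₁′ Q₁′ →
          (∀ {c prev L} → Choose c prev L nx tag nx) × Moved (newP tag) P′ P₁′ × Moved (newQ tag) Q′ Q₁′
  spare nothing P′ Q′ = bef , _ , _ , bef , refl , refl
  spare (just e) P′ Q′ = aft , _ , _ , aft , refl , refl

  -- Past the tested letter each letter costs one unit of `Q`; the strict inequality leaves one for
  -- the separator. The new pointer is put off by `spare` and blocks nothing.
  finish : ∀ {v : Word∞} j {i par c g prev ex nx P Q P′ Q′} →
           Reach v i (conf (st par free c g true true prev ex nx) P Q P′ Q′) → j < Q →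
           v (i + j) ≡ nothing → (∀ j′ → j′ < j → ∃ λ y → v (i + j′) ≡ just y) → Fails v
  finish {v} zero {i} {par} {P = P} {suc Q} {P′} {Q′} rch _ vi _ = suc i , arrange par P Q (suc P′) Q′ ,
    there rch (relabel (trans (sym vi) (cong v (+-identityʳ i)))
      (moving (fail aft bef aft refl) (allMoved par aft bef refl refl refl refl)))
  finish {v} (suc j) {i} {par} {c} {nx = nx} {Q = suc Q} {P′} {Q′} rch (s≤s j<Q) vi cells
    with cells 0 z<s | spare nx P′ Q′
  ... | (x , b) , v0 | tag , _ , _ , ch , mp , mq = finish j
    (there rch (relabel (trans (sym v0) (cong v (+-identityʳ i)))
      (read-step aft tag refl aft ch tt refl (allMoved par aft tag refl refl mp mq)))) j<Q
    (trans (cong v (sym (+-suc i j))) vi)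
    λ j′ j′<j → let (y , e) = cells (suc j′) (s≤s j′<j) in y , trans (cong v (sym (+-suc i j′))) e

  -- Letter `k` of the oracle makes its first appearance in the last cell of row `k + 1`.
  extract : Word∞ → ωWord n
  extract v k with v (rowStart (suc k) + k)
  ... | just (a , _) = a
  ... | nothing = someLetter

  extract-just : ∀ {v k a b} → v (rowStart (suc k) + k) ≡ just (a , b) → extract v k ≡ a
  extract-just {v} {k} e with v (rowStart (suc k) + k)
  extract-just refl | just _ = refl

  -- For `k = t` no oracle letter is expected, but `extract` reads off this very cell, so that its
  -- letter is right by definition. In the other cells both components are expected.
  wrong-letter : ∀ {v t k} → k ≤ t → v (rowStart (suc t) + k) ≢ letterAt (extract v) (suc t) k →
                 ¬ Meets (expectAt (extract v) t k) (v (rowStart (suc t) + k))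
  wrong-letter {v} {t} {k} k≤t ne m with v (rowStart (suc t) + k) in vi
  ... | just (a , b) = ne (trans (cong₂ (λ a b → just (a , b)) a≡ b≡) (sym (letterAt-< (extract v) (s≤s k≤t))))
    where
    b≡ : b ≡ contentAt (extract v) (suc t) k
    b≡ = trans (proj₂ m) (cong (content _ _) (midOf≡ (extract v) t k))
    a≡ : a ≡ extract v k
    a≡ with m≤n⇒m<n∨m≡n k≤t
    ... | inj₁ k<t = proj₁ m _ (cong (Maybe.map proj₁) (letterAt-< (extract v) k<t))
    ... | inj₂ refl = sym (extract-just {v} {t} vi)

  choose-any : ∀ {p k tag e} → TagView p k tag → ∀ {c prev L} →
               ∃ λ nx → Choose c prev L (if p <ᵇ k then just e else nothing) tag nx
  choose-any (bef k<p) rewrite ≥⇒<ᵇ≡false (<⇒≤ k<p) = _ , bef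
  choose-any {p} (at refl) rewrite ≥⇒<ᵇ≡false (≤-refl {p}) = _ , at
  choose-any (aft p<k) rewrite <⇒<ᵇ≡true p<k = _ , aft

  module _ {v : Word∞} {r : ℕ → Conf} (f : Follows v r) where

    private
      x = extract v

    error-fails : ∀ {i t k} → position i ≡ (suc t , k) → k ≤ t → (∀ j → j < i → v j ≡ diagram x j) →
                  v i ≢ letterAt x (suc t) k → Fails v
    error-fails {i} {t} {k} pos k≤t agree ne = detect (v i) refl
      where
      i≡ : rowStart (suc t) + k ≡ i
      i≡ = subst (λ (t , k) → rowStart t + k ≡ i) pos (proj₂ (rowStart-position i))
      pointer : ℕ → ℕ
      -- Only the old pointer of the row with the error matters; elsewhere 0 will do. The kind is
      -- free from row 1 on, the initial state being `staying`.
      pointer s = if s ≡ᵇ suc t then k else 0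
      kind : ℕ → Kind
      kind zero = staying
      kind (suc _) = free
      inRow : ∀ s → pointer (suc s) ≤ s
      inRow s with s ≡ᵇ t in e
      ... | false = z≤n
      ... | true rewrite ≡ᵇ⇒≡ s t (subst T (sym e) tt) = k≤t
      nextKind : ∀ s → NextKind (kind s) (controlAt x (suc s)) (kind (suc s))
      nextKind zero = tt
      nextKind (suc s) = refl
      stays : ∀ s → kind s ≡ staying → pointer (suc s) ≡ pointer s
      stays zero _ = n≤0⇒n≡0 (inRow 0)
      jump : ∀ s → kind s ≡ jumping → _
      jump zero ()
      jump (suc s) ()
      open Prescribed x pointer kind refl refl inRow nextKind stays jump
      pointer≡ : pointer (suc t) ≡ k
      pointer≡ with t ≡ᵇ t in e
      ... | true = refl
      ... | false = ⊥-elim (subst T e (≡⇒≡ᵇ t t refl))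
      reach : ∀ j → j ≤ i → Reach v j (run j)
      reach zero _ = subst (Reach v 0) (sym run-start) here
      reach (suc j) j<i = there (reach j (<⇒≤ j<i)) (relabel (sym (agree j j<i)) (run-step j))
      reach-i : Reach v i (confAt (suc t) k)
      reach-i = subst (λ (t , k) → Reach v i (confAt t k)) pos (reach i ≤-refl)
      bad : violates (expected (suc t)) (v i) ≡ true
      bad with em {P = Violates (expected (suc t)) (v i)}
      ... | yes _ = refl
      ... | no ¬p = ⊥-elim (¬p (_ , cong (λ p → just (expectAt x t p)) pointer≡ ,
              subst (λ i → ¬ Meets (expectAt x t k) (v i)) i≡
                (wrong-letter {v} k≤t (subst (λ i → v i ≢ letterAt x (suc t) k) (sym i≡) ne))))
      tag≡ : oldTag (suc t) k ≡ at
      tag≡ with oldTag (suc t) k | tagView (pointer (suc t)) k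
      ... | _ | bef k<p = ⊥-elim (<-irrefl (sym pointer≡) k<p)
      ... | _ | at _ = refl
      ... | _ | aft p<k = ⊥-elim (<-irrefl pointer≡ p<k)
      err : errAfter false (oldTag (suc t) k) (expected (suc t)) (v i) ≡ true
      err = trans (cong (λ tag → errAfter false tag (expected (suc t)) (v i)) tag≡) bad
      past : (pointer (suc t) <ᵇ suc k) ≡ true
      past = <⇒<ᵇ≡true (≤-reflexive (cong suc pointer≡))
      choice = choose-any (tagView (pointer (suc (suc t))) k)
      k<1+t = s≤s k≤t
      ends = row-ends (proj₂ f) (suc t ∸ k) (m+[n∸m]≡n (<⇒≤ k<1+t))
               (mid⇒scan (proj₂ (proj₂ (subst (λ (t , k) → ∃₂ λ P₀ κ → Mid x t k P₀ κ (r i)) pos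
                 (mid-reach agree (follows-reach f i))))))
      Q≡ : (suc t ∸ pointer (suc t)) ∸ (k ∸ pointer (suc t)) ≡ suc t ∸ k
      Q≡ rewrite pointer≡ | n∸n≡0 k = refl
      detect : ∀ L → v i ≡ L → Fails v
      -- The row is too short, and the separator itself violates the expectation. Otherwise the end
      -- of the row is awaited by `finish`, and `row-ends` for the given run `r` shows that it is in
      -- reach.
      detect nothing vi = suc i , arrange (parity (suc t)) _ _ _ _ , there reach-i
        (relabel (sym vi) (moving (fail (oldTag (suc t) k) (newTag (suc t) k)
          (subst (Flag _ _) past (flag-tag (tagView (pointer (suc t)) k)))
          (trans (cong (errAfter false (oldTag (suc t) k) (expected (suc t))) (sym vi)) err))
          (moved-tag (suc t) k (<⇒≤ k<1+t))))
      detect (just (a , b)) vi with ends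
      ... | zero , _ , vi′ , _ = case trans (sym vi) (trans (cong v (sym (+-identityʳ i))) vi′) of λ ()
      ... | suc j , j≤ , vj , cells = finish j
        (there reach-i (relabel (sym vi)
          (read-step (oldTag (suc t) k) (newTag (suc t) k) refl
            (subst (Flag _ _) past (flag-tag (tagView (pointer (suc t)) k)))
            (proj₂ choice) tt (trans (cong (errAfter false (oldTag (suc t) k) (expected (suc t))) (sym vi)) err)
            (moved-tag (suc t) k (<⇒≤ k<1+t)))))
        (≤-trans j≤ (≤-reflexive (sym Q≡)))
        (trans (cong v (sym (+-suc i j))) vj)
        λ j′ j′<j → let (y , e) = cells (suc j′) (s≤s j′<j) in y , trans (cong v (sym (+-suc i j′))) e

    correct : ¬ Fails v → ∀ i → v i ≡ diagram x i
    correct ¬fails i = below (suc i) i ≤-refl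
      where
      now : ∀ i → (∀ j → j < i → v j ≡ diagram x j) → v i ≡ diagram x i
      now i agree with position i in pos | proj₁ (rowStart-position i) | mid-reach agree (follows-reach f i)
      ... | t , k | k≤t | _ , _ , m with m≤n⇒m<n∨m≡n k≤t
      now i agree | suc t , k | _ | _ | inj₁ (s≤s k≤t) = dne λ ne → ¬fails (error-fails pos k≤t agree ne)
      now i agree | t , _ | _ | _ , _ , m | inj₂ refl with v i in vi
      ... | nothing = sym (letterAt-≡ x t)
      -- A letter in place of the separator exhausts the counters of the given run itself, so no
      -- failing run has to be constructed.
      ... | just y = ⊥-elim (scan-long (scan-step (mid⇒scan m) (relabel vi (proj₂ f i))) (proj₂ f (suc i)))
      below : ∀ i j → j < i → v j ≡ diagram x j
      below (suc i) j (s≤s j≤i) with m≤n⇒m<n∨m≡n j≤i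
      ... | inj₁ j<i = below i j j<i
      ... | inj₂ refl = now i (below i)

-- Walks as accepting runs, and continuity of the coding

rowStart-≥ : ∀ t → t ≤ rowStart t
rowStart-≥ zero = z≤n
rowStart-≥ (suc t) = m≤n+m (suc t) (rowStart t)

module DiagramLanguage (em : ∀ {ℓ} → ExcludedMiddle ℓ) {n : ℕ} (R : RowSystem n) where

  open RowSystem R
  open PointerRuns em R
  open PointerLanguage em R
  open Classical em

  walk⇒acc : ∀ {x v} → (∀ i → v i ≡ diagram x i) → Walk x → Acc∞ v
  walk⇒acc {x} {v} h w = run , (run-start , λ i → relabel (sym (h i)) (run-step i)) , λ N →
    let (t , N≤t , j) = often N in
    rowStart t , ≤-trans N≤t (rowStart-≥ t) ,
    trans (cong (λ p → accepting (proj₁ (confAt (proj₁ p) (proj₂ p))))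
                (trans (cong position (sym (+-identityʳ (rowStart t)))) (position-rowStart t 0 z≤n)))
          (cong (λ b → isJumping (if b then jumping else staying)) j)
    where
    open Walk w
    kind : ℕ → Kind
    kind t = if jumps t then jumping else staying
    no-jump₀ : kind 0 ≡ staying
    no-jump₀ with jumps 0 in j
    ... | false = refl
    ... | true with jump 0 j
    ... | _ , (() , _) , _
    nextKind : ∀ t → NextKind (kind t) (controlAt x (suc t)) (kind (suc t))
    nextKind t with jumps t | jumps (suc t) in j
    ... | false | false = tt
    ... | false | true = proj₁ (jump (suc t) j)
    ... | true | false = tt
    ... | true | true = proj₁ (jump (suc t) j)
    stays′ : ∀ t → kind t ≡ staying → pointer (suc t) ≡ pointer t
    stays′ t e with jumps t in j
    ... | false = stays t j
    jump′ : ∀ t → kind t ≡ jumping → _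
    jump′ t e with jumps t in j
    ... | true = proj₂ (jump t j)
    open Prescribed x pointer kind begin no-jump₀ inRow nextKind stays′ jump′

  module _ {x : ωWord n} {v : Word∞} (h : ∀ i → v i ≡ diagram x i)
           {r : ℕ → Conf} (f : Follows v r) where

    private
      AtRow : ℕ → Set
      AtRow t = ∃₂ λ P₀ κ → Mid x t 0 P₀ κ (r (rowStart t))

      along : ∀ {t P₀ κ} → Mid x t 0 P₀ κ (r (rowStart t)) → ∀ k → k ≤ t →
              Mid x t k P₀ κ (r (rowStart t + k))
      along {t} m zero _ = subst (λ i → Mid x t 0 _ _ (r i)) (sym (+-identityʳ _)) m
      along {t} {P₀} {κ} m (suc k) k<t = subst (λ i → Mid x t (suc k) P₀ κ (r i)) (sym (+-suc (rowStart t) k))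
        (mid-step x (along m k (<⇒≤ k<t)) k<t
          (trans (h _) (diagram-rowStart x t k (<⇒≤ k<t))) (proj₂ f (rowStart t + k)))

      nextRow : ∀ {t P₀ κ} → Mid x t 0 P₀ κ (r (rowStart t)) →
                ∃₂ λ P₀′ κ′ → Mid x (suc t) 0 P₀′ κ′ (r (rowStart (suc t))) × RowEnd x t P₀ κ P₀′ κ′
      nextRow {t} m with mid-end x (along m t ≤-refl)
                           (trans (h _) (diagram-rowStart x t t ≤-refl)) (proj₂ f (rowStart t + t))
      ... | P₀′ , κ′ , m′ , e =
        P₀′ , κ′ , subst (λ i → Mid x (suc t) 0 P₀′ κ′ (r i)) (sym (+-suc (rowStart t) t)) m′ , e

      atRow : ∀ t → AtRow t
      atRow zero = 0 , staying , subst (Mid x 0 0 0 staying) (sym (proj₁ f)) (mid-start x)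
      atRow (suc t) = let (P₀′ , κ′ , m′ , _) = nextRow (proj₂ (proj₂ (atRow t))) in P₀′ , κ′ , m′

      κ : ℕ → Kind
      κ t = proj₁ (proj₂ (atRow t))

      rowEnd : ∀ t → RowEnd x t (proj₁ (atRow t)) (κ t) (proj₁ (atRow (suc t))) (κ (suc t))
      rowEnd t = proj₂ (proj₂ (proj₂ (nextRow (proj₂ (proj₂ (atRow t))))))

      -- Without a failure acceptance means infinitely many jumps, hence a run that has become free
      -- is excluded in `not-jumping`.
      κ-stays-free : ∀ {s t} → s ℕ.≤′ t → κ s ≡ free → κ t ≡ free
      κ-stays-free ≤′-refl e = e
      κ-stays-free (≤′-step {n} p) e = RowEnd.ifFree (rowEnd n) (κ-stays-free p e)

      isJumping⇒ : ∀ {k} → isJumping k ≡ true → k ≡ jumping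
      isJumping⇒ {jumping} _ = refl

    acc⇒walk : InfinitelyOften (λ i → accepting (proj₁ (r i)) ≡ true) → Walk x
    acc⇒walk inf = record
      { pointer = λ t → proj₁ (atRow t)
      ; jumps = λ t → isJumping (κ t)
      ; begin = refl
      ; inRow = λ t → RowEnd.inRow (rowEnd t)
      ; stays = λ t e → RowEnd.ifStaying (rowEnd t) (not-jumping t e)
      ; jump = λ t e → RowEnd.ifJumping (rowEnd t) (isJumping⇒ e)
      ; often = often
      }
      where
      often : InfinitelyOften (λ t → isJumping (κ t) ≡ true)
      often N with inf (rowStart N)
      ... | i , N≤i , a with position i | rowStart-position i
      ... | t , k | k≤t , refl with along (proj₂ (proj₂ (atRow t))) k k≤t
      ... | mid shape _ _ _ _ _ _ = t , row-≥ N t k k≤t N≤i , trans (sym (cong (accepting ∘ proj₁) shape)) a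
      not-jumping : ∀ t → isJumping (κ t) ≡ false → κ t ≡ staying
      not-jumping t e with κ t in eq
      ... | staying = refl
      ... | free with often t
      ... | s , t≤s , j = case trans (sym j) (cong isJumping (κ-stays-free (≤⇒≤′ t≤s) eq)) of λ ()

  acc⇒fails⊎walk : ∀ {v} → Acc∞ v → Fails v ⊎ ((∀ i → v i ≡ diagram (extract v) i) × Walk (extract v))
  acc⇒fails⊎walk {v} (r , f , inf) with em {P = Fails v}
  ... | yes p = inj₁ p
  ... | no ¬p = inj₂ (correct f ¬p , acc⇒walk (correct f ¬p) f inf)

  width : ℕ
  width = size finLetter

  decode : ωWord width → Word∞
  decode w i = dec finLetter (w i)

  language : Lang width
  language = CounterAutomaton.Recognised pointerAutomaton finLetter

  language-r-BCL : r-BCLω 4 language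
  language-r-BCL = CounterAutomaton.recognised-r-BCL pointerAutomaton finLetter em

  Failing Diagrams : Lang width
  Failing w = Fails (decode w)
  Diagrams w = ∀ i → decode w i ≡ diagram (extract (decode w)) i

  draw : ωWord n → ωWord width
  draw x i = enc finLetter (diagram x i)

  scanOf : ωWord width → ωWord n
  scanOf w = extract (decode w)

  decode-draw : ∀ x i → decode (draw x) i ≡ diagram x i
  decode-draw x i = dec-enc finLetter (diagram x i)

  scanOf-draw : ∀ x k → scanOf (draw x) k ≡ x k
  scanOf-draw x k = extract-just {decode (draw x)} {k} (trans (decode-draw x (rowStart (suc k) + k))
    (trans (diagram-rowStart x (suc k) k (n≤1+n k)) (letterAt-< x (n<1+n k))))

  language-≐ : language ≐ (λ w → Failing w ⊎ (Diagrams w × Walk (scanOf w)))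
  language-≐ = acc⇒fails⊎walk , λ { (inj₁ p) → fails⇒acc p ; (inj₂ (d , w)) → walk⇒acc d w }

  module _ {x y : ωWord n} where

    control-cong : ∀ t → Agree t x y → controlAt x t ≡ controlAt y t × (∀ k → contentAt x t k ≡ contentAt y t k)
    control-cong zero _ = refl , λ _ → refl
    control-cong (suc t) a with control-cong t (λ i i<t → a i (m<n⇒m<1+n i<t))
    ... | c≡ , b≡ = cong₂ next c≡ (any-cong t ≤-refl) , λ k →
        trans (cong (λ c → content c _ _) c≡) (cong₂ (content (controlAt y t)) (left≡ k) (cong (if k <ᵇ t then_else nothing) (cong just (b≡ k))))
      where
      any-cong : ∀ k → k ≤ t → testUpTo x t k ≡ testUpTo y t k
      any-cong zero _ = refl
      any-cong (suc k) k<t = cong₂ _∨_ (any-cong k (<⇒≤ k<t))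
        (trans (cong₂ (λ c a → guard c a (contentAt x t k)) c≡ (a k (m<n⇒m<1+n k<t)))
               (cong (guard _ _) (b≡ k)))
      left≡ : ∀ k → leftOf x t k ≡ leftOf y t k
      left≡ zero = refl
      left≡ (suc k) = cong just (b≡ k)

    diagram-cong : ∀ i → Agree i x y → diagram x i ≡ diagram y i
    diagram-cong i a with position i | rowStart-position i
    ... | t , k | k≤t , refl with m≤n⇒m<n∨m≡n k≤t
    ... | inj₂ refl = trans (letterAt-≡ x t) (sym (letterAt-≡ y t))
    ... | inj₁ k<t = trans (letterAt-< x k<t) (trans
          (cong₂ (λ a b → just (a , b)) (a k (≤-trans k<t t≤i)) (proj₂ (control-cong t (λ j j<t → a j (≤-trans j<t t≤i))) k))
          (sym (letterAt-< y k<t)))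
      where
      t≤i : t ≤ rowStart t + k
      t≤i = ≤-trans (rowStart-≥ t) (m≤m+n _ k)

  draw-continuous : IsContinuous draw
  draw-continuous = pointwise-continuous draw λ x i → i , λ y a → cong (enc finLetter) (diagram-cong i a)

  scanOf-local : ∀ {w w′} k → Agree (suc (rowStart (suc k) + k)) w w′ → scanOf w k ≡ scanOf w′ k
  scanOf-local {w} {w′} k a rewrite a (rowStart (suc k) + k) ≤-refl = refl

  scanOf-continuous : IsContinuous scanOf
  scanOf-continuous = pointwise-continuous scanOf λ w k → _ , λ w′ → scanOf-local k

  Failing-open : IsOpen Failing
  Failing-open w (i , cs , rch) = i , λ w′ e → i , cs ,
    Reach-resp (λ j j<i → cong (dec finLetter) (prefix⇒Agree {σ = w} {w′} i e j j<i)) rch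

  ∁Diagrams-open : IsOpen (∁ Diagrams)
  ∁Diagrams-open w ¬d with ¬∀⇒∃¬ ¬d
  -- A wrong letter is recognised from itself and from the places where the oracle letters that
  -- determine it are read off.
  ... | i , ne = suc i ⊔ l , λ w′ e d → ne (trans
        (cong (dec finLetter) (prefix⇒Agree {σ = w} {w′} (suc i) (prefix-≤ {σ = w} {w′} (m≤m⊔n (suc i) l) e) i ≤-refl))
        (trans (d i) (diagram-cong i λ j j<i →
          sym (prefix⇒Agree i (proj₂ (scanOf-continuous w i) w′ (prefix-≤ {σ = w} {w′} (m≤n⊔m (suc i) l) e)) j j<i))))
    where
    l = proj₁ (scanOf-continuous w i)

  Diagrams-¬Failing : ∀ {w} → Diagrams w → ¬ Failing w
  Diagrams-¬Failing d = diagram-¬Fails d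

  draw-Diagrams : ∀ x → Diagrams (draw x)
  draw-Diagrams x i = trans (decode-draw x i) (diagram-cong i λ j _ → sym (scanOf-draw x j))

-- Register programs with an oracle

Env : Set
Env = ℕ → ℕ

-- In unary these assignments involve only a cell and its left neighbour, and a value grows no
-- faster than the rows do.
data Expr : Set where
  zro     : Expr
  var inc : ℕ → Expr

ev : Expr → Env → ℕ
ev zro ρ = 0
ev (var i) ρ = ρ i
ev (inc i) ρ = suc (ρ i)

data Guard (n : ℕ) : Set where
  equal    : (r r′ : ℕ) → Guard n
  letterIs : (a : Fin n) (r : ℕ) → Guard n

data Prog (n : ℕ) : Set where
  set   : ℕ → Expr → Prog n
  seq   : Prog n → Prog n → Prog n
  until : Guard n → Prog n → Prog n
  when  : Guard n → Prog n → Prog n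

infixr 5 _⨟_
_⨟_ : ∀ {n} → Prog n → Prog n → Prog n
_⨟_ = seq

assign : ℕ → Expr → ℕ → Expr
assign r e j = if j ≡ᵇ r then e else var j

≡ᵇ-refl : ∀ k → (k ≡ᵇ k) ≡ true
≡ᵇ-refl zero = refl
≡ᵇ-refl (suc k) = ≡ᵇ-refl k

≢⇒≡ᵇ-false : ∀ {j k} → j ≢ k → (j ≡ᵇ k) ≡ false
≢⇒≡ᵇ-false {j} {k} ne with j ≡ᵇ k in e
... | false = refl
... | true = ⊥-elim (ne (≡ᵇ⇒≡ j k (subst T (sym e) tt)))

≡ᵇ-true⇒≡ : ∀ {j k} → (j ≡ᵇ k) ≡ true → j ≡ k
≡ᵇ-true⇒≡ {j} {k} e = ≡ᵇ⇒≡ j k (subst T (sym e) tt)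

≡ᵇ-false⇒≢ : ∀ {j k} → (j ≡ᵇ k) ≡ false → j ≢ k
≡ᵇ-false⇒≢ {j} e refl = case trans (sym e) (≡ᵇ-refl j) of λ ()

assign-same : ∀ r e ρ → ev (assign r e r) ρ ≡ ev e ρ
assign-same r e ρ rewrite ≡ᵇ-refl r = refl

assign-other : ∀ {r j} e ρ → j ≢ r → ev (assign r e j) ρ ≡ ρ j
assign-other e ρ ne rewrite ≢⇒≡ᵇ-false ne = refl

data Instr (n : ℕ) : Set where
  move : ℕ → Expr → Instr n
  test : Guard n → Instr n

act : ∀ {n} → Instr n → ℕ → Expr
act (move r e) = assign r e
act (test g) = var

effect : ∀ {n} → Instr n → Env → Env
effect ι ρ j = ev (act ι j) ρ

-- The places in the program text, which become the finite control; in a loop or a conditional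
-- `nothing` stands for the test.
State : ∀ {n} → Prog n → Set
State (set r e) = ⊤
State (seq p q) = State p ⊎ State q
State (until g p) = Maybe (State p)
State (when g p) = Maybe (State p)

State-finite : ∀ {n} (p : Prog n) → Finite (State p)
State-finite (set r e) = ⊤-finite
State-finite (seq p q) = ⊎-finite (State-finite p) (State-finite q)
State-finite (until g p) = Maybe-finite (State-finite p)
State-finite (when g p) = Maybe-finite (State-finite p)

entry : ∀ {n} (p : Prog n) → State p
entry (set r e) = tt
entry (seq p q) = inj₁ (entry p)
entry (until g p) = nothing
entry (when g p) = nothing

instr : ∀ {n} (p : Prog n) → State p → Instr n
instr (set r e) _ = move r e
instr (seq p q) (inj₁ s) = instr p s
instr (seq p q) (inj₂ s) = instr q s
instr (until g p) nothing = test g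
instr (until g p) (just s) = instr p s
instr (when g p) nothing = test g
instr (when g p) (just s) = instr p s

-- The next state, given the outcome of the test; nothing means that the program is left.
advance : ∀ {n} (p : Prog n) → State p → Bool → Maybe (State p)
advance (set r e) _ b = nothing
advance (seq p q) (inj₁ s) b with advance p s b
... | just s′ = just (inj₁ s′)
... | nothing = just (inj₂ (entry q))
advance (seq p q) (inj₂ s) b = Maybe.map inj₂ (advance q s b)
advance (until g p) nothing true = nothing
advance (until g p) nothing false = just (just (entry p))
advance (until g p) (just s) b = just (advance p s b)
advance (when g p) nothing true = just (just (entry p))
advance (when g p) nothing false = nothing
advance (when g p) (just s) b = Maybe.map just (advance p s b)

module Semantics {n : ℕ} (x : ωWord n) where

  holds : Guard n → Env → Bool
  holds (equal r r′) ρ = ρ r′ ≡ᵇ ρ r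
  holds (letterIs a r) ρ = ⌊ x (ρ r) FinP.≟ a ⌋

  result : Instr n → Env → Bool
  result (move r e) ρ = false
  result (test g) ρ = holds g ρ

  data Exec : Prog n → Env → Env → Set where
    set        : ∀ {r e ρ} → Exec (set r e) ρ (effect (move {n} r e) ρ)
    seq        : ∀ {p q ρ ρ₁ ρ₂} → Exec p ρ ρ₁ → Exec q ρ₁ ρ₂ → Exec (seq p q) ρ ρ₂
    until-done : ∀ {g p ρ} → holds g ρ ≡ true → Exec (until g p) ρ ρ
    until-more : ∀ {g p ρ ρ₁ ρ₂} → holds g ρ ≡ false → Exec p ρ ρ₁ → Exec (until g p) ρ₁ ρ₂ →
                 Exec (until g p) ρ ρ₂
    when-yes   : ∀ {g p ρ ρ₁} → holds g ρ ≡ true → Exec p ρ ρ₁ → Exec (when g p) ρ ρ₁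
    when-no    : ∀ {g p ρ} → holds g ρ ≡ false → Exec (when g p) ρ ρ

  -- One step per row of the diagram. Programs are verified with `Exec` and carried over by
  -- `exec⇒runs`.
  data Runs (p : Prog n) : State p → Env → Env → Set where
    stop : ∀ {s ρ} → advance p s (result (instr p s) ρ) ≡ nothing → Runs p s ρ (effect (instr p s) ρ)
    more : ∀ {s s′ ρ ρ′} → advance p s (result (instr p s) ρ) ≡ just s′ →
           Runs p s′ (effect (instr p s) ρ) ρ′ → Runs p s ρ ρ′

  runs-seq₂ : ∀ {p q s ρ ρ′} → Runs q s ρ ρ′ → Runs (seq p q) (inj₂ s) ρ ρ′
  runs-seq₂ (stop e) = stop (cong (Maybe.map inj₂) e)
  runs-seq₂ (more e r) = more (cong (Maybe.map inj₂) e) (runs-seq₂ r)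

  runs-seq : ∀ {p q s ρ ρ₁ ρ₂} → Runs p s ρ ρ₁ → Runs q (entry q) ρ₁ ρ₂ → Runs (seq p q) (inj₁ s) ρ ρ₂
  runs-seq {p} {q} {s} {ρ} (stop e) r′ = more step′ (runs-seq₂ r′)
    where
    step′ : advance (seq p q) (inj₁ s) (result (instr p s) ρ) ≡ just (inj₂ (entry q))
    step′ rewrite e = refl
  runs-seq {p} {q} {s} {ρ} (more {s′ = s′} e r) r′ = more step′ (runs-seq r r′)
    where
    step′ : advance (seq p q) (inj₁ s) (result (instr p s) ρ) ≡ just (inj₁ s′)
    step′ rewrite e = refl

  runs-until : ∀ {g p s ρ ρ₁ ρ₂} → Runs p s ρ ρ₁ → Runs (until g p) nothing ρ₁ ρ₂ →
               Runs (until g p) (just s) ρ ρ₂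
  runs-until (stop e) r′ = more (cong just e) r′
  runs-until (more e r) r′ = more (cong just e) (runs-until r r′)

  runs-when : ∀ {g p s ρ ρ₁} → Runs p s ρ ρ₁ → Runs (when g p) (just s) ρ ρ₁
  runs-when (stop e) = stop (cong (Maybe.map just) e)
  runs-when (more e r) = more (cong (Maybe.map just) e) (runs-when r)

  exec⇒runs : ∀ {p ρ ρ′} → Exec p ρ ρ′ → Runs p (entry p) ρ ρ′
  exec⇒runs set = stop refl
  exec⇒runs (seq e e′) = runs-seq (exec⇒runs e) (exec⇒runs e′)
  exec⇒runs (until-done {g} {p} h) = stop (cong (advance (until g p) nothing) h)
  exec⇒runs (until-more {g} {p} h e e′) =
    more (cong (advance (until g p) nothing) h) (runs-until (exec⇒runs e) (exec⇒runs e′))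
  exec⇒runs (when-yes {g} {p} h e) = more (cong (advance (when g p) nothing) h) (runs-when (exec⇒runs e))
  exec⇒runs (when-no {g} {p} h) = stop (cong (advance (when g p) nothing) h)

-- Compilation of recursive functions

registersFrom : ℕ → ∀ l → Vec ℕ l
registersFrom t zero = []
registersFrom t (suc l) = t ∷ registersFrom (suc t) l

registersFrom-< : ∀ t l i → lookup (registersFrom t l) i < t + l
registersFrom-< t (suc l) zero = m<m+n t z<s
registersFrom-< t (suc l) (suc i) = <-≤-trans (registersFrom-< (suc t) l i) (≤-reflexive (sym (+-suc t l)))

skip : ∀ {n} → Prog n
skip = until (equal 0 0) (set 0 zro)

-- compile f as out fr computes f of the registers as into the register out, and otherwise changes only
-- registers from fr on.
compile : ∀ {n k} → PR k → Vec ℕ k → (out fr : ℕ) → Prog n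
compileAll : ∀ {n k l} → Vec (PR k) l → Vec ℕ k → (t fr : ℕ) → Prog n

compile zeroᶠ as out fr = set out zro
compile sucᶠ (a ∷ []) out fr = set out (inc a)
compile (proj i) as out fr = set out (var (lookup as i))
compile (comp {l = l} f gs) as out fr =
  compileAll gs as fr (fr + l) ⨟ compile f (registersFrom fr l) out (fr + l)
compile (rec f g) (a ∷ as) out fr =
  seq (seq (set fr zro ⨟ compile f as (1 + fr) (2 + fr))
           (until (equal fr a) (compile g (fr ∷ 1 + fr ∷ as) (1 + fr) (2 + fr) ⨟ set fr (inc fr))))
      (set out (var (1 + fr)))
compile (μ f) as out fr =
  seq (seq (set (2 + fr) zro ⨟ set fr zro ⨟ compile f (fr ∷ as) (1 + fr) (3 + fr))
           (until (equal (1 + fr) (2 + fr)) (set fr (inc fr) ⨟ compile f (fr ∷ as) (1 + fr) (3 + fr))))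
      (set out (var fr))

compileAll [] as t fr = skip
compileAll (g ∷ gs) as t fr = compile g as t fr ⨟ compileAll gs as (suc t) fr

map-lookup-cong : ∀ {k} (ρ ρ′ : Env) (as : Vec ℕ k) → (∀ i → ρ′ (lookup as i) ≡ ρ (lookup as i)) →
                  Vec.map ρ′ as ≡ Vec.map ρ as
map-lookup-cong ρ ρ′ [] h = refl
map-lookup-cong ρ ρ′ (a ∷ as) h = cong₂ _∷_ (h zero) (map-lookup-cong ρ ρ′ as (h ∘ suc))

module CompileCorrect {n : ℕ} (x : ωWord n) where

  open Semantics x

  Below : ∀ {k} → ℕ → Vec ℕ k → Set
  Below fr as = ∀ i → lookup as i < fr

  Frame : ℕ → ℕ → Env → Env → Set
  Frame fr out ρ ρ′ = ∀ r → r < fr → r ≢ out → ρ′ r ≡ ρ r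

  Computes : ∀ {k} → PR k → Vec ℕ k → ℕ → Set
  Computes {k} f xs y = ∀ ρ (as : Vec ℕ k) out fr → Below fr as → out < fr → Vec.map ρ as ≡ xs →
    ∃ λ ρ′ → Exec (compile f as out fr) ρ ρ′ × ρ′ out ≡ y × Frame fr out ρ ρ′

  set-exec : ∀ out e fr ρ {y} → ev e ρ ≡ y →
             ∃ λ ρ′ → Exec (set out e) ρ ρ′ × ρ′ out ≡ y × Frame fr out ρ ρ′
  set-exec out e fr ρ eq = _ , set , trans (assign-same out e ρ) eq , λ r _ ne → assign-other e ρ ne

  keep-args : ∀ {k fr ρ ρ′ xs} (as : Vec ℕ k) → Below fr as → (∀ r → r < fr → ρ′ r ≡ ρ r) →
              Vec.map ρ as ≡ xs → Vec.map ρ′ as ≡ xs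
  keep-args {ρ = ρ} {ρ′} as b h e = trans (map-lookup-cong ρ ρ′ as λ i → h _ (b i)) e

  cons-below : ∀ {k fr a} {as : Vec ℕ k} → a < fr → Below fr as → Below fr (a ∷ as)
  cons-below p b zero = p
  cons-below p b (suc i) = b i

  weaken : ∀ {k fr fr′} (as : Vec ℕ k) → fr ≤ fr′ → Below fr as → Below fr′ as
  weaken as le b i = ≤-trans (b i) le

  computes : ∀ {k} {f : PR k} {xs y} → f [ xs ]⇓ y → Computes f xs y

  computesAll : ∀ {k l} {gs : Vec (PR k) l} {xs ys} → Pointwise (λ g z → g [ xs ]⇓ z) gs ys →
    ∀ ρ (as : Vec ℕ k) t fr → Below t as → t + l ≤ fr → Vec.map ρ as ≡ xs →
    ∃ λ ρ′ → Exec (compileAll gs as t fr) ρ ρ′ × Vec.map ρ′ (registersFrom t l) ≡ ys ×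
             (∀ r → r < t → ρ′ r ≡ ρ r)

  -- The derivation unwinds from the last round, whereas the loop runs forwards. So the state after
  -- `m` rounds comes with a continuation: whatever the loop does from there may be preceded by
  -- these rounds. By `m ≤ ρ a` the exit test fails in all of them.
  computesRec : ∀ {k} {f : PR k} {g m xs y} → rec f g [ m ∷ xs ]⇓ y →
    ∀ ρ a (as : Vec ℕ k) fr → Below fr (a ∷ as) → m ≤ ρ a → Vec.map ρ as ≡ xs →
    let init = set fr zro ⨟ compile f as (1 + fr) (2 + fr)
        loop = until (equal fr a) (compile g (fr ∷ 1 + fr ∷ as) (1 + fr) (2 + fr) ⨟ set fr (inc fr))
    in ∃ λ ρₘ → ρₘ fr ≡ m × ρₘ (1 + fr) ≡ y × (∀ r → r < fr → ρₘ r ≡ ρ r) ×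
       (∀ ρ′ → Exec loop ρₘ ρ′ → Exec (seq init loop) ρ ρ′)

  computesLoop : ∀ {k} {f : PR k} {g m xs y} → rec f g [ m ∷ xs ]⇓ y → Computes (rec f g) (m ∷ xs) y
  computesLoop {m = m} d ρ (a ∷ as) out fr b o e =
    let ρa≡ = ∷-injectiveᵛˡ e
        (ρₘ , j≡ , acc≡ , same , k) = computesRec d ρ a as fr b (≤-reflexive (sym ρa≡)) (∷-injectiveᵛʳ e)
        done = until-done (trans (cong₂ _≡ᵇ_ (trans (same a (b zero)) ρa≡) j≡) (≡ᵇ-refl m))
        (ρ′ , ex , res , frame) = set-exec out (var (1 + fr)) fr ρₘ acc≡
    in ρ′ , seq (k ρₘ done) ex , res , λ r r<fr ne → trans (frame r r<fr ne) (same r r<fr)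

  computes ⇓zero ρ as out fr b o e = set-exec out zro fr ρ refl
  computes ⇓suc ρ (a ∷ []) out fr b o refl = set-exec out (inc a) fr ρ refl
  computes (⇓proj {i = i}) ρ as out fr b o refl =
    set-exec out (var (lookup as i)) fr ρ (sym (lookup-map i ρ as))
  computes (⇓comp {l = l} ds d) ρ as out fr b o e =
    let (ρ₁ , ex₁ , val , same₁) = computesAll ds ρ as fr (fr + l) b ≤-refl e
        (ρ₂ , ex₂ , res , same₂) = computes d ρ₁ (registersFrom fr l) out (fr + l)
          (registersFrom-< fr l) (≤-trans o (m≤m+n fr l)) val
    in ρ₂ , seq ex₁ ex₂ , res , λ r r<fr ne → trans (same₂ r (≤-trans r<fr (m≤m+n fr l)) ne) (same₁ r r<fr)
  computes d@(⇓rec₀ _) = computesLoop d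
  computes d@(⇓rec₊ _ _) = computesLoop d
  computes (⇓μ {f = f} {xs} {y} d h) ρ as out fr b o e =
    let (ρy , j≡ , v≡ , z≡ , same , k) = search y ≤-refl
        done = until-done (trans (cong₂ _≡ᵇ_ z≡ v≡) (cong (0 ≡ᵇ_) (val≡0 ≤-refl)))
        (ρ′ , ex , res , frame) = set-exec out (var fr) fr ρy j≡
    in ρ′ , seq (k ρy done) ex , res , λ r r<fr ne → trans (frame r r<fr ne) (same r r<fr)
    where
    specs : ∀ z → z < y → ∃ λ v → Computes f (z ∷ xs) (suc v)
    specs z z<y = proj₁ (h z z<y) , computes (proj₂ (h z z<y))
    -- One specification for the values before `y` and the zero at `y`, so that `search` runs
    -- through all `m ≤ y` uniformly.
    spec : ∀ m → m ≤ y → ∃ λ w → Computes f (m ∷ xs) w × (m < y → (0 ≡ᵇ w) ≡ false) × (m ≡ y → w ≡ 0)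
    spec m m≤y with m≤n⇒m<n∨m≡n m≤y
    ... | inj₁ m<y = suc (proj₁ (specs m m<y)) , proj₂ (specs m m<y) , (λ _ → refl) ,
                     λ { refl → ⊥-elim (<-irrefl refl m<y) }
    ... | inj₂ refl = 0 , computes d , (λ lt → ⊥-elim (<-irrefl refl lt)) , λ _ → refl
    val≡0 : (le : y ≤ y) → proj₁ (spec y le) ≡ 0
    val≡0 le = proj₂ (proj₂ (proj₂ (spec y le))) refl
    init = set (2 + fr) zro ⨟ set fr zro ⨟ compile f (fr ∷ as) (1 + fr) (3 + fr)
    loop = until (equal (1 + fr) (2 + fr)) (set fr (inc fr) ⨟ compile f (fr ∷ as) (1 + fr) (3 + fr))
    args<3+ : Below (3 + fr) (fr ∷ as)
    args<3+ = cons-below (m≤n+m (suc fr) 2) (weaken as (m≤n+m fr 3) b)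
    1+fr<3+fr : 1 + fr < 3 + fr
    1+fr<3+fr = s≤s (s≤s (n≤1+n fr))
    search : ∀ m (m≤y : m ≤ y) → ∃ λ ρₘ → ρₘ fr ≡ m × ρₘ (1 + fr) ≡ proj₁ (spec m m≤y) × ρₘ (2 + fr) ≡ 0 ×
             (∀ r → r < fr → ρₘ r ≡ ρ r) × (∀ ρ′ → Exec loop ρₘ ρ′ → Exec (seq init loop) ρ ρ′)
    search zero 0≤y =
      let (ρ₁ , ex₁ , z≡ , fr₁) = set-exec (2 + fr) zro (2 + fr) ρ refl
          (ρ₂ , ex₂ , j≡ , fr₂) = set-exec fr zro (3 + fr) ρ₁ refl
          low : ∀ r → r < fr → ρ₂ r ≡ ρ r
          low r r<fr = trans (fr₂ r (≤-trans r<fr (m≤n+m fr 3)) (<⇒≢ r<fr))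
                             (fr₁ r (≤-trans r<fr (m≤n+m fr 2)) (<⇒≢ (≤-trans r<fr (m≤n+m fr 2))))
          (_ , sp , _) = spec 0 0≤y
          (ρ₃ , ex₃ , v≡ , fr₃) = sp ρ₂ (fr ∷ as) (1 + fr) (3 + fr) args<3+ 1+fr<3+fr
            (cong₂ _∷_ j≡ (keep-args as b low e))
      in ρ₃ , trans (fr₃ fr (m≤n+m (suc fr) 2) (<⇒≢ (n<1+n fr))) j≡ , v≡ ,
         trans (fr₃ (2 + fr) ≤-refl (λ ())) (trans (fr₂ (2 + fr) ≤-refl (λ ())) z≡) ,
         (λ r r<fr → trans (fr₃ r (≤-trans r<fr (m≤n+m fr 3)) (<⇒≢ (m<n⇒m<1+n r<fr))) (low r r<fr)) ,
         λ ρ′ ex → seq (seq ex₁ (seq ex₂ ex₃)) ex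
    search (suc m) m<y =
      let (ρₘ , j≡ , v≡ , z≡ , same , k) = search m (<⇒≤ m<y)
          (_ , _ , nz , _) = spec m (<⇒≤ m<y)
          (ρ₂ , ex₂ , j≡′ , fr₂) = set-exec fr (inc fr) (3 + fr) ρₘ (cong suc j≡)
          low : ∀ r → r < fr → ρ₂ r ≡ ρ r
          low r r<fr = trans (fr₂ r (≤-trans r<fr (m≤n+m fr 3)) (<⇒≢ r<fr)) (same r r<fr)
          (_ , sp , _) = spec (suc m) m<y
          (ρ₃ , ex₃ , v≡′ , fr₃) = sp ρ₂ (fr ∷ as) (1 + fr) (3 + fr) args<3+ 1+fr<3+fr
            (cong₂ _∷_ j≡′ (keep-args as b low e))
      in ρ₃ , trans (fr₃ fr (m≤n+m (suc fr) 2) (<⇒≢ (n<1+n fr))) j≡′ , v≡′ ,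
         trans (fr₃ (2 + fr) ≤-refl (λ ())) (trans (fr₂ (2 + fr) ≤-refl (λ ())) z≡) ,
         (λ r r<fr → trans (fr₃ r (≤-trans r<fr (m≤n+m fr 3)) (<⇒≢ (m<n⇒m<1+n r<fr))) (low r r<fr)) ,
         λ ρ′ ex → k ρ′ (until-more (trans (cong₂ _≡ᵇ_ z≡ v≡) (nz m<y)) (seq ex₂ ex₃) ex)

  computesAll [] ρ as t fr b le e = ρ , until-done (≡ᵇ-refl (ρ 0)) , refl , λ _ _ → refl
  computesAll {l = suc l} (d ∷ ds) ρ as t fr b le e =
    let t<fr = ≤-trans (m<m+n t z<s) le
        (ρ₁ , ex₁ , v≡ , same₁) = computes d ρ as t fr (weaken as (<⇒≤ t<fr) b) t<fr e
        low r r<t = same₁ r (<-trans r<t t<fr) (<⇒≢ r<t)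
        (ρ₂ , ex₂ , vs≡ , same₂) = computesAll ds ρ₁ as (suc t) fr (weaken as (n≤1+n t) b)
          (≤-trans (≤-reflexive (sym (+-suc t l))) le) (keep-args as b low e)
    in ρ₂ , seq ex₁ ex₂ , cong₂ _∷_ (trans (same₂ t ≤-refl) v≡) vs≡ ,
       λ r r<t → trans (same₂ r (m<n⇒m<1+n r<t)) (low r r<t)

  computesRec (⇓rec₀ d) ρ a as fr b m≤ e =
    let (ρ₁ , ex₁ , j≡ , fr₁) = set-exec fr zro (2 + fr) ρ refl
        low r r<fr = fr₁ r (≤-trans r<fr (m≤n+m fr 2)) (<⇒≢ r<fr)
        (ρ₂ , ex₂ , v≡ , fr₂) = computes d ρ₁ as (1 + fr) (2 + fr) (weaken as (m≤n+m fr 2) (b ∘ suc)) ≤-refl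
          (keep-args as (b ∘ suc) low e)
    in ρ₂ , trans (fr₂ fr (m≤n+m (suc fr) 1) (<⇒≢ (n<1+n fr))) j≡ , v≡ ,
       (λ r r<fr → trans (fr₂ r (≤-trans r<fr (m≤n+m fr 2)) (<⇒≢ (m<n⇒m<1+n r<fr))) (low r r<fr)) ,
       λ ρ′ ex → seq (seq ex₁ ex₂) ex
  computesRec (⇓rec₊ {n = m} d d′) ρ a as fr b m< e =
    let (ρₘ , j≡ , acc≡ , same , k) = computesRec d ρ a as fr b (<⇒≤ m<) e
        (ρ₁ , ex₁ , acc≡′ , fr₁) = computes d′ ρₘ (fr ∷ 1 + fr ∷ as) (1 + fr) (2 + fr)
          (cons-below (m≤n+m (suc fr) 1) (cons-below ≤-refl (weaken as (m≤n+m fr 2) (b ∘ suc)))) ≤-refl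
          (cong₂ _∷_ j≡ (cong₂ _∷_ acc≡ (keep-args as (b ∘ suc) same e)))
        (ρ₂ , ex₂ , j≡′ , fr₂) = set-exec fr (inc fr) (2 + fr) ρ₁
          (cong suc (trans (fr₁ fr (m≤n+m (suc fr) 1) (<⇒≢ (n<1+n fr))) j≡))
    in ρ₂ , j≡′ , trans (fr₂ (1 + fr) ≤-refl (λ e → <⇒≢ (n<1+n fr) (sym e))) acc≡′ ,
       (λ r r<fr → trans (fr₂ r (≤-trans r<fr (m≤n+m fr 2)) (<⇒≢ r<fr))
                    (trans (fr₁ r (≤-trans r<fr (m≤n+m fr 2)) (<⇒≢ (m<n⇒m<1+n r<fr))) (same r r<fr))) ,
       λ ρ′ ex → k ρ′ (until-more
         (trans (cong₂ _≡ᵇ_ (same a (b zero)) j≡) (≢⇒≡ᵇ-false (λ e → <⇒≢ m< (sym e)))) (seq ex₁ ex₂) ex)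

-- The register machine as a row system

data Ctrl (S : Set) : Set where
  init ann : Ctrl S
  run      : S → Ctrl S

Ctrl-finite : ∀ {S} → Finite S → Finite (Ctrl S)
Ctrl-finite fin = retract (λ { init → nothing ; ann → just nothing ; (run s) → just (just s) })
  (λ { nothing → init ; (just nothing) → ann ; (just (just s)) → run s })
  (λ { init → refl ; ann → refl ; (run s) → refl }) (Maybe-finite (Maybe-finite fin))

bitAt : ∀ {l} → Vec Bool l → ℕ → Bool
bitAt [] j = false
bitAt (b ∷ bs) zero = b
bitAt (b ∷ bs) (suc j) = bitAt bs j

bits : ∀ l → (ℕ → Bool) → Vec Bool l
bits zero f = []
bits (suc l) f = f 0 ∷ bits l (f ∘ suc)

bitAt-bits : ∀ {l j} f → j < l → bitAt (bits l f) j ≡ f j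
bitAt-bits {suc l} {zero} f _ = refl
bitAt-bits {suc l} {suc j} f (s≤s p) = bitAt-bits (f ∘ suc) p

anyUpTo-none : ∀ {f} t → (∀ k → k < t → f k ≡ false) → anyUpTo t f ≡ false
anyUpTo-none zero h = refl
anyUpTo-none (suc t) h rewrite anyUpTo-none t (λ k k<t → h k (m<n⇒m<1+n k<t)) = h t ≤-refl

-- A single cell carries the bit of a register, so the existential test of the row evaluates `g` at
-- the value `m` of that register.
anyUpTo-point : ∀ {f} (g : ℕ → Bool) m t → (∀ k → k < t → f k ≡ ((m ≡ᵇ k) ∧ g k)) → m < t → anyUpTo t f ≡ g m
anyUpTo-point {f} g m (suc t) h m<1+t with m≤n⇒m<n∨m≡n (≤-pred m<1+t)
... | inj₁ m<t rewrite anyUpTo-point g m t (λ k k<t → h k (m<n⇒m<1+n k<t)) m<t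
                     | h t ≤-refl | ≢⇒≡ᵇ-false (<⇒≢ m<t) = ∨-identityʳ (g m)
... | inj₂ refl rewrite anyUpTo-none {f} t (λ k k<t → trans (h k (m<n⇒m<1+n k<t))
                          (cong (_∧ g k) (≢⇒≡ᵇ-false (λ e → <⇒≢ k<t (sym e)))))
                      | h t ≤-refl | ≡ᵇ-refl t = refl

exprBound : Expr → ℕ
exprBound zro = 0
exprBound (var i) = suc i
exprBound (inc i) = suc i

guardBound : ∀ {n} → Guard n → ℕ
guardBound (equal r r′) = suc r ⊔ suc r′
guardBound (letterIs a r) = suc r

instrBound : ∀ {n} → Instr n → ℕ
instrBound (move r e) = exprBound e
instrBound (test g) = guardBound g

bound : ∀ {n} → Prog n → ℕ
bound (set r e) = exprBound e
bound (seq p q) = bound p ⊔ bound q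
bound (until g p) = guardBound g ⊔ bound p
bound (when g p) = guardBound g ⊔ bound p

instr-bounded : ∀ {n} (p : Prog n) s → instrBound (instr p s) ≤ bound p
instr-bounded (set r e) _ = ≤-refl
instr-bounded (seq p q) (inj₁ s) = ≤-trans (instr-bounded p s) (m≤m⊔n _ _)
instr-bounded (seq p q) (inj₂ s) = ≤-trans (instr-bounded q s) (m≤n⊔m (bound p) _)
instr-bounded (until g p) nothing = m≤m⊔n _ _
instr-bounded (until g p) (just s) = ≤-trans (instr-bounded p s) (m≤n⊔m (guardBound g) _)
instr-bounded (when g p) nothing = m≤m⊔n _ _
instr-bounded (when g p) (just s) = ≤-trans (instr-bounded p s) (m≤n⊔m (guardBound g) _)

Branch : (ℕ → ℕ) → Set
Branch parent = ∃ λ (c : ℕ → ℕ) → c 0 ≡ 0 × (∀ k → parent (c (suc k)) ≡ c k × c k < c (suc k))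

-- A program is run for the values 0, 1, 2, … of register 0; the result is in register 1.
module Machine {n : ℕ} (someLetter : Fin n) (body : Prog n) where

  registers : ℕ
  registers = 2 ⊔ bound body

  Control : Set
  Control = Ctrl (State body)

  action : Control → ℕ → Expr
  action init j = zro
  action ann j = assign 0 (inc 0) j
  action (run s) j = act (instr body s) j

  -- Bit `j` of cell `k` says that register `j` has the value `k`. Incrementing copies from the left
  -- neighbour, and 0 is the cell without a left neighbour.
  newBit : Expr → Maybe (Vec Bool registers) → Maybe (Vec Bool registers) → Bool
  newBit zro left mid = Maybe.maybe′ (λ _ → false) true left
  newBit (var i) left mid = Maybe.maybe′ (λ b → bitAt b i) false mid
  newBit (inc i) left mid = Maybe.maybe′ (λ b → bitAt b i) false left

  testCell : Instr n → Fin n → Vec Bool registers → Bool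
  testCell (move r e) a b = false
  testCell (test (equal r r′)) a b = bitAt b r ∧ bitAt b r′
  testCell (test (letterIs a′ r)) a b = bitAt b r ∧ ⌊ a FinP.≟ a′ ⌋

  guardCell : Control → Fin n → Vec Bool registers → Bool
  guardCell (run s) a b = testCell (instr body s) a b
  guardCell _ a b = false

  nextControl : Control → Bool → Control
  nextControl (run s) b = Maybe.maybe′ run ann (advance body s b)
  nextControl _ b = run (entry body)

  isAnn : Control → Bool
  isAnn ann = true
  isAnn _ = false

  system : RowSystem n
  system = record
    { Control = Control
    ; Content = Vec Bool registers
    ; finControl = Ctrl-finite (State-finite body)
    ; finContent = Vec-finite Bool-finite registers
    ; control₀ = init
    ; guard = guardCell
    ; next = nextControl
    ; content = λ c left mid → bits registers λ j → newBit (action c j) left mid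
    ; announcing = isAnn
    ; source = λ b → bitAt b 1
    ; target = λ b → bitAt b 0
    ; someLetter = someLetter
    }

  open RowSystem system hiding (Control; someLetter)

  module _ (x : ωWord n) where

    open Semantics x

    env : ℕ → Env
    env zero j = 0
    env (suc t) j = ev (action (controlAt x t) j) (env t)

    ev-≤ : ∀ e ρ t → (∀ j → ρ j < t) → ev e ρ ≤ t
    ev-≤ zro ρ t h = z≤n
    ev-≤ (var i) ρ t h = <⇒≤ (h i)
    ev-≤ (inc i) ρ t h = h i

    -- A value grows by at most one per step, as does the row, so it always has a cell to be shown
    -- in. Row 0 has no cells, and its environment is a dummy.
    env-< : ∀ t j → env (suc t) j < suc t
    env-< zero j = s≤s z≤n
    env-< (suc t) j = s≤s (ev-≤ (action (controlAt x (suc t)) j) (env (suc t)) (suc t) (env-< t))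

    action-bounded : ∀ c j → j < registers → exprBound (action c j) ≤ registers
    action-bounded init j _ = z≤n
    action-bounded ann j j<r with j ≡ᵇ 0
    ... | true = m≤n⇒m≤1+n z≤n ⟨≤⟩ m≤m⊔n 2 (bound body)
      where
      _⟨≤⟩_ : ∀ {a} → a ≤ 2 → 2 ≤ registers → 1 ≤ registers
      _ ⟨≤⟩ h = ≤-trans (s≤s z≤n) h
    ... | false = j<r
    action-bounded (run s) j j<r with instr body s | instr-bounded body s
    ... | test g | _ = j<r
    ... | move r e | b with j ≡ᵇ r
    ... | true = ≤-trans b (m≤n⊔m 2 (bound body))
    ... | false = j<r

    BitsRight : ℕ → Set
    BitsRight t = ∀ k j → k < t → j < registers → bitAt (contentAt x t k) j ≡ (env t j ≡ᵇ k)

    bits-step : ∀ t → BitsRight (suc t) → ∀ e k → k < suc (suc t) → exprBound e ≤ registers →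
                newBit e (leftOf x (suc t) k) (midOf x (suc t) k) ≡ (ev e (env (suc t)) ≡ᵇ k)
    bits-step t ih zro zero _ _ = refl
    bits-step t ih zro (suc k) _ _ = refl
    bits-step t ih (inc i) zero _ _ = refl
    bits-step t ih (inc i) (suc k) (s≤s k<) b = ih k i k< b
    bits-step t ih (var i) k k< b with m≤n⇒m<n∨m≡n (≤-pred k<)
    ... | inj₁ k<t rewrite <⇒<ᵇ≡true k<t = ih k i k<t b
    ... | inj₂ refl rewrite ≥⇒<ᵇ≡false (≤-refl {t}) = sym (≢⇒≡ᵇ-false (<⇒≢ (env-< t i)))

    bits-right : ∀ t → BitsRight (suc t)
    bits-right zero zero j _ j<r = bitAt-bits (λ j → newBit (action init j) nothing nothing) j<r
    bits-right zero (suc k) j (s≤s ()) j<r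
    bits-right (suc t) k j k< j<r = trans
      (bitAt-bits (λ j → newBit (action (controlAt x (suc t)) j) (leftOf x (suc t) k) (midOf x (suc t) k)) j<r)
      (bits-step t (bits-right t) (action (controlAt x (suc t)) j) k k<
        (action-bounded (controlAt x (suc t)) j j<r))

    test-right : ∀ t ι → instrBound ι ≤ registers →
                 anyUpTo (suc t) (λ k → testCell ι (x k) (contentAt x (suc t) k)) ≡ result ι (env (suc t))
    test-right t (move r e) b = anyUpTo-none (suc t) λ _ _ → refl
    test-right t (test (equal r r′)) b = anyUpTo-point (λ k → env (suc t) r′ ≡ᵇ k) (env (suc t) r) (suc t)
      (λ k k< → cong₂ _∧_ (bits-right t k r k< (≤-trans (m≤m⊔n (suc r) (suc r′)) b))
                          (bits-right t k r′ k< (≤-trans (m≤n⊔m (suc r) (suc r′)) b)))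
      (env-< t r)
    test-right t (test (letterIs a r)) b = anyUpTo-point (λ k → ⌊ x k FinP.≟ a ⌋) (env (suc t) r) (suc t)
      (λ k k< → cong (_∧ _) (bits-right t k r k< b)) (env-< t r)

    next-run : ∀ {t s} → controlAt x (suc t) ≡ run s →
               controlAt x (suc (suc t)) ≡ Maybe.maybe′ run ann (advance body s (result (instr body s) (env (suc t))))
               × env (suc (suc t)) ≡ effect (instr body s) (env (suc t))
    next-run {t} {s} e rewrite e =
      cong (λ b → Maybe.maybe′ run ann (advance body s b))
        (test-right t (instr body s) (≤-trans (instr-bounded body s) (m≤n⊔m 2 (bound body)))) , refl

    -- `spec` covers every initial environment because the registers are not cleared between rounds.
    module Correct (parent : ℕ → ℕ)
                   (spec : ∀ ρ → ∃ λ ρ′ → Runs body (entry body) ρ ρ′ × ρ′ 0 ≡ ρ 0 × ρ′ 1 ≡ parent (ρ 0)) where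

      Good : ℕ → Env → Set
      Good i ρ = ρ 0 ≡ i × ρ 1 ≡ parent i

      data Phase (i : ℕ) (t : ℕ) : Set where
        announced : controlAt x t ≡ ann → Good i (env t) → Phase i t
        running   : ∀ {s ρ′} → controlAt x t ≡ run s → Runs body s (env t) ρ′ → Good i ρ′ → Phase i t

      -- The number of announcements before row `t`; from row 1 on it is the argument being treated.
      index : ℕ → ℕ
      index zero = 0
      index (suc t) = if isAnn (controlAt x t) then suc (index t) else index t

      begin-phase : ∀ {t i} → controlAt x t ≡ run (entry body) → env t 0 ≡ i → Phase i t
      begin-phase {t} c e with spec (env t)
      ... | ρ′ , r , e₀ , e₁ = running c r (trans e₀ e , trans e₁ (cong parent e))

      phase-step : ∀ {i t s ρ′} → controlAt x (suc t) ≡ run s → Runs body s (env (suc t)) ρ′ → Good i ρ′ →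
                   Phase i (suc (suc t))
      phase-step {i} {t} {s} c r g with next-run {t} c
      phase-step {i} {t} {s} c (stop e) g | c′ , ρ≡ =
        announced (trans c′ (cong (Maybe.maybe′ run ann) e)) (subst (Good i) (sym ρ≡) g)
      phase-step {i} {t} {s} {ρ′} c (more {s′ = s′} e r) g | c′ , ρ≡ =
        running (trans c′ (cong (Maybe.maybe′ run ann) e)) (subst (λ ρ → Runs body s′ ρ ρ′) (sym ρ≡) r) g

      index-ann : ∀ t → controlAt x t ≡ ann → index (suc t) ≡ suc (index t)
      index-ann t c = cong (λ c → if isAnn c then suc (index t) else index t) c

      index-run : ∀ t {s} → controlAt x t ≡ run s → index (suc t) ≡ index t
      index-run t c = cong (λ c → if isAnn c then suc (index t) else index t) c

      after-ann : ∀ {c} b → c ≡ ann → nextControl c b ≡ run (entry body)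
      after-ann b refl = refl

      phase : ∀ t → Phase (index (suc t)) (suc t)
      phase zero = begin-phase refl refl
      phase (suc t) with phase t
      ... | announced c (e , _) = begin-phase (after-ann _ c)
              (trans (cong (λ c → ev (action c 0) (env (suc t))) c) (trans (cong suc e) (sym (index-ann (suc t) c))))
      ... | running c r g = subst (λ i → Phase i (suc (suc t))) (sym (index-run (suc t) c)) (phase-step c r g)

      next-announcement : ∀ t → ∃ λ t′ → t ≤ t′ × controlAt x (suc t′) ≡ ann × index (suc t′) ≡ index (suc t)
      next-announcement t with phase t
      ... | announced c _ = t , ≤-refl , c , refl
      ... | running c r g = go t c refl r
        where
        go : ∀ t {s ρ ρ′} → controlAt x (suc t) ≡ run s → env (suc t) ≡ ρ → Runs body s ρ ρ′ →
             ∃ λ t′ → t ≤ t′ × controlAt x (suc t′) ≡ ann × index (suc t′) ≡ index (suc t)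
        go t c refl r with next-run {t} c
        go t c refl (stop e) | c′ , _ =
          suc t , n≤1+n t , trans c′ (cong (Maybe.maybe′ run ann) e) , index-run (suc t) c
        go t c refl (more e r) | c′ , ρ≡ with go (suc t) (trans c′ (cong (Maybe.maybe′ run ann) e)) ρ≡ r
        ... | t′ , t<t′ , c″ , i≡ = t′ , <⇒≤ t<t′ , c″ , trans i≡ (index-run (suc t) c)

      at-announcement : ∀ {t} → controlAt x (suc t) ≡ ann → Good (index (suc t)) (env (suc t))
      at-announcement {t} c with phase t
      ... | announced _ g = g
      ... | running c′ _ _ = case trans (sym c) c′ of λ ()

-- Walks and branches

firstFrom : ∀ (p : ℕ → Bool) d N → p (N + d) ≡ true →
            ∃ λ t → N ≤ t × p t ≡ true × (∀ s → N ≤ s → s < t → p s ≡ false)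
firstFrom p d N h with p N in e
... | true = N , ≤-refl , e , λ s N≤s s<N → ⊥-elim (<⇒≱ s<N N≤s)
firstFrom p zero N h | false = case trans (sym e) (trans (cong p (sym (+-identityʳ N))) h) of λ ()
firstFrom p (suc d) N h | false with firstFrom p d (suc N) (trans (cong p (sym (+-suc N d))) h)
... | t , N<t , pt , none = t , <⇒≤ N<t , pt , below
  where
  below : ∀ s → N ≤ s → s < t → p s ≡ false
  below s N≤s s<t with m≤n⇒m<n∨m≡n N≤s
  ... | inj₁ N<s = none s N<s s<t
  ... | inj₂ refl = e

-- Every number is announced once, in increasing order. So only an increasing sequence can be
-- followed by a pointer, and a walk yields one; `parent₀` secures its first step by excluding a
-- jump from 0 to 0.
module MachineWalk {n : ℕ} (someLetter : Fin n) (body : Prog n) (x : ωWord n) (parent : ℕ → ℕ)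
  (spec : ∀ ρ → ∃ λ ρ′ → Semantics.Runs x body (entry body) ρ ρ′ × ρ′ 0 ≡ ρ 0 × ρ′ 1 ≡ parent (ρ 0))
  (parent₀ : parent 0 ≢ 0) where

  open Machine someLetter body
  open RowSystem system hiding (Control; someLetter)
  open Correct x parent spec

  1<registers : 1 < registers
  1<registers = m≤m⊔n 2 (bound body)

  isAnn⇒ : ∀ {c} → isAnn c ≡ true → c ≡ ann
  isAnn⇒ {ann} _ = refl

  announcement : ∀ t → isAnn (controlAt x t) ≡ true →
                 Good (index t) (env x t) × index (suc t) ≡ suc (index t) × BitsRight x t × (∀ j → env x t j < t)
  announcement (suc t) a = let c = isAnn⇒ a in
    at-announcement {t} c , index-ann (suc t) c , bits-right x t , env-< x t

  index-step : ∀ t → index t ≤ index (suc t)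
  index-step t with isAnn (controlAt x t)
  ... | true = n≤1+n _
  ... | false = ≤-refl

  index-≤ : ∀ t → index t ≤ t
  index-≤ zero = z≤n
  index-≤ (suc t) with isAnn (controlAt x t)
  ... | true = s≤s (index-≤ t)
  ... | false = m≤n⇒m≤1+n (index-≤ t)

  index-mono : ∀ {s t} → s ≤ t → index s ≤ index t
  index-mono {s} s≤t = go (≤⇒≤′ s≤t)
    where
    go : ∀ {t} → s ℕ.≤′ t → index s ≤ index t
    go ≤′-refl = ≤-refl
    go (≤′-step {n = t} p) = ≤-trans (go p) (index-step t)

  module FromBranch (c : ℕ → ℕ) (c₀ : c 0 ≡ 0) (branch : ∀ k → parent (c (suc k)) ≡ c k × c k < c (suc k)) where

    -- The number of jumps made before row `t`; the next one waits for the announcement of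
    -- `c (suc (count t))`.
    count : ℕ → ℕ
    jumpsAt : ℕ → Bool
    jumpsAt t = isAnn (controlAt x t) ∧ (index t ≡ᵇ c (suc (count t)))
    count zero = 0
    count (suc t) = if jumpsAt t then suc (count t) else count t

    jumpsAt⇒ : ∀ t → jumpsAt t ≡ true → isAnn (controlAt x t) ≡ true × index t ≡ c (suc (count t))
    jumpsAt⇒ t j with isAnn (controlAt x t) | index t ≡ᵇ c (suc (count t)) in e
    ... | true | true = refl , ≡ᵇ-true⇒≡ e

    count-jump : ∀ t → jumpsAt t ≡ true → count (suc t) ≡ suc (count t)
    count-jump t j rewrite j = refl

    count-stay : ∀ t → jumpsAt t ≡ false → count (suc t) ≡ count t
    count-stay t j rewrite j = refl

    visited : ∀ t → c (count t) ≤ index t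
    visited zero = ≤-reflexive c₀
    visited (suc t) with jumpsAt t in j
    ... | false = ≤-trans (visited t) (index-step t)
    ... | true = ≤-trans (≤-reflexive (sym (proj₂ (jumpsAt⇒ t j)))) (index-step t)

    -- The awaited announcement has not been missed: after a jump this holds since the branch
    -- increases, otherwise since the number announced was a different one.
    ahead : ∀ t → index t ≤ c (suc (count t))
    ahead zero = z≤n
    ahead (suc t) with isAnn (controlAt x t) | index t ≡ᵇ c (suc (count t)) in e
    ... | false | _ = ahead t
    ... | true | true = ≤-trans (s≤s (≤-reflexive (≡ᵇ-true⇒≡ e))) (proj₂ (branch (suc (count t))))
    ... | true | false = ≤∧≢⇒< (ahead t) (≡ᵇ-false⇒≢ e)

    inRowAt : ∀ t → c (count (suc t)) ≤ t
    inRowAt t with jumpsAt t in j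
    ... | true = ≤-trans (≤-reflexive (sym (proj₂ (jumpsAt⇒ t j)))) (index-≤ t)
    ... | false = ≤-trans (visited t) (index-≤ t)

    no-ann-between : ∀ {t t′} → t ℕ.≤′ t′ → index t′ ≡ index t → count t′ ≡ count t
    no-ann-between ≤′-refl e = refl
    no-ann-between {t} (≤′-step {n = t′} p) e with isAnn (controlAt x t′) in a
    ... | false = no-ann-between p e
    ... | true = ⊥-elim (<-irrefl (sym e) (s≤s (index-mono (≤′⇒≤ p))))

    -- Induction on the number `d` of announcements that pass before the awaited one.
    some-jump : ∀ d t → index (suc t) + d ≡ c (suc (count (suc t))) → ∃ λ t′ → t ≤ t′ × jumpsAt t′ ≡ true
    some-jump d t e with next-announcement t
    ... | t′ , t≤t′ , ann′ , i≡ = go d e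
      where
      count≡ : count (suc t′) ≡ count (suc t)
      count≡ = no-ann-between (≤⇒≤′ (s≤s t≤t′)) i≡
      go : ∀ d → index (suc t) + d ≡ c (suc (count (suc t))) → ∃ λ t′ → t ≤ t′ × jumpsAt t′ ≡ true
      go zero e = suc t′ , m≤n⇒m≤1+n t≤t′ , cong₂ _∧_ (cong isAnn ann′)
        (trans (cong (index (suc t′) ≡ᵇ_) (trans (cong (c ∘ suc) count≡)
          (trans (sym e) (trans (+-identityʳ _) (sym i≡))))) (≡ᵇ-refl (index (suc t′))))
      go (suc d) e =
        let noJump = trans (cong₂ _∧_ (cong isAnn ann′) (≢⇒≡ᵇ-false λ e′ →
                       <⇒≢ (m<m+n (index (suc t)) z<s) (trans (sym i≡) (trans e′ (trans (cong (c ∘ suc) count≡) (sym e)))))) refl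
            (t″ , lt , j) = some-jump d (suc t′)
              (trans (cong (_+ d) (trans (index-ann (suc t′) ann′) (cong suc i≡)))
              (trans (sym (+-suc (index (suc t)) d)) (trans e (cong (c ∘ suc)
                (sym (trans (count-stay (suc t′) noJump) count≡))))))
        in t″ , ≤-trans t≤t′ (<⇒≤ lt) , j

    walk : Walk x
    walk = record
      { pointer = c ∘ count
      ; jumps = jumpsAt
      ; begin = c₀
      ; inRow = inRowAt
      ; stays = λ t j → cong c (count-stay t j)
      ; jump = jumpAt
      ; often = λ N → some-jump (c (suc (count (suc N))) ∸ index (suc N)) N (m+[n∸m]≡n (ahead (suc N)))
      }
      where
      jumpAt : ∀ t → jumpsAt t ≡ true → _
      jumpAt t j with jumpsAt⇒ t j
      ... | a , i≡ with announcement t a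
      ... | (e₀ , e₁) , _ , right , env<t =
        let old≡ = trans e₁ (trans (cong parent i≡) (proj₁ (branch (count t))))
            new≡ = trans e₀ (trans i≡ (cong c (sym (count-jump t j))))
            old< = subst (_< t) old≡ (env<t 1)
            new< = subst (_< t) new≡ (env<t 0)
        in a , (old< , trans (right _ 1 old< 1<registers) (trans (cong (_≡ᵇ c (count t)) old≡) (≡ᵇ-refl (c (count t))))) ,
               (new< , trans (right _ 0 new< (≤-trans (s≤s z≤n) 1<registers)) (trans (cong (_≡ᵇ c (count (suc t))) new≡) (≡ᵇ-refl (c (count (suc t))))))

  branch⇒walk : Branch parent → Walk x
  branch⇒walk (c , c₀ , branch) = FromBranch.walk c c₀ branch

  walk⇒branch : Walk x → Branch parent
  walk⇒branch w = c , begin , λ k → parent-c k , increasing k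
    where
    open Walk w
    nextJump : ∀ N → ∃ λ t → N ≤ t × jumps t ≡ true × (∀ s → N ≤ s → s < t → jumps s ≡ false)
    nextJump N with often N
    ... | t , N≤t , j = firstFrom jumps (t ∸ N) N (trans (cong jumps (m+[n∸m]≡n N≤t)) j)
    from time : ℕ → ℕ
    from zero = 0
    from (suc k) = suc (time k)
    time k = proj₁ (nextJump (from k))
    c : ℕ → ℕ
    c k = pointer (from k)
    jumped : ∀ k → jumps (time k) ≡ true
    jumped k = proj₁ (proj₂ (proj₂ (nextJump (from k))))
    constant : ∀ {s t} → s ℕ.≤′ t → (∀ u → s ≤ u → u < t → jumps u ≡ false) → pointer t ≡ pointer s
    constant ≤′-refl h = refl
    constant (≤′-step {n = t} p) h = trans (stays t (h t (≤′⇒≤ p) ≤-refl))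
      (constant p λ u s≤u u<t → h u s≤u (m<n⇒m<1+n u<t))
    pointer-time : ∀ k → pointer (time k) ≡ pointer (from k)
    pointer-time k = let (_ , le , _ , none) = nextJump (from k) in constant (≤⇒≤′ le) none
    facts : ∀ k → parent (index (time k)) ≡ c k × index (time k) ≡ c (suc k) ×
                  index (suc (time k)) ≡ suc (index (time k))
    facts k with jump (time k) (jumped k)
    ... | a , (old< , s) , (new< , g) with announcement (time k) a
    ... | (e₀ , e₁) , i≡ , right , _ =
      trans (sym e₁) (trans (≡ᵇ-true⇒≡ (trans (sym (right _ 1 old< 1<registers)) s))
        (pointer-time k)) ,
      trans (sym e₀) (≡ᵇ-true⇒≡ (trans (sym (right _ 0 new< (≤-trans (s≤s z≤n) 1<registers))) g)) , i≡
    parent-c : ∀ k → parent (c (suc k)) ≡ c k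
    parent-c k = let (p , i , _) = facts k in trans (cong parent (sym i)) p
    increasing : ∀ k → c k < c (suc k)
    increasing zero = subst (_< c 1) (sym begin)
      (n≢0⇒n>0 λ e → parent₀ (trans (cong parent (sym e)) (trans (parent-c 0) begin)))
    increasing (suc k) =
      let (_ , i , i+) = facts k
          (_ , i′ , _) = facts (suc k)
      in ≤-trans (≤-reflexive (trans (cong suc (sym i)) (sym i+)))
           (≤-trans (index-mono (proj₁ (proj₂ (nextJump (from (suc k)))))) (≤-reflexive i′))


-- A calculus of computable functions

Computable : ∀ {k} → (Vec ℕ k → ℕ) → Set
Computable {k} F = ∃ λ (f : PR k) → ∀ xs → f [ xs ]⇓ F xs

b2n : Bool → ℕ
b2n true = 1
b2n false = 0

Decides : ∀ {k} → (Vec ℕ k → Bool) → Set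
Decides B = Computable (b2n ∘ B)

pattern #0 = zero
pattern #1 = suc #0
pattern #2 = suc #1

projections : ∀ {l m} (ι : Fin l → Fin m) (ys : Vec ℕ l) {xs : Vec ℕ m} →
              (∀ i → lookup xs (ι i) ≡ lookup ys i) →
              Pointwise (λ g z → g [ xs ]⇓ z) (tabulate (proj ∘ ι)) ys
projections ι [] h = []
projections ι (y ∷ ys) {xs} h =
  subst (proj (ι zero) [ xs ]⇓_) (h zero) ⇓proj ∷ projections (ι ∘ suc) ys (h ∘ suc)

module _ {k : ℕ} where

  Computable-resp : ∀ {F G : Vec ℕ k → ℕ} → (∀ xs → F xs ≡ G xs) → Computable F → Computable G
  Computable-resp h (f , p) = f , λ xs → subst (f [ xs ]⇓_) (h xs) (p xs)

  Decides-resp : ∀ {B C : Vec ℕ k → Bool} → (∀ xs → B xs ≡ C xs) → Decides B → Decides C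
  Decides-resp h = Computable-resp (cong b2n ∘ h)

  projᶜ : ∀ i → Computable {k} (λ xs → lookup xs i)
  projᶜ i = proj i , λ xs → ⇓proj

  sucᶜ : ∀ {F} → Computable {k} F → Computable (suc ∘ F)
  sucᶜ (f , p) = comp sucᶠ (f ∷ []) , λ xs → ⇓comp (p xs ∷ []) ⇓suc

  constᶜ : ∀ m → Computable {k} (λ _ → m)
  constᶜ zero = comp zeroᶠ [] , λ xs → ⇓comp [] ⇓zero
  constᶜ (suc m) = sucᶜ (constᶜ m)

  weakenᶜ : ∀ {F} → Computable {k} F → Computable {suc k} (λ xs → F (Vec.tail xs))
  weakenᶜ (f , p) = comp f (tabulate (proj ∘ suc)) , λ { (x ∷ xs) →
    ⇓comp (projections suc xs λ _ → refl) (p xs) }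

  ap₁ : ∀ {φ : ℕ → ℕ} {F} → Computable {1} (λ xs → φ (lookup xs #0)) → Computable {k} F → Computable (φ ∘ F)
  ap₁ (f , p) (g , q) = comp f (g ∷ []) , λ xs → ⇓comp (q xs ∷ []) (p _)

  ap₂ : ∀ {φ : ℕ → ℕ → ℕ} {F G} → Computable {2} (λ xs → φ (lookup xs #0) (lookup xs #1)) →
        Computable {k} F → Computable G → Computable (λ xs → φ (F xs) (G xs))
  ap₂ (f , p) (g , q) (h , r) = comp f (g ∷ h ∷ []) , λ xs → ⇓comp (q xs ∷ r xs ∷ []) (p _)

  ap₃ : ∀ {φ : ℕ → ℕ → ℕ → ℕ} {F G H} →
        Computable {3} (λ xs → φ (lookup xs #0) (lookup xs #1) (lookup xs #2)) →
        Computable {k} F → Computable G → Computable H → Computable (λ xs → φ (F xs) (G xs) (H xs))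
  ap₃ (f , p) (g , q) (h , r) (i , s) =
    comp f (g ∷ h ∷ i ∷ []) , λ xs → ⇓comp (q xs ∷ r xs ∷ s xs ∷ []) (p _)

  recᶜ : (φ : ℕ → Vec ℕ k → ℕ) {F : Vec ℕ k → ℕ} {G : Vec ℕ (2 + k) → ℕ} {N : Vec ℕ k → ℕ} →
         (∀ xs → φ 0 xs ≡ F xs) → (∀ m xs → φ (suc m) xs ≡ G (m ∷ φ m xs ∷ xs)) →
         Computable F → Computable G → Computable N → Computable (λ xs → φ (N xs) xs)
  recᶜ φ {F} {G} {N} e₀ e₊ (f , p) (g , q) (ν , r) =
    comp (rec f g) (ν ∷ tabulate proj) , λ xs → ⇓comp (r xs ∷ projections id xs λ _ → refl) (go (N xs) xs)
    where
    go : ∀ m xs → rec f g [ m ∷ xs ]⇓ φ m xs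
    go zero xs = ⇓rec₀ (subst (f [ xs ]⇓_) (sym (e₀ xs)) (p xs))
    go (suc m) xs = ⇓rec₊ (go m xs) (subst (g [ _ ]⇓_) (sym (e₊ m xs)) (q _))

module _ {k : ℕ} {F G : Vec ℕ k → ℕ} (f : Computable F) (g : Computable G) where

  +ᶜ : Computable (λ xs → F xs + G xs)
  +ᶜ = recᶜ (λ m xs → m + G xs) (λ _ → refl) (λ _ _ → refl) g (sucᶜ (projᶜ #1)) f

  *ᶜ : Computable (λ xs → F xs * G xs)
  *ᶜ = recᶜ (λ m xs → m * G xs) {G = λ v → G (Vec.tail (Vec.tail v)) + lookup v #1} (λ _ → refl) (λ _ _ → refl) (constᶜ 0)
         (recᶜ (λ m v → m + lookup v #1) (λ _ → refl) (λ _ _ → refl) (projᶜ #1) (sucᶜ (projᶜ #1))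
           (weakenᶜ (weakenᶜ g))) f

predᶜ : ∀ {k} {F : Vec ℕ k → ℕ} → Computable F → Computable (λ xs → pred (F xs))
predᶜ f = recᶜ (λ m _ → pred m) (λ _ → refl) (λ _ _ → refl) (constᶜ 0) (projᶜ #0) f

module _ {k : ℕ} {F G : Vec ℕ k → ℕ} (f : Computable F) (g : Computable G) where

  ∸ᶜ : Computable (λ xs → F xs ∸ G xs)
  ∸ᶜ = recᶜ (λ m xs → F xs ∸ m) {G = λ v → pred (lookup v #1)} (λ _ → refl) (λ m xs → sym (pred[m∸n]≡m∸[1+n] (F xs) m)) f
         (predᶜ (projᶜ #1)) g

notᶜ : ∀ {k} {B : Vec ℕ k → Bool} → Decides B → Decides (not ∘ B)
notᶜ {B = B} b = Computable-resp (λ xs → eq (B xs)) (∸ᶜ (constᶜ 1) b)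
  where
  eq : ∀ b → 1 ∸ b2n b ≡ b2n (not b)
  eq true = refl
  eq false = refl

module _ {k : ℕ} {B C : Vec ℕ k → Bool} (b : Decides B) (c : Decides C) where

  ∧ᶜ : Decides (λ xs → B xs ∧ C xs)
  ∧ᶜ = Computable-resp (λ xs → eq (B xs) (C xs)) (*ᶜ b c)
    where
    eq : ∀ b c → b2n b * b2n c ≡ b2n (b ∧ c)
    eq true true = refl
    eq true false = refl
    eq false c = refl

module _ {k : ℕ} {B : Vec ℕ k → Bool} {F G : Vec ℕ k → ℕ}
         (b : Decides B) (f : Computable F) (g : Computable G) where

  ifᶜ : Computable (λ xs → if B xs then F xs else G xs)
  ifᶜ = Computable-resp (λ xs → eq (B xs) (F xs) (G xs)) (+ᶜ (*ᶜ b f) (*ᶜ (notᶜ b) g))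
    where
    eq : ∀ b m n → b2n b * m + b2n (not b) * n ≡ (if b then m else n)
    eq true m n = trans (+-identityʳ _) (+-identityʳ m)
    eq false m n = +-identityʳ n

module _ {k : ℕ} {B C : Vec ℕ k → Bool} (b : Decides B) (c : Decides C) where

  ∨ᶜ : Decides (λ xs → B xs ∨ C xs)
  ∨ᶜ = Computable-resp (λ xs → eq (B xs) (C xs)) (ifᶜ b (constᶜ 1) c)
    where
    eq : ∀ b c → (if b then 1 else b2n c) ≡ b2n (b ∨ c)
    eq true c = refl
    eq false c = refl

module _ {k : ℕ} where

  isZeroᶜ : {F : Vec ℕ k → ℕ} → Computable F → Decides (λ xs → F xs ≡ᵇ 0)
  isZeroᶜ {F} f = Computable-resp (λ xs → eq (F xs)) (∸ᶜ (constᶜ 1) f)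
    where
    eq : ∀ m → 1 ∸ m ≡ b2n (m ≡ᵇ 0)
    eq zero = refl
    eq (suc m) = 0∸n≡0 m

module _ {k : ℕ} {F G : Vec ℕ k → ℕ} (f : Computable F) (g : Computable G) where

  ≤ᵇᶜ : Decides (λ xs → F xs ≤ᵇ G xs)
  ≤ᵇᶜ = Decides-resp (λ xs → eq (F xs) (G xs)) (isZeroᶜ (∸ᶜ f g))
    where
    <ᵇ-suc : ∀ m n → (m <ᵇ suc n) ≡ (m ≤ᵇ n)
    <ᵇ-suc zero n = refl
    <ᵇ-suc (suc m) n = refl
    eq : ∀ m n → (m ∸ n ≡ᵇ 0) ≡ (m ≤ᵇ n)
    eq zero zero = refl
    eq zero (suc n) = refl
    eq (suc m) zero = refl
    eq (suc m) (suc n) = trans (eq m n) (sym (<ᵇ-suc m n))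

  ≡ᵇᶜ : Decides (λ xs → F xs ≡ᵇ G xs)
  ≡ᵇᶜ = Decides-resp (λ xs → eq (F xs) (G xs)) (isZeroᶜ (+ᶜ (∸ᶜ f g) (∸ᶜ g f)))
    where
    eq : ∀ m n → ((m ∸ n) + (n ∸ m) ≡ᵇ 0) ≡ (m ≡ᵇ n)
    eq zero zero = refl
    eq zero (suc n) = refl
    eq (suc m) zero = refl
    eq (suc m) (suc n) = eq m n

anyUpToᶜ : ∀ {k} (P : ℕ → Vec ℕ k → Bool) {N} → Decides (λ v → P (lookup v #0) (Vec.tail v)) →
           Computable N → Decides (λ xs → anyUpTo (N xs) (λ i → P i xs))
anyUpToᶜ {k} P p n =
  recᶜ (λ m xs → b2n (anyUpTo m (λ i → P i xs)))
    {G = λ v → if lookup v #1 ≡ᵇ 0 then b2n (P (lookup v #0) (Vec.tail (Vec.tail v))) else 1}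
    (λ _ → refl) (λ m xs → eq (anyUpTo m λ i → P i xs) _) (constᶜ 0)
    (ifᶜ (isZeroᶜ (projᶜ #1)) reindexed (constᶜ 1)) n
  where
  eq : ∀ b c → b2n (b ∨ c) ≡ (if b2n b ≡ᵇ 0 then b2n c else 1)
  eq true c = refl
  eq false c = refl
  reindexed : Computable {2 + k} (λ v → b2n (P (lookup v #0) (Vec.tail (Vec.tail v))))
  reindexed = comp (proj₁ p) (proj #0 ∷ tabulate (λ i → proj (Fin.suc (Fin.suc i)))) ,
    λ { (i ∷ y ∷ xs) → ⇓comp (⇓proj ∷ projections (λ i → Fin.suc (Fin.suc i)) xs λ _ → refl) (proj₂ p (i ∷ xs)) }

allUpTo : ℕ → (ℕ → Bool) → Bool
allUpTo m f = not (anyUpTo m (not ∘ f))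

allUpToᶜ : ∀ {k} (P : ℕ → Vec ℕ k → Bool) {N} → Decides (λ v → P (lookup v #0) (Vec.tail v)) →
           Computable N → Decides (λ xs → allUpTo (N xs) (λ i → P i xs))
allUpToᶜ P p n = notᶜ q
  where q = anyUpToᶜ (λ i xs → not (P i xs)) (notᶜ p) n

anyUpTo⇒ : ∀ {f} m → anyUpTo m f ≡ true → ∃ λ i → i < m × f i ≡ true
anyUpTo⇒ {f} (suc m) e with anyUpTo m f in a
... | true = let (i , i<m , fi) = anyUpTo⇒ m a in i , m<n⇒m<1+n i<m , fi
... | false = m , ≤-refl , e

⇒anyUpTo : ∀ {f m i} → i < m → f i ≡ true → anyUpTo m f ≡ true
⇒anyUpTo {f} {suc m} {i} i<m e with m≤n⇒m<n∨m≡n (≤-pred i<m)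
... | inj₁ lt rewrite ⇒anyUpTo {f} lt e = refl
... | inj₂ refl rewrite e = ∨-zeroʳ (anyUpTo i f)

allUpTo⇒ : ∀ {f m i} → allUpTo m f ≡ true → i < m → f i ≡ true
allUpTo⇒ {f} {m} {i} h i<m with f i in e
... | true = refl
... | false with anyUpTo m (not ∘ f) | ⇒anyUpTo {not ∘ f} {m} i<m (cong not e)
allUpTo⇒ {f} () i<m | false | true | _

⇒allUpTo : ∀ {f} m → (∀ i → i < m → f i ≡ true) → allUpTo m f ≡ true
⇒allUpTo {f} m h with anyUpTo m (not ∘ f) in e
... | false = refl
... | true = let (i , i<m , n) = anyUpTo⇒ m e in case trans (sym n) (cong not (h i i<m)) of λ ()

-- The cases up to `M` are wired into the program, so `H` may depend on its index in any way. This
-- admits finite tables obtained by excluded middle.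
casesᶜ : ∀ {k} M (H : ℕ → Vec ℕ k → ℕ) {F : Vec ℕ k → ℕ} → Computable F → (∀ i → Computable (H i)) →
         Computable (λ xs → H (F xs ⊓ M) xs)
casesᶜ zero H {F} f h = Computable-resp (λ xs → cong (λ i → H i xs) (sym (⊓-zeroʳ (F xs)))) (h 0)
casesᶜ (suc M) H {F} f h = Computable-resp eq (ifᶜ (≤ᵇᶜ (constᶜ (suc M)) f) (h (suc M)) (casesᶜ M H f h))
  where
  eq : ∀ xs → (if suc M ≤ᵇ F xs then H (suc M) xs else H (F xs ⊓ M) xs) ≡ H (F xs ⊓ suc M) xs
  eq xs with suc M ≤ᵇ F xs in le
  ... | true = cong (λ i → H i xs) (sym (m≥n⇒m⊓n≡n (≤ᵇ⇒≤ (suc M) (F xs) (subst T (sym le) tt))))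
  ... | false = cong (λ i → H i xs) (trans (m≤n⇒m⊓n≡m F≤M) (sym (m≤n⇒m⊓n≡m (m≤n⇒m≤1+n F≤M))))
    where
    F≤M : F xs ≤ M
    F≤M = ≮⇒≥ λ lt → subst T le (≤⇒≤ᵇ lt)

-- Integer inverses, pairing and codes of words

root : (ℕ → ℕ) → ℕ → ℕ
root φ zero = 0
root φ (suc c) = if φ (suc (root φ c)) ≤ᵇ suc c then suc (root φ c) else root φ c

≤ᵇ≡true⇒≤ : ∀ {m n} → (m ≤ᵇ n) ≡ true → m ≤ n
≤ᵇ≡true⇒≤ {m} {n} e = ≤ᵇ⇒≤ m n (subst T (sym e) tt)

≤ᵇ≡false⇒> : ∀ {m n} → (m ≤ᵇ n) ≡ false → n < m
≤ᵇ≡false⇒> {m} {n} e = ≰⇒> λ le → subst T e (≤⇒≤ᵇ le)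

module _ {φ : ℕ → ℕ} (φ0 : φ 0 ≡ 0) (incr : ∀ q → φ q < φ (suc q)) where

  -- Raising the candidate by at most one per step suffices, as `φ` grows by at least one. Square
  -- roots and division by the base are the instances.
  root-spec : ∀ c → φ (root φ c) ≤ c × c < φ (suc (root φ c))
  root-spec zero = ≤-reflexive φ0 , ≤-<-trans z≤n (incr 0)
  root-spec (suc c) with φ (suc (root φ c)) ≤ᵇ suc c in e
  ... | true = ≤ᵇ≡true⇒≤ e , ≤-<-trans (proj₂ (root-spec c)) (incr _)
  ... | false = m≤n⇒m≤1+n (proj₁ (root-spec c)) , ≤ᵇ≡false⇒> e

  φ-mono : ∀ {p q} → p ≤ q → φ p ≤ φ q
  φ-mono {p} p≤q = go (≤⇒≤′ p≤q)
    where
    go : ∀ {q} → p ℕ.≤′ q → φ p ≤ φ q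
    go ≤′-refl = ≤-refl
    go (≤′-step {n = q} h) = ≤-trans (go h) (<⇒≤ (incr q))

  root-unique : ∀ {c q} → φ q ≤ c → c < φ (suc q) → root φ c ≡ q
  root-unique {c} {q} h h′ = let (l , u) = root-spec c in ≤-antisym
    (≮⇒≥ λ lt → <⇒≱ h′ (≤-trans (φ-mono lt) l)) (≮⇒≥ λ lt → <⇒≱ u (≤-trans (φ-mono lt) h))

root-≤ : ∀ φ c → root φ c ≤ c
root-≤ φ zero = z≤n
root-≤ φ (suc c) with φ (suc (root φ c)) ≤ᵇ suc c
... | true = s≤s (root-≤ φ c)
... | false = m≤n⇒m≤1+n (root-≤ φ c)

rootᶜ : ∀ {k} {φ : ℕ → ℕ} {F : Vec ℕ k → ℕ} → Computable {1} (λ xs → φ (lookup xs #0)) → Computable F →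
        Computable (root φ ∘ F)
rootᶜ {φ = φ} p f = recᶜ (λ m _ → root φ m)
  {G = λ v → if φ (suc (lookup v #1)) ≤ᵇ suc (lookup v #0) then suc (lookup v #1) else lookup v #1}
  (λ _ → refl) (λ _ _ → refl) (constᶜ 0)
  (ifᶜ (≤ᵇᶜ (ap₁ {φ = φ} p (sucᶜ (projᶜ #1))) (sucᶜ (projᶜ #0))) (sucᶜ (projᶜ #1)) (projᶜ #1)) f

square : ℕ → ℕ
square w = w * w

square-incr : ∀ w → square w < square (suc w)
square-incr w = s≤s (≤-trans (*-monoʳ-≤ w (n≤1+n w)) (m≤n+m _ w))

isqrt : ℕ → ℕ
isqrt = root square

isqrt-square : ∀ {s a} → a ≤ s → isqrt (square s + a) ≡ s
isqrt-square {s} {a} a≤s = root-unique refl square-incr (m≤m+n _ a)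
  (s≤s (≤-trans (+-mono-≤ (*-monoʳ-≤ s (n≤1+n s)) a≤s) (≤-reflexive (+-comm _ s))))

opaque

  -- The gap after the square of `a + b` has room for `a`, so the integer square root recovers the
  -- sum. Both components of 0 are 0, which fits 0 as the root of a tree.
  pair : ℕ → ℕ → ℕ
  pair a b = square (a + b) + a

  fst snd : ℕ → ℕ
  fst i = i ∸ square (isqrt i)
  snd i = isqrt i ∸ fst i

  fst-pair : ∀ a b → fst (pair a b) ≡ a
  fst-pair a b rewrite isqrt-square (m≤m+n a b) = m+n∸m≡n (square (a + b)) a

  snd-pair : ∀ a b → snd (pair a b) ≡ b
  snd-pair a b rewrite fst-pair a b | isqrt-square (m≤m+n a b) = m+n∸m≡n a b

  fst-0 : fst 0 ≡ 0
  fst-0 = refl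

  snd-0 : snd 0 ≡ 0
  snd-0 = refl

  <-pair : ∀ a {b} → b ≢ 0 → a < pair a b
  <-pair a {zero} b≢0 = ⊥-elim (b≢0 refl)
  <-pair a {suc b} _ rewrite +-suc a b = s≤s (m≤n+m a _)

  pair-mono : ∀ {a a′ b b′} → a ≤ a′ → b ≤ b′ → pair a b ≤ pair a′ b′
  pair-mono h h′ = +-mono-≤ (*-mono-≤ (+-mono-≤ h h′) (+-mono-≤ h h′)) h

  fst-≤-pair : ∀ a b → a ≤ pair a b
  fst-≤-pair a b = m≤n+m a _

  pair-suc≢0 : ∀ a b → pair (suc a) b ≢ 0
  pair-suc≢0 a b = m+1+n≢0 (square (suc a + b))

  pairᶜ : ∀ {k} {F G : Vec ℕ k → ℕ} → Computable F → Computable G → Computable (λ xs → pair (F xs) (G xs))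
  pairᶜ f g = +ᶜ (*ᶜ (+ᶜ f g) (+ᶜ f g)) f

  isqrtᶜ : ∀ {k} {F : Vec ℕ k → ℕ} → Computable F → Computable (isqrt ∘ F)
  isqrtᶜ = rootᶜ {φ = square} (*ᶜ (projᶜ #0) (projᶜ #0))

  fstᶜ : ∀ {k} {F : Vec ℕ k → ℕ} → Computable F → Computable (fst ∘ F)
  fstᶜ f = ∸ᶜ f (*ᶜ (isqrtᶜ f) (isqrtᶜ f))

  sndᶜ : ∀ {k} {F : Vec ℕ k → ℕ} → Computable F → Computable (snd ∘ F)
  sndᶜ f = ∸ᶜ (isqrtᶜ f) (fstᶜ f)

-- The word w is read off its code ⌜ w ⌝ by its digits: digit i is 0 beyond the end of w, and otherwise
-- one more than the number of the i-th letter.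
module _ (n : ℕ) where

  tailCode headCode : ℕ → ℕ
  tailCode c = root (n *_) (pred c)
  headCode c = pred c ∸ n * tailCode c

  dropCode : ℕ → ℕ → ℕ
  dropCode zero c = c
  dropCode (suc i) c = tailCode (dropCode i c)

  digit : ℕ → ℕ → ℕ
  digit i c = if dropCode i c ≡ᵇ 0 then 0 else suc (headCode (dropCode i c))

  module _ {k : ℕ} where

    tailCodeᶜ : {F : Vec ℕ k → ℕ} → Computable F → Computable (tailCode ∘ F)
    tailCodeᶜ f = rootᶜ {φ = n *_} (*ᶜ (constᶜ n) (projᶜ #0)) (predᶜ f)

    headCodeᶜ : {F : Vec ℕ k → ℕ} → Computable F → Computable (headCode ∘ F)
    headCodeᶜ f = ∸ᶜ (predᶜ f) (*ᶜ (constᶜ n) (tailCodeᶜ f))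

  digitᶜ : ∀ {k} {I F : Vec ℕ k → ℕ} → Computable I → Computable F → Computable (λ xs → digit (I xs) (F xs))
  digitᶜ i f = ifᶜ (isZeroᶜ dropped) (constᶜ 0) (sucᶜ (headCodeᶜ dropped))
    where
    dropped = ap₂ {φ = dropCode} (recᶜ (λ m xs → dropCode m (lookup xs #1)) {G = λ v → tailCode (lookup v #1)}
      (λ _ → refl) (λ _ _ → refl) (projᶜ #1) (tailCodeᶜ (projᶜ #1)) (projᶜ #0)) i f

digitOf : ∀ {n} → Word n → ℕ → ℕ
digitOf [] i = 0
digitOf (a ∷ w) zero = suc (toℕ a)
digitOf (a ∷ w) (suc i) = digitOf w i

module _ {n : ℕ} where

  tailCode-∷ : ∀ (a : Fin n) w → tailCode n ⌜ a ∷ w ⌝ ≡ ⌜ w ⌝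
  tailCode-∷ a w = root-unique (*-zeroʳ n)
    (λ q → <-≤-trans (m<n+m (n * q) (≤-<-trans z≤n (FinP.toℕ<n a))) (≤-reflexive (sym (*-suc n q))))
    (m≤n+m (n * ⌜ w ⌝) (toℕ a))
    (<-≤-trans (+-monoˡ-< (n * ⌜ w ⌝) (FinP.toℕ<n a)) (≤-reflexive (sym (*-suc n ⌜ w ⌝))))

  headCode-∷ : ∀ (a : Fin n) w → headCode n ⌜ a ∷ w ⌝ ≡ toℕ a
  headCode-∷ a w rewrite tailCode-∷ a w = m+n∸n≡m (toℕ a) (n * ⌜ w ⌝)

  dropCode-shift : ∀ i c → dropCode n (suc i) c ≡ dropCode n i (tailCode n c)
  dropCode-shift zero c = refl
  dropCode-shift (suc i) c = cong (tailCode n) (dropCode-shift i c)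

  dropCode-0 : ∀ i → dropCode n i 0 ≡ 0
  dropCode-0 zero = refl
  dropCode-0 (suc i) rewrite dropCode-0 i = refl

  digit-⌜⌝ : ∀ (w : Word n) i → digit n i ⌜ w ⌝ ≡ digitOf w i
  digit-⌜⌝ [] i rewrite dropCode-0 i = refl
  digit-⌜⌝ (a ∷ w) zero = cong suc (headCode-∷ a w)
  digit-⌜⌝ (a ∷ w) (suc i) = trans
    (cong (λ c → if c ≡ᵇ 0 then 0 else suc (headCode n c))
      (trans (dropCode-shift i ⌜ a ∷ w ⌝) (cong (dropCode n i) (tailCode-∷ a w))))
    (digit-⌜⌝ w i)

  digitOf-prefix-< : ∀ (σ : ωWord n) {m i} → i < m → digitOf (prefix σ m) i ≡ suc (toℕ (σ i))
  digitOf-prefix-< σ {suc m} {zero} _ = refl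
  digitOf-prefix-< σ {suc m} {suc i} (s≤s i<m) = digitOf-prefix-< (σ ∘ suc) i<m

  digitOf-prefix-≥ : ∀ (σ : ωWord n) {m i} → m ≤ i → digitOf (prefix σ m) i ≡ 0
  digitOf-prefix-≥ σ {zero} _ = refl
  digitOf-prefix-≥ σ {suc m} {suc i} (s≤s m≤i) = digitOf-prefix-≥ (σ ∘ suc) m≤i

  digitOf-injective : ∀ (v w : Word n) → (∀ i → digitOf v i ≡ digitOf w i) → v ≡ w
  digitOf-injective [] [] h = refl
  digitOf-injective [] (b ∷ w) h = case h 0 of λ ()
  digitOf-injective (a ∷ v) [] h = case h 0 of λ ()
  digitOf-injective (a ∷ v) (b ∷ w) h =
    cong₂ _∷_ (FinP.toℕ-injective (suc-injective (h 0))) (digitOf-injective v w (h ∘ suc))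

⌜⌝-surjective : ∀ {n} c → ∃ λ (w : Word (suc n)) → ⌜ w ⌝ ≡ c
⌜⌝-surjective {n} c = go c (<-wellFounded c)
  where
  go : ∀ c → Acc _<_ c → ∃ λ (w : Word (suc n)) → ⌜ w ⌝ ≡ c
  go zero _ = [] , refl
  go (suc c) (acc rs) =
    let q = root (suc n *_) c
        (lo , hi) = root-spec {suc n *_} (*-zeroʳ n) (λ q → *-monoʳ-< (suc n) (n<1+n q)) c
        (w , e) = go q (rs (s≤s (root-≤ (suc n *_) c)))
        r = c ∸ suc n * q
        r< : r < suc n
        r< = +-cancelʳ-< (suc n * q) r (suc n) (<-≤-trans (≤-<-trans (≤-reflexive (m∸n+n≡m lo)) hi)
               (≤-reflexive (*-suc (suc n) q)))
    in fromℕ< r< ∷ w , cong suc (trans (cong₂ (λ a b → a + suc n * b) (FinP.toℕ-fromℕ< r<) e) (m∸n+n≡m lo))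

-- An appended letter is the most significant digit, so the code of a growing prefix is updated by
-- adding a multiple of a power of the base.
⌜prefix⌝-suc : ∀ {n} (σ : ωWord n) m →
               ⌜ prefix σ (suc m) ⌝ ≡ ⌜ prefix σ m ⌝ + suc (toℕ (σ m)) * n ℕ.^ m
⌜prefix⌝-suc {n} σ zero = cong suc (trans (cong (toℕ (σ 0) +_) (*-zeroʳ n))
  (trans (+-identityʳ _) (sym (*-identityʳ _))))
⌜prefix⌝-suc {n} σ (suc m) = begin
  a + n * ⌜ prefix (σ ∘ suc) (suc m) ⌝ ≡⟨ cong (λ c → a + n * c) (⌜prefix⌝-suc (σ ∘ suc) m) ⟩
  a + n * (p + b * q)                  ≡⟨ cong (a +_) (*-distribˡ-+ n p (b * q)) ⟩
  a + (n * p + n * (b * q))            ≡⟨ sym (+-assoc a (n * p) _) ⟩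
  a + n * p + n * (b * q)              ≡⟨ cong (a + n * p +_) (trans (sym (*-assoc n b q)) (trans (cong (_* q) (*-comm n b)) (*-assoc b n q))) ⟩
  a + n * p + b * (n * q)              ∎
  where
  open ≡-Reasoning
  a = suc (toℕ (σ 0))
  b = suc (toℕ (σ (suc m)))
  p = ⌜ prefix (σ ∘ suc) m ⌝
  q = n ℕ.^ m

-- The program that reads a prefix of the oracle

^ᶜ : ∀ {k} n {F : Vec ℕ k → ℕ} → Computable F → Computable (λ xs → n ℕ.^ F xs)
^ᶜ n f = recᶜ (λ m _ → n ℕ.^ m) {G = λ v → n * lookup v #1} (λ _ → refl) (λ _ _ → refl) (constᶜ 1)
  (*ᶜ (constᶜ n) (projᶜ #1)) f

-- Registers: 0 the argument i, 1 the result, 2 the length ℓ i of a prefix of the oracle, 3 the code of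
-- the prefix of length j, 4 the counter j, 5 the j-th letter of the oracle.
module PrefixProgram {n : ℕ} {ℓ : ℕ → ℕ} {P : ℕ → ℕ → ℕ}
  (ℓᶜ : Computable {1} (λ xs → ℓ (lookup xs #0)))
  (Pᶜ : Computable {2} (λ xs → P (lookup xs #0) (lookup xs #1))) where

  extendᶜ : Computable {3} (λ xs → lookup xs #0 + suc (lookup xs #1) * n ℕ.^ lookup xs #2)
  extendᶜ = +ᶜ (projᶜ #0) (*ᶜ (sucᶜ (projᶜ #1)) (^ᶜ n (projᶜ #2)))

  setConst : ℕ → ℕ → Prog n
  setConst r zero = set r zro
  setConst r (suc m) = setConst r m ⨟ set r (inc r)

  -- A letter of the oracle can be tested but not copied into a register, hence all letters of the
  -- alphabet are tried.
  readLetter : ∀ l → (Fin l → Fin n) → Prog n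
  readLetter zero ι = skip
  readLetter (suc l) ι = when (letterIs (ι zero) 4) (setConst 5 (toℕ (ι zero))) ⨟ readLetter l (ι ∘ suc)

  loopBody loop body : Prog n
  loopBody = readLetter n id ⨟ compile (proj₁ extendᶜ) (3 ∷ 5 ∷ 4 ∷ []) 3 6 ⨟ set 4 (inc 4)
  loop = until (equal 2 4) loopBody
  body = compile (proj₁ ℓᶜ) (0 ∷ []) 2 6 ⨟ set 3 zro ⨟ set 4 zro ⨟ loop ⨟
         compile (proj₁ Pᶜ) (0 ∷ 3 ∷ []) 1 6

  module _ (x : ωWord n) where

    open Semantics x
    open CompileCorrect x

    setConst-exec : ∀ r m ρ → ∃ λ ρ′ → Exec (setConst r m) ρ ρ′ × ρ′ r ≡ m × (∀ j → j ≢ r → ρ′ j ≡ ρ j)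
    setConst-exec r zero ρ = _ , set , assign-same r zro ρ , λ j ne → assign-other zro ρ ne
    setConst-exec r (suc m) ρ =
      let (ρ₁ , e , v , h) = setConst-exec r m ρ
      in _ , seq e set , trans (assign-same r (inc r) ρ₁) (cong suc v) ,
         λ j ne → trans (assign-other (inc r) ρ₁ ne) (h j ne)

    -- The disjunction is the invariant: the letter has been stored already, or it is among those
    -- still to be tried.
    readLetter-exec : ∀ l ι ρ → ∃ λ ρ′ → Exec (readLetter l ι) ρ ρ′ × (∀ j → j ≢ 5 → ρ′ j ≡ ρ j) ×
      (ρ 5 ≡ toℕ (x (ρ 4)) ⊎ (∃ λ i → ι i ≡ x (ρ 4)) → ρ′ 5 ≡ toℕ (x (ρ 4)))
    readLetter-exec zero ι ρ = ρ , until-done (≡ᵇ-refl (ρ 0)) , (λ _ _ → refl) ,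
      λ { (inj₁ e) → e ; (inj₂ (() , _)) }
    readLetter-exec (suc l) ι ρ with x (ρ 4) FinP.≟ ι zero in eq
    ... | yes e =
      let (ρ₁ , ex₁ , v , h₁) = setConst-exec 5 (toℕ (ι zero)) ρ
          (ρ₂ , ex₂ , h₂ , g) = readLetter-exec l (ι ∘ suc) ρ₁
          4≡ = h₁ 4 (λ ())
          right : ρ₁ 5 ≡ toℕ (x (ρ 4))
          right = trans v (cong toℕ (sym e))
      in ρ₂ , seq (when-yes (cong ⌊_⌋ eq) ex₁) ex₂ , (λ j ne → trans (h₂ j ne) (h₁ j ne)) ,
         λ _ → trans (g (inj₁ (trans right (cong (toℕ ∘ x) (sym 4≡))))) (cong (toℕ ∘ x) 4≡)
    ... | no ne =
      let (ρ₂ , ex₂ , h₂ , g) = readLetter-exec l (ι ∘ suc) ρ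
      in ρ₂ , seq (when-no (cong ⌊_⌋ eq)) ex₂ , h₂ , λ where
        (inj₁ e) → g (inj₁ e)
        (inj₂ (zero , e)) → ⊥-elim (ne (sym e))
        (inj₂ (suc i , e)) → g (inj₂ (i , e))

    Reading : ℕ → ℕ → ℕ → Env → Set
    Reading i m j ρ = ρ 0 ≡ i × ρ 2 ≡ m × ρ 3 ≡ ⌜ prefix x j ⌝ × ρ 4 ≡ j

    loopBody-exec : ∀ {i m j} ρ → Reading i m j ρ → ∃ λ ρ′ → Exec loopBody ρ ρ′ × Reading i m (suc j) ρ′
    loopBody-exec {i} {m} {j} ρ (r0 , r2 , r3 , r4) =
      let (ρ₁ , ex₁ , h₁ , g) = readLetter-exec n id ρ
          letter = trans (g (inj₂ (x (ρ 4) , refl))) (cong (toℕ ∘ x) r4)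
          (ρ₂ , ex₂ , v , h₂) = computes (proj₂ extendᶜ (⌜ prefix x j ⌝ ∷ toℕ (x j) ∷ j ∷ [])) ρ₁
            (3 ∷ 5 ∷ 4 ∷ []) 3 6
            (λ { zero → m≤m+n 4 2 ; (suc zero) → ≤-refl ; (suc (suc zero)) → n≤1+n 5 }) (m≤m+n 4 2)
            (cong₂ _∷_ (trans (h₁ 3 λ ()) r3) (cong₂ _∷_ letter (cong (_∷ []) (trans (h₁ 4 λ ()) r4))))
      in _ , seq ex₁ (seq ex₂ set) ,
         trans (h₂ 0 z<s λ ()) (trans (h₁ 0 λ ()) r0) ,
         trans (h₂ 2 (m≤m+n 3 3) λ ()) (trans (h₁ 2 λ ()) r2) ,
         trans v (sym (⌜prefix⌝-suc x j)) ,
         cong suc (trans (h₂ 4 (n≤1+n 5) λ ()) (trans (h₁ 4 λ ()) r4))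

    loop-exec : ∀ d {i m j} ρ → j + d ≡ m → Reading i m j ρ → ∃ λ ρ′ → Exec loop ρ ρ′ × Reading i m m ρ′
    loop-exec zero {i} {m} {j} ρ e r@(_ , r2 , _ , r4) with trans (sym (+-identityʳ j)) e
    ... | refl = ρ , until-done (trans (cong₂ _≡ᵇ_ r4 r2) (≡ᵇ-refl m)) , r
    loop-exec (suc d) {i} {m} {j} ρ e r@(_ , r2 , _ , r4) =
      let (ρ₁ , ex₁ , r′) = loopBody-exec ρ r
          (ρ₂ , ex₂ , r″) = loop-exec d ρ₁ (trans (sym (+-suc j d)) e) r′
      in ρ₂ , until-more (trans (cong₂ _≡ᵇ_ r4 r2) (≢⇒≡ᵇ-false {j} {m} λ j≡m → m+1+n≢m j (trans e (sym j≡m)))) ex₁ ex₂ , r″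

    body-runs : ∀ ρ → ∃ λ ρ′ → Runs body (entry body) ρ ρ′ × ρ′ 0 ≡ ρ 0 ×
                ρ′ 1 ≡ P (ρ 0) ⌜ prefix x (ℓ (ρ 0)) ⌝
    body-runs ρ =
      let i = ρ 0
          (ρ₁ , ex₁ , v₁ , h₁) = computes (proj₂ ℓᶜ (i ∷ [])) ρ (0 ∷ []) 2 6
            (λ { zero → z<s }) (m≤m+n 3 3) refl
          (ρ₂ , ex₂ , r0 , r2 , r3 , r4) = loop-exec (ℓ i) _ refl
            (h₁ 0 z<s (λ ()) , v₁ , refl , refl)
          (ρ₃ , ex₃ , v₃ , h₃) = computes (proj₂ Pᶜ (i ∷ ⌜ prefix x (ℓ i) ⌝ ∷ [])) ρ₂ (0 ∷ 3 ∷ []) 1 6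
            (λ { zero → z<s ; (suc zero) → m≤m+n 4 2 }) (m≤m+n 2 4)
            (cong₂ _∷_ r0 (cong (_∷ []) r3))
      in ρ₃ , exec⇒runs (seq ex₁ (seq set (seq set (seq ex₂ ex₃)))) ,
         trans (h₃ 0 z<s λ ()) r0 , v₃

-- The tree of witnesses of an effective analytic set

digitOf-≥ : ∀ {n} (w : Word n) {j} → n ≢ 0 → ⌜ w ⌝ ≤ j → digitOf w j ≡ 0
digitOf-≥ [] n≢0 _ = refl
digitOf-≥ {zero} (() ∷ w)
digitOf-≥ {suc n} (a ∷ w) {suc j} n≢0 (s≤s h) = digitOf-≥ w n≢0
  (≤-trans (m≤n*m ⌜ w ⌝ (suc n)) (≤-trans (m≤n+m _ (toℕ a)) h))

digitOf-beyond : ∀ {n} (w : Word n) {i j} → digitOf w i ≡ 0 → i ≤ j → digitOf w j ≡ 0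
digitOf-beyond [] _ _ = refl
digitOf-beyond (a ∷ w) {suc i} {suc j} e (s≤s i≤j) = digitOf-beyond w e i≤j

digitOf-letter : ∀ {n} (w : Word n) j → digitOf w j ≡ 0 ⊎ ∃ λ (a : Fin n) → digitOf w j ≡ suc (toℕ a)
digitOf-letter [] j = inj₁ refl
digitOf-letter (a ∷ w) zero = inj₂ (a , refl)
digitOf-letter (a ∷ w) (suc j) = digitOf-letter w j

⌜⌝-injective : ∀ {n} (v w : Word n) → ⌜ v ⌝ ≡ ⌜ w ⌝ → v ≡ w
⌜⌝-injective {n} v w e = digitOf-injective v w λ i →
  trans (sym (digit-⌜⌝ v i)) (trans (cong (digit n i) e) (digit-⌜⌝ w i))

∧-true : ∀ {a b} → (a ∧ b) ≡ true → a ≡ true × b ≡ true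
∧-true {true} {true} _ = refl , refl

∨-true : ∀ {a b} → (a ∨ b) ≡ true → a ≡ true ⊎ b ≡ true
∨-true {true} _ = inj₁ refl
∨-true {false} e = inj₂ e

-- Every relation on ℕ × 2* × Σ* with a recursive truth value is decided by a computable function on
-- codes, since all numbers are codes of words.
module RecursiveRelation {p q : ℕ} {R : ℕ → Word (suc p) → Word (suc q) → Set} {f : PR 3}
  (truth : ∀ k u v → ComputesTruth f (k ∷ ⌜ u ⌝ ∷ ⌜ v ⌝ ∷ []) (R k u v)) where

  decideWords : ∀ k u v → ∃ λ b → f [ k ∷ ⌜ u ⌝ ∷ ⌜ v ⌝ ∷ [] ]⇓ b2n b × (b ≡ true ⇔ R k u v)
  decideWords k u v with truth k u v
  ... | inj₁ (r , d) = true , d , mk⇔ (λ _ → r) (λ _ → refl)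
  ... | inj₂ (¬r , d) = false , d , mk⇔ (λ ()) (λ r → ⊥-elim (¬r r))

  decide : ℕ → ℕ → ℕ → Bool
  decide k c d = proj₁ (decideWords k (proj₁ (⌜⌝-surjective c)) (proj₁ (⌜⌝-surjective d)))

  decideᶜ : Decides {3} (λ xs → decide (lookup xs #0) (lookup xs #1) (lookup xs #2))
  decideᶜ = f , λ { (k ∷ c ∷ d ∷ []) →
    let (u , eu) = ⌜⌝-surjective c; (v , ev) = ⌜⌝-surjective d
    in subst₂ (λ c′ d′ → f [ k ∷ c′ ∷ d′ ∷ [] ]⇓ b2n (decide k c d)) eu ev (proj₁ (proj₂ (decideWords k u v))) }

  decide-correct : ∀ k u v → decide k ⌜ u ⌝ ⌜ v ⌝ ≡ true ⇔ R k u v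
  decide-correct k u v = subst₂ (λ u′ v′ → decide k ⌜ u ⌝ ⌜ v ⌝ ≡ true ⇔ R k u′ v′)
    (⌜⌝-injective _ u (proj₂ (⌜⌝-surjective ⌜ u ⌝))) (⌜⌝-injective _ v (proj₂ (⌜⌝-surjective ⌜ v ⌝)))
    (proj₂ (proj₂ (decideWords k (proj₁ (⌜⌝-surjective ⌜ u ⌝)) (proj₁ (⌜⌝-surjective ⌜ v ⌝)))))

-- A node of level k + 1 consists of its parent, its level, and the codes of a word w extending that of
-- the parent and of a prefix u of w of length m such that R k u v holds for the prefix v of length m of
-- the oracle.  An infinite branch thus describes a witness τ of membership.
module Nodes (em : ∀ {ℓ} → ExcludedMiddle ℓ) {q : ℕ} {R : ℕ → Word 2 → Word (suc q) → Set} {f : PR 3}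
  (truth : ∀ k u v → ComputesTruth f (k ∷ ⌜ u ⌝ ∷ ⌜ v ⌝ ∷ []) (R k u v)) where

  open RecursiveRelation truth

  above level word part len : ℕ → ℕ
  above i = fst i
  level i = fst (snd i)
  word i = fst (snd (snd i))
  part i = fst (snd (snd (snd i)))
  len i = snd (snd (snd (snd i)))

  level-0 : level 0 ≡ 0
  level-0 = trans (cong fst snd-0) fst-0

  word-0 : word 0 ≡ 0
  word-0 = trans (cong (fst ∘ snd) snd-0) (trans (cong fst snd-0) fst-0)

  node : ℕ → ℕ → ℕ → ℕ → ℕ → ℕ
  node a k w u m = pair a (pair k (pair w (pair u m)))

  extends : ℕ → ℕ → Bool
  extends c d = allUpTo c λ j → (digit 2 j c ≡ᵇ 0) ∨ (digit 2 j c ≡ᵇ digit 2 j d)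

  hasLength : ℕ → ℕ → Bool
  hasLength c m = (digit 2 m c ≡ᵇ 0) ∧ allUpTo m λ j → not (digit 2 j c ≡ᵇ 0)

  valid : ℕ → ℕ → Bool
  valid i d = (level i ≡ᵇ suc (level (above i))) ∧ extends (word (above i)) (word i) ∧
              extends (part i) (word i) ∧ hasLength (part i) (len i) ∧
              decide (level (above i)) (part i) d

  -- An invalid node has its parent above itself, which keeps it off every branch and makes the
  -- parent of 0 differ from 0.
  parentOf : ℕ → ℕ → ℕ
  parentOf i d = if valid i d then above i else suc i

  extendsᶜ : ∀ {k} {F G : Vec ℕ k → ℕ} → Computable F → Computable G → Decides (λ xs → extends (F xs) (G xs))
  extendsᶜ {F = F} {G} f g = allUpToᶜ (λ j xs → (digit 2 j (F xs) ≡ᵇ 0) ∨ (digit 2 j (F xs) ≡ᵇ digit 2 j (G xs)))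
    (∨ᶜ (isZeroᶜ dF) (≡ᵇᶜ dF (digitᶜ 2 (projᶜ #0) (weakenᶜ g)))) f
    where dF = digitᶜ 2 (projᶜ #0) (weakenᶜ f)

  hasLengthᶜ : ∀ {k} {F G : Vec ℕ k → ℕ} → Computable F → Computable G → Decides (λ xs → hasLength (F xs) (G xs))
  hasLengthᶜ {F = F} f g = ∧ᶜ (isZeroᶜ (digitᶜ 2 g f))
    (allUpToᶜ (λ j xs → not (digit 2 j (F xs) ≡ᵇ 0)) (notᶜ (isZeroᶜ (digitᶜ 2 (projᶜ #0) (weakenᶜ f)))) g)

  module _ {k : ℕ} {F : Vec ℕ k → ℕ} (f : Computable F) where

    levelᶜ : Computable (level ∘ F)
    levelᶜ = fstᶜ (sndᶜ f)
    wordᶜ : Computable (word ∘ F)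
    wordᶜ = fstᶜ (sndᶜ (sndᶜ f))
    partᶜ : Computable (part ∘ F)
    partᶜ = fstᶜ (sndᶜ (sndᶜ (sndᶜ f)))
    lenᶜ : Computable (len ∘ F)
    lenᶜ = sndᶜ (sndᶜ (sndᶜ (sndᶜ f)))

  validᶜ : Decides {2} (λ xs → valid (lookup xs #0) (lookup xs #1))
  validᶜ = ∧ᶜ (≡ᵇᶜ (levelᶜ i) (sucᶜ (levelᶜ (fstᶜ i)))) (∧ᶜ (extendsᶜ (wordᶜ (fstᶜ i)) (wordᶜ i))
    (∧ᶜ (extendsᶜ (partᶜ i) (wordᶜ i)) (∧ᶜ (hasLengthᶜ (partᶜ i) (lenᶜ i))
      (ap₃ {φ = λ k c d → b2n (decide k c d)} decideᶜ (levelᶜ (fstᶜ i)) (partᶜ i) (projᶜ #1)))))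
    where
    i : Computable {2} (λ xs → lookup xs #0)
    i = projᶜ #0

  parentOfᶜ : Computable {2} (λ xs → parentOf (lookup xs #0) (lookup xs #1))
  parentOfᶜ = ifᶜ validᶜ (fstᶜ (projᶜ #0)) (sucᶜ (projᶜ #0))

  open PrefixProgram {suc q} {len} {parentOf} (lenᶜ (projᶜ #0)) parentOfᶜ using (body; body-runs) public

  Extends : ℕ → ℕ → Set
  Extends c d = ∀ j → digit 2 j c ≡ 0 ⊎ digit 2 j c ≡ digit 2 j d

  -- No word is longer than its code, so the bounded test has seen all nonzero digits.
  extends⇒ : ∀ {c d} → extends c d ≡ true → Extends c d
  extends⇒ {c} {d} e j with <-≤-connex j c
  ... | inj₁ j<c = Sum.map ≡ᵇ-true⇒≡ ≡ᵇ-true⇒≡ (∨-true (allUpTo⇒ {m = c} e j<c))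
  ... | inj₂ c≤j = let (w , w≡) = ⌜⌝-surjective {1} c in
    inj₁ (trans (cong (digit 2 j) (sym w≡)) (trans (digit-⌜⌝ w j)
      (digitOf-≥ w (λ ()) (≤-trans (≤-reflexive w≡) c≤j))))

  ⇒extends : ∀ {c d} → Extends c d → extends c d ≡ true
  ⇒extends {c} {d} h = ⇒allUpTo c λ j _ → go (h j)
    where
    go : ∀ {a b} → a ≡ 0 ⊎ a ≡ b → (a ≡ᵇ 0) ∨ (a ≡ᵇ b) ≡ true
    go (inj₁ refl) = refl
    go {a} (inj₂ refl) rewrite ≡ᵇ-refl a = ∨-zeroʳ (a ≡ᵇ 0)

  prefix-extends : ∀ (τ : ωWord 2) {l m} → l ≤ m → Extends ⌜ prefix τ l ⌝ ⌜ prefix τ m ⌝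
  prefix-extends τ {l} {m} l≤m j
    rewrite digit-⌜⌝ (prefix τ l) j | digit-⌜⌝ (prefix τ m) j with <-≤-connex j l
  ... | inj₁ j<l = inj₂ (trans (digitOf-prefix-< τ j<l) (sym (digitOf-prefix-< τ (≤-trans j<l l≤m))))
  ... | inj₂ l≤j = inj₁ (digitOf-prefix-≥ τ l≤j)

  prefix-hasLength : ∀ (τ : ωWord 2) m → hasLength ⌜ prefix τ m ⌝ m ≡ true
  prefix-hasLength τ m = cong₂ _∧_
    (cong (_≡ᵇ 0) (trans (digit-⌜⌝ (prefix τ m) m) (digitOf-prefix-≥ τ {m} ≤-refl)))
    (⇒allUpTo m λ j j<m → cong (λ d → not (d ≡ᵇ 0)) (trans (digit-⌜⌝ (prefix τ m) j) (digitOf-prefix-< τ j<m)))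

  record ValidNode (i a d : ℕ) : Set where
    field
      level≡   : level i ≡ suc (level a)
      word⊑    : Extends (word a) (word i)
      part⊑    : Extends (part i) (word i)
      part-end : digit 2 (len i) (part i) ≡ 0
      part-in  : ∀ j → j < len i → digit 2 j (part i) ≢ 0
      holds    : decide (level a) (part i) d ≡ true

  valid-elim : ∀ i a d → above i ≡ a → valid i d ≡ true → ValidNode i a d
  valid-elim i .(above i) d refl v =
    let (l , v₁) = ∧-true {level i ≡ᵇ suc (level (above i))} v
        (w , v₂) = ∧-true {extends (word (above i)) (word i)} v₁
        (u , v₃) = ∧-true {extends (part i) (word i)} v₂
        (h , r) = ∧-true {hasLength (part i) (len i)} v₃
        (h₀ , h₁) = ∧-true {digit 2 (len i) (part i) ≡ᵇ 0} h
    in record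
      { level≡ = ≡ᵇ-true⇒≡ l ; word⊑ = extends⇒ w ; part⊑ = extends⇒ u ; part-end = ≡ᵇ-true⇒≡ h₀
      ; part-in = λ j j<m e → case trans (sym (allUpTo⇒ {m = len i} h₁ j<m)) (cong (λ d → not (d ≡ᵇ 0)) e) of λ ()
      ; holds = r }

  module _ (x : ωWord (suc q)) where

    parent : ℕ → ℕ
    parent i = parentOf i ⌜ prefix x (len i) ⌝

    parent₀ : parent 0 ≢ 0
    parent₀ e = case trans (sym e) (cong (λ b → if b then above 0 else 1) invalid) of λ ()
      where
      invalid : valid 0 ⌜ prefix x (len 0) ⌝ ≡ false
      invalid rewrite level-0 = refl

    Member : Set
    Member = ∃ λ (τ : ωWord 2) → ∀ k → ∃ λ m → R k (prefix τ m) (prefix x m)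

    module ToBranch (τ : ωWord 2) (wit : ∀ k → ∃ λ m → R k (prefix τ m) (prefix x m)) where

      m M c : ℕ → ℕ
      m k = proj₁ (wit k)
      -- The lengths `m k` need not increase with `k`, while the words along a branch must extend
      -- each other; hence maxima.
      M zero = 0
      M (suc k) = M k ⊔ m k
      c zero = 0
      c (suc k) = node (c k) (suc k) ⌜ prefix τ (M (suc k)) ⌝ ⌜ prefix τ (m k) ⌝ (m k)

      module _ (a k w u m : ℕ) where
        above-node : above (node a k w u m) ≡ a
        above-node = fst-pair a _
        level-node : level (node a k w u m) ≡ k
        level-node rewrite snd-pair a (pair k (pair w (pair u m))) = fst-pair k _
        word-node : word (node a k w u m) ≡ w
        word-node rewrite snd-pair a (pair k (pair w (pair u m))) | snd-pair k (pair w (pair u m)) = fst-pair w _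
        part-node : part (node a k w u m) ≡ u
        part-node rewrite snd-pair a (pair k (pair w (pair u m))) | snd-pair k (pair w (pair u m))
                        | snd-pair w (pair u m) = fst-pair u m
        len-node : len (node a k w u m) ≡ m
        len-node rewrite snd-pair a (pair k (pair w (pair u m))) | snd-pair k (pair w (pair u m))
                       | snd-pair w (pair u m) = snd-pair u m

      level-c : ∀ k → level (c k) ≡ k
      level-c zero = level-0
      level-c (suc k) = level-node (c k) (suc k) ⌜ prefix τ (M (suc k)) ⌝ ⌜ prefix τ (m k) ⌝ (m k)

      word-c : ∀ k → word (c k) ≡ ⌜ prefix τ (M k) ⌝
      word-c zero = word-0
      word-c (suc k) = word-node (c k) (suc k) ⌜ prefix τ (M (suc k)) ⌝ ⌜ prefix τ (m k) ⌝ (m k)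

      valid-intro : ∀ {i a k w w′ d} l → above i ≡ a → level i ≡ suc k → level a ≡ k → word a ≡ w → word i ≡ w′ →
        part i ≡ ⌜ prefix τ l ⌝ → len i ≡ l → Extends w w′ → Extends ⌜ prefix τ l ⌝ w′ →
        decide k ⌜ prefix τ l ⌝ d ≡ true → valid i d ≡ true
      valid-intro {k = k} {d = d} l refl li refl refl refl ui mi e e′ r = cong₂ _∧_
        (trans (cong (_≡ᵇ suc k) li) (≡ᵇ-refl k))
        (cong₂ _∧_ (⇒extends e) (cong₂ _∧_ (trans (cong (λ u → extends u _) ui) (⇒extends e′))
          (cong₂ _∧_ (trans (cong₂ hasLength ui mi) (prefix-hasLength τ l))
            (trans (cong (λ u → decide k u d) ui) r))))

      valid-c : ∀ k → valid (c (suc k)) ⌜ prefix x (m k) ⌝ ≡ true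
      valid-c k = valid-intro {c (suc k)} {c k} {d = ⌜ prefix x (m k) ⌝} (m k)
        (above-node (c k) (suc k) ⌜ prefix τ (M (suc k)) ⌝ ⌜ prefix τ (m k) ⌝ (m k)) (level-c (suc k)) (level-c k) (word-c k) (word-c (suc k))
        (part-node (c k) (suc k) ⌜ prefix τ (M (suc k)) ⌝ ⌜ prefix τ (m k) ⌝ (m k)) (len-node (c k) (suc k) ⌜ prefix τ (M (suc k)) ⌝ ⌜ prefix τ (m k) ⌝ (m k))
        (prefix-extends τ (m≤m⊔n (M k) (m k))) (prefix-extends τ (m≤n⊔m (M k) (m k)))
        (Equivalence.from (decide-correct k (prefix τ (m k)) (prefix x (m k))) (proj₂ (wit k)))

      branch : Branch parent
      branch = c , refl , λ k →
        (trans (cong (λ l → parentOf (c (suc k)) ⌜ prefix x l ⌝) (len-node (c k) (suc k) ⌜ prefix τ (M (suc k)) ⌝ ⌜ prefix τ (m k) ⌝ (m k)))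
          (trans (cong (λ b → if b then above (c (suc k)) else suc (c (suc k))) (valid-c k))
            (above-node (c k) (suc k) ⌜ prefix τ (M (suc k)) ⌝ ⌜ prefix τ (m k) ⌝ (m k)))) ,
        <-pair (c k) (pair-suc≢0 k _)

    module FromBranch (c : ℕ → ℕ) (c₀ : c 0 ≡ 0) (branch : ∀ k → parent (c (suc k)) ≡ c k × c k < c (suc k)) where

      parentOf-valid : ∀ i d → parentOf i d < i → valid i d ≡ true × parentOf i d ≡ above i
      parentOf-valid i d lt with valid i d
      ... | true = refl , refl
      ... | false = ⊥-elim (<⇒≱ lt (n≤1+n i))

      valid-c : ∀ k → valid (c (suc k)) ⌜ prefix x (len (c (suc k))) ⌝ ≡ true × above (c (suc k)) ≡ c k
      valid-c k =
        let (p , lt) = branch k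
            (v , e) = parentOf-valid (c (suc k)) ⌜ prefix x (len (c (suc k))) ⌝ (subst (_< c (suc k)) (sym p) lt)
        in v , trans (sym e) p

      sound : ∀ k → ValidNode (c (suc k)) (c k) ⌜ prefix x (len (c (suc k))) ⌝
      sound k = let (v , e) = valid-c k in valid-elim (c (suc k)) (c k) _ e v

      level-c : ∀ k → level (c k) ≡ k
      level-c zero = trans (cong level c₀) level-0
      level-c (suc k) = trans (ValidNode.level≡ (sound k)) (cong suc (level-c k))

      word-mono : ∀ {k l} → k ℕ.≤′ l → Extends (word (c k)) (word (c l))
      word-mono ≤′-refl j = inj₂ refl
      word-mono (≤′-step {n = l} p) j with word-mono p j | ValidNode.word⊑ (sound l) j
      ... | inj₁ e | _ = inj₁ e
      ... | inj₂ e | inj₁ e′ = inj₁ (trans e e′)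
      ... | inj₂ e | inj₂ e′ = inj₂ (trans e e′)

      word-digit : ∀ k l j → digit 2 j (word (c k)) ≢ 0 → digit 2 j (word (c l)) ≢ 0 →
                   digit 2 j (word (c k)) ≡ digit 2 j (word (c l))
      word-digit k l j nk nl with ≤-total k l
      ... | inj₁ k≤l with word-mono (≤⇒≤′ k≤l) j
      ... | inj₁ e = ⊥-elim (nk e)
      ... | inj₂ e = e
      word-digit k l j nk nl | inj₂ l≤k with word-mono (≤⇒≤′ l≤k) j
      ... | inj₁ e = ⊥-elim (nl e)
      ... | inj₂ e = sym e

      Shows : ℕ → Fin 2 → Set
      Shows j a = ∃ λ k → digit 2 j (word (c k)) ≡ suc (toℕ a)

      τ : ωWord 2
      τ j with em {P = ∃ (Shows j)}
      ... | yes (a , _) = a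
      -- A digit that no word of the branch shows lies in none of the parts, so its value is never
      -- consulted.
      ... | no _ = zero

      shown : ∀ k j → digit 2 j (word (c k)) ≢ 0 → ∃ (Shows j)
      shown k j nz with ⌜⌝-surjective {1} (word (c k))
      ... | w , w≡ with subst (λ e → digit 2 j e ≡ digitOf w j) w≡ (digit-⌜⌝ w j) | digitOf-letter w j
      ... | e | inj₁ z = ⊥-elim (nz (trans e z))
      ... | e | inj₂ (a , e′) = a , k , trans e e′

      τ-digit : ∀ k j → digit 2 j (word (c k)) ≢ 0 → digit 2 j (word (c k)) ≡ suc (toℕ (τ j))
      τ-digit k j nz with em {P = ∃ (Shows j)}
      ... | yes (a , l , e) = trans (word-digit k l j nz (λ z → case trans (sym e) z of λ ())) e
      ... | no ¬s = ⊥-elim (¬s (shown k j nz))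

      part-prefix : ∀ k → part (c (suc k)) ≡ ⌜ prefix τ (len (c (suc k))) ⌝
      part-prefix k with ⌜⌝-surjective {1} (part (c (suc k))) | sound k
      ... | u , u≡ | s = trans (sym u≡) (cong ⌜_⌝ (digitOf-injective u (prefix τ m) same))
        where
        m = len (c (suc k))
        digit-u : ∀ j → digitOf u j ≡ digit 2 j (part (c (suc k)))
        digit-u j = trans (sym (digit-⌜⌝ u j)) (cong (digit 2 j) u≡)
        same : ∀ j → digitOf u j ≡ digitOf (prefix τ m) j
        same j with <-≤-connex j m
        ... | inj₂ m≤j = trans (digitOf-beyond u (trans (digit-u m) (ValidNode.part-end s)) m≤j)
                               (sym (digitOf-prefix-≥ τ m≤j))
        ... | inj₁ j<m with ValidNode.part⊑ s j
        ... | inj₁ z = ⊥-elim (ValidNode.part-in s j j<m z)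
        ... | inj₂ e = trans (digit-u j) (trans e (trans
              (τ-digit (suc k) j (λ z → ValidNode.part-in s j j<m (trans e z))) (sym (digitOf-prefix-< τ j<m))))

      member : Member
      member = τ , λ k → len (c (suc k)) ,
        Equivalence.to (decide-correct k (prefix τ _) (prefix x _))
          (subst₂ (λ l u → decide l u ⌜ prefix x (len (c (suc k))) ⌝ ≡ true) (level-c k) (part-prefix k) (ValidNode.holds (sound k)))

    branch⇔member : Branch parent ⇔ Member
    branch⇔member = mk⇔ (λ (c , c₀ , b) → FromBranch.member c c₀ b) (λ (τ , wit) → ToBranch.branch τ wit)

-- Simulation of effective analytic sets by automata

module Simulation (em : ∀ {ℓ} → ExcludedMiddle ℓ) where

  open BorelClasses em

  -- The reduction bounds the classes of `L` from below and the transfer bounds them from above: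
  -- enough to compare ranks and to carry over completeness.
  Simulates : ∀ {m n} → Lang m → Lang n → Set₁
  Simulates K L = (∃ λ h → IsContinuous h × K ≐ (h ⊢ L)) ×
    (∀ α → 𝟙 ≺ α → Σ⁰ α K → Σ⁰ α L) × (∀ α → 𝟙 ≺ α → Π⁰ α K → Π⁰ α L)

  -- Reading a drawn diagram returns the oracle only pointwise, so membership in `K` has to respect
  -- pointwise equality.
  Σ¹₁-resp : ∀ {n} {K : Lang n} → IsΣ¹₁ K → ∀ {σ σ′} → (∀ i → σ i ≡ σ′ i) → K σ → K σ′
  Σ¹₁-resp (R , _ , to , from) {σ} {σ′} e k = let (τ , h) = to k in
    from (τ , λ k → let (m , r) = h k in m , subst (R k (prefix τ m)) (applyUpTo-cong m λ i _ → e i) r)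

  module _ {n N : ℕ} {K : Lang n} {L O C : Lang N} (draw : ωWord n → ωWord N) (scan : ωWord N → ωWord n)
    (resp : ∀ {σ σ′} → (∀ i → σ i ≡ σ′ i) → K σ → K σ′)
    (L⇔ : ∀ w → L w ⇔ (O w ⊎ (C w × K (scan w)))) where

    simulates : IsContinuous draw → IsContinuous scan → IsOpen O → IsOpen (∁ C) → (∀ w → C w → ¬ O w) →
                (∀ x → C (draw x)) → (∀ x i → scan (draw x) i ≡ x i) → Simulates K L
    simulates draw-cont scan-cont O-open ∁C-open disjoint drawn section =
      (draw , draw-cont , to , from) , sigma , pi
      where
      to : ∀ {x} → K x → L (draw x)
      to {x} k = Equivalence.from (L⇔ (draw x)) (inj₂ (drawn x , resp (λ i → sym (section x i)) k))

      from : ∀ {x} → L (draw x) → K x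
      from {x} l with Equivalence.to (L⇔ (draw x)) l
      ... | inj₁ p = ⊥-elim (disjoint (draw x) (drawn x) p)
      ... | inj₂ (_ , k) = resp (section x) k

      sigma : ∀ α → 𝟙 ≺ α → Σ⁰ α K → Σ⁰ α L
      sigma α 𝟙≺α s = Σ⁰-≐ {α = α}
        ((λ { {w} (inj₁ (_ , p)) → Equivalence.from (L⇔ w) (inj₁ p) ; {w} (inj₂ p) → Equivalence.from (L⇔ w) (inj₂ p) }) ,
         (λ {w} l → Sum.map₁ (λ p → tt , p) (Equivalence.to (L⇔ w) l)))
        (Σ⁰-closed∩open∪closed∩ {α = α} {Z = λ _ → ⊤} 𝟙≺α (λ _ ¬⊤ → ⊥-elim (¬⊤ tt)) O-open ∁C-open
          (Σ⁰-preimage scan-cont s))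

      pi : ∀ α → 𝟙 ≺ α → Π⁰ α K → Π⁰ α L
      -- Outside the language lie the words in neither `O` nor `C`, a closed set cut by an open one,
      -- and the words of `C` whose oracle is outside `K`.
      pi α 𝟙≺α s = Σ⁰-≐ {α = α} ((λ {w} → into w) , λ {w} → outof w)
        (Σ⁰-closed∩open∪closed∩ {α = α} {Z = ∁ O} 𝟙≺α (open-≐ ∁∁-≐ O-open) ∁C-open ∁C-open
          (Σ⁰-preimage scan-cont s))
        where
        into : ∀ w → (¬ O w × ¬ C w) ⊎ (C w × ¬ K (scan w)) → ¬ L w
        into w h l with h | Equivalence.to (L⇔ w) l
        ... | inj₁ (¬p , _) | inj₁ p = ¬p p
        ... | inj₁ (_ , ¬d) | inj₂ (d , _) = ¬d d
        ... | inj₂ (d , _) | inj₁ p = disjoint w d p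
        ... | inj₂ (_ , ¬k) | inj₂ (_ , k) = ¬k k
        outof : ∀ w → ¬ L w → (¬ O w × ¬ C w) ⊎ (C w × ¬ K (scan w))
        outof w ¬l with em {P = C w}
        ... | yes d = inj₂ (d , λ k → ¬l (Equivalence.from (L⇔ w) (inj₂ (d , k))))
        ... | no ¬d = inj₁ ((λ p → ¬l (Equivalence.from (L⇔ w) (inj₁ p))) , ¬d)

  module _ {q : ℕ} (body : Prog (suc q)) (parent : ωWord (suc q) → ℕ → ℕ)
    (runs : ∀ x ρ → ∃ λ ρ′ → Semantics.Runs x body (entry body) ρ ρ′ × ρ′ 0 ≡ ρ 0 × ρ′ 1 ≡ parent x (ρ 0))
    (parent₀ : ∀ x → parent x 0 ≢ 0) {K : Lang (suc q)} (branch⇔K : ∀ x → Branch (parent x) ⇔ K x)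
    (resp : ∀ {σ σ′} → (∀ i → σ i ≡ σ′ i) → K σ → K σ′) where

    open Machine (zero {n = q}) body using (system)
    open RowSystem system using (Walk)
    open DiagramLanguage em system

    Walk⇔K : ∀ x → Walk x ⇔ K x
    Walk⇔K x = mk⇔
      (λ w → Equivalence.to (branch⇔K x) (walk⇒branch w))
      (λ k → branch⇒walk (Equivalence.from (branch⇔K x) k))
      where open MachineWalk zero body x (parent x) (runs x) (parent₀ x) using (walk⇒branch; branch⇒walk)

    simulateProgram : ∃₂ λ N (L : Lang N) → r-BCLω 4 L × Simulates K L
    simulateProgram = width , language , language-r-BCL ,
      simulates draw scanOf resp language⇔ draw-continuous scanOf-continuous Failing-open ∁Diagrams-open
        (λ w → Diagrams-¬Failing {w}) draw-Diagrams scanOf-draw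
      where
      language⇔ : ∀ w → language w ⇔ (Failing w ⊎ (Diagrams w × K (scanOf w)))
      language⇔ w = mk⇔
        (λ l → Sum.map₂ (λ (d , k) → d , Equivalence.to (Walk⇔K (scanOf w)) k) (proj₁ language-≐ {w} l))
        (λ p → proj₂ language-≐ {w} (Sum.map₂ (λ (d , k) → d , Equivalence.from (Walk⇔K (scanOf w)) k) p))

  simulate : ∀ {n} {K : Lang n} → IsΣ¹₁ K → ∃₂ λ N (L : Lang N) → r-BCLω 4 L × Simulates K L
  -- Over the empty alphabet there are no ω-words, but also no letter to serve as the default of
  -- `extract`.
  simulate {zero} {K} _ = 0 , K , (empty , (λ {σ} _ → absurd σ) , (λ {σ} _ → absurd σ)) ,
    (id , (λ σ → absurd σ) , id , id) , (λ _ _ → id) , (λ _ _ → id)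
    where
    absurd : ∀ {ℓ} {A : Set ℓ} → ωWord 0 → A
    absurd σ with σ 0
    ... | ()
    empty : BüchiBlindCounterAutomaton 4 0
    empty = record
      { machine = record { states = 1 ; Δ = λ _ _ _ _ _ → ⊥ ; q₀ = zero ; no-down = λ () ; blind = λ () }
      ; F = Subset.⊥ }
  simulate {suc q} {K} Kσ@(R , (f , truth) , K≐) =
    simulateProgram body parent body-runs parent₀
      (λ x → mk⇔ (λ b → proj₂ K≐ (Equivalence.to (branch⇔member x) b))
                 (λ k → Equivalence.from (branch⇔member x) (proj₁ K≐ k)))
      (Σ¹₁-resp Kσ)
    where
    open Nodes em truth

-- The tree of positions, and the game

opaque

  -- Child number `i` with label `d`. Every label is available infinitely often, as countable unions
  -- require, and the successor makes a child larger than its father.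
  child : ℕ → ℕ → ℕ → ℕ
  child c i d = pair c (suc (pair i d))

  father label : ℕ → ℕ
  father z = fst z
  label z = snd (pred (snd z))

  father-child : ∀ c i d → father (child c i d) ≡ c
  father-child c i d = fst-pair c (suc (pair i d))

  label-child : ∀ c i d → label (child c i d) ≡ d
  label-child c i d = trans (cong (snd ∘ pred) (snd-pair c (suc (pair i d)))) (snd-pair i d)

  rank-child : ∀ {c i d i′ d′} → child c i d ≡ child c i′ d′ → i ≡ i′
  rank-child {c} {i} {d} {i′} {d′} e = trans (sym (fst-pair i d)) (trans (cong fst (suc-injective
    (trans (sym (snd-pair c _)) (trans (cong snd e) (snd-pair c _))))) (fst-pair i′ d′))

  <-child : ∀ c i d → c < child c i d
  <-child c i d = <-pair c λ ()

  isChild : ℕ → Bool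
  isChild z = (pair (fst z) (suc (pair (fst (pred (snd z))) (label z))) ≡ᵇ z)

  isChild-child : ∀ c i d → isChild (child c i d) ≡ true
  isChild-child c i d rewrite fst-pair c (suc (pair i d)) | snd-pair c (suc (pair i d))
    | fst-pair i d | snd-pair i d = ≡ᵇ-refl (pair c (suc (pair i d)))

  isChild⇒ : ∀ {z} → isChild z ≡ true → ∃ λ i → z ≡ child (father z) i (label z)
  isChild⇒ e = _ , sym (≡ᵇ-true⇒≡ e)

  fatherᶜ : ∀ {k} {F : Vec ℕ k → ℕ} → Computable F → Computable (father ∘ F)
  fatherᶜ = fstᶜ

  labelᶜ : ∀ {k} {F : Vec ℕ k → ℕ} → Computable F → Computable (label ∘ F)
  labelᶜ f = sndᶜ (predᶜ (sndᶜ f))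

  isChildᶜ : ∀ {k} {F : Vec ℕ k → ℕ} → Computable F → Decides (isChild ∘ F)
  isChildᶜ f = ≡ᵇᶜ (pairᶜ (fstᶜ f) (sucᶜ (pairᶜ (fstᶜ (predᶜ (sndᶜ f))) (labelᶜ f)))) f

data Below (c : ℕ) : ℕ → Set where
  here  : Below c c
  there : ∀ {y i d} → Below c y → Below c (child y i d)

below-≤ : ∀ {c y} → Below c y → c ≤ y
below-≤ here = ≤-refl
below-≤ (there {y} {i} {d} b) = ≤-trans (below-≤ b) (<⇒≤ (<-child y i d))

below-child : ∀ {c i d y} → Below (child c i d) y → Below c y
below-child here = there here
below-child (there b) = there (below-child b)

-- Both descents are retraced from `y` through the same fathers; if one ended earlier than the
-- other, a child would be at most its own father. This permits oracles of different subtrees to be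
-- glued.
siblings-disjoint : ∀ {c i d i′ d′ z z′ y} → z ≡ child c i d → z′ ≡ child c i′ d′ →
                    Below z y → Below z′ y → z ≡ z′
siblings-disjoint {c} {i} {d} {i′} {d′} {z} {z′} ez ez′ b b′ = go b b′ refl
  where
  not-below-father : ∀ {i d z z′} → z ≡ child c i d → ∀ {y j e} → Below z y → z′ ≡ child c i′ d′ →
                     z′ ≡ child y j e → ⊥
  not-below-father {i} {d} refl {y} {j} {e} b ez′ ey =
    <⇒≱ (<-child c i d) (subst (child c i d ≤_)
      (trans (sym (father-child y j e)) (trans (cong father (trans (sym ey) ez′)) (father-child c i′ d′))) (below-≤ b))
  go : ∀ {y y′} → Below z y → Below z′ y′ → y ≡ y′ → z ≡ z′
  go here here e = e
  go here (there {y} {j} {f} b) e = ⊥-elim (<⇒≱ (<-child c i′ d′) (subst₂ _≤_ ez′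
      (trans (sym (father-child y j f)) (trans (cong father (trans (sym e) ez)) (father-child c i d))) (below-≤ b)))
  go (there {y} {j} {f} b) here e = ⊥-elim (not-below-father ez b ez′ (sym e))
  go (there {y} {j} {f} b) (there {y′} {j′} {f′} b′) e =
    go b b′ (trans (sym (father-child y j f)) (trans (cong father e) (father-child y′ j′ f′)))

bit : Bool → Fin 2
bit true = suc zero
bit false = zero

isOne : Fin 2 → Bool
isOne zero = false
isOne (suc _) = true

isOne-bit : ∀ b → isOne (bit b) ≡ b
isOne-bit true = refl
isOne-bit false = refl

-- The game of length α: at a node labelled a the player wins if he can move to a child with a smaller
-- label at which he does not win; at a leaf, whose label is the least one, the oracle decides.
module Game (em : ∀ {ℓ} → ExcludedMiddle ℓ) (α : Ordinal) (f : Ordinal.Carrier α → ℕ)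
  (f-cong : ∀ {a b} → Ordinal._≈_ α a b → f a ≡ f b) (f-injective : ∀ {a b} → f a ≡ f b → Ordinal._≈_ α a b) where

  open OrdinalComparison em
  open OrdinalConstructions em
  open BorelClasses em
  open Ordinal α using (Carrier; wellFounded)

  Leaf : Carrier → Set
  Leaf a = ∀ b → ¬ lt α b a

  Win′ : ωWord 2 → ℕ → ∀ {a} → Acc (lt α) a → Set
  Win′ x c {a} (acc rs) = (Leaf a × x c ≡ bit true) ⊎
    (∃₂ λ i b → Σ (lt α b a) λ b<a → ¬ Win′ x (child c i (f b)) (rs b<a))

  win-resp : ∀ {x} c {a b} (p : Acc (lt α) a) (q : Acc (lt α) b) → eq α a b → Win′ x c p → Win′ x c q
  win-resp c (acc rs) (acc rs′) e (inj₁ (leaf , w)) =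
    inj₁ ((λ d d<b → leaf d (STO.<-respʳ-≈ α (STO.Eq.sym α e) d<b)) , w)
  win-resp c (acc rs) (acc rs′) e (inj₂ (i , d , d<a , ¬w)) =
    let d<b = STO.<-respʳ-≈ α e d<a in
    inj₂ (i , d , d<b , λ w → ¬w (win-resp _ (rs′ d<b) (rs d<a) (STO.Eq.refl α) w))

  record Win (x : ωWord 2) (c : ℕ) (a : Carrier) : Set where
    constructor wins
    field play : Win′ x c (wellFounded a)

  open Win

  WinBelow : (Carrier → Set) → ℕ → Lang 2
  WinBelow P c x = ∃₂ λ i b → P b × ¬ Win x (child c i (f b)) b

  win⇔ : ∀ {x c a} → Win x c a ⇔ ((Leaf a × x c ≡ bit true) ⊎ WinBelow (λ b → lt α b a) c x)
  win⇔ {x} {c} {a} = mk⇔ (to (wellFounded a) ∘ play) (wins ∘ from (wellFounded a))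
    where
    to : (p : Acc (lt α) a) → Win′ x c p → (Leaf a × x c ≡ bit true) ⊎ WinBelow (λ b → lt α b a) c x
    to (acc rs) = Sum.map₂ λ (i , b , b<a , ¬w) → i , b , b<a , λ w →
      ¬w (win-resp _ (wellFounded b) (rs b<a) (STO.Eq.refl α) (play w))
    from : (p : Acc (lt α) a) → (Leaf a × x c ≡ bit true) ⊎ WinBelow (λ b → lt α b a) c x → Win′ x c p
    from (acc rs) = Sum.map₂ λ (i , b , b<a , ¬w) → i , b , b<a , λ w →
      ¬w (wins (win-resp _ (rs b<a) (wellFounded b) (STO.Eq.refl α) w))

  win-≈ : ∀ {x c a b} → eq α a b → Win x c a → Win x c b
  win-≈ {a = a} {b} e (wins w) = wins (win-resp _ (wellFounded a) (wellFounded b) e w)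

  leaf-win : ∀ {x c a} → Leaf a → Win x c a ⇔ x c ≡ bit true
  leaf-win leaf = mk⇔
    (λ w → case Equivalence.to win⇔ w of λ { (inj₁ (_ , e)) → e ; (inj₂ (_ , b , b<a , _)) → ⊥-elim (leaf b b<a) })
    (λ e → Equivalence.from win⇔ (inj₁ (leaf , e)))

  nonleaf-win : ∀ {x c a} → ¬ Leaf a → Win x c a ⇔ WinBelow (λ b → lt α b a) c x
  nonleaf-win ¬leaf = mk⇔
    (λ w → case Equivalence.to win⇔ w of λ { (inj₁ (leaf , _)) → ⊥-elim (¬leaf leaf) ; (inj₂ p) → p })
    (λ p → Equivalence.from win⇔ (inj₂ p))

  record Stage : Set₁ where
    field
      P : Carrier → Set
      β : Ordinal
      below : ∀ {b} → P b → Lt (seg α b) β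
      above : ∀ {γ} → Lt γ β → ∃ λ b → P b × γ ≅ seg α b

  top : Stage
  top = record { P = λ _ → ⊤ ; β = α ; below = λ {b} _ → seg-Lt {α} {b}
               ; above = λ {γ} p → let (b , e) = Lt⇒seg {γ} {α} p in b , tt , e }

  stageOf : Carrier → Stage
  stageOf a = record
    { P = λ b → lt α b a
    ; β = seg α a
    ; below = seg-mono {α}
    ; above = λ {γ} p →
        let (b , e) = Lt⇒seg {γ} {α} (Lt-Le-trans {γ} {seg α a} {α} p (Lt⇒Le {seg α a} {α} (seg-Lt {α} {a})))
        in b , seg-reflects {α} {b} {a} (Le-Lt-trans {seg α b} {γ} {seg α a} (≅⇒Ge {γ} {seg α b} e) p) , e
    }

  nonleaf⇒𝟙≼ : ∀ {a} → ¬ Leaf a → 𝟙 ≼ seg α a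
  nonleaf⇒𝟙≼ {a} ¬leaf = let (b , h) = ¬∀⇒∃¬ ¬leaf in
    Le⇒≼ {𝟙} {seg α a} (𝟙-Le {seg α a} (b , dne h))

  𝟙≼⇒nonleaf : ∀ {a} → 𝟙 ≼ seg α a → ¬ Leaf a
  𝟙≼⇒nonleaf {a} p leaf = let ((b , b<a) , _) = ≼⇒Le {𝟙} {seg α a} p zero in leaf b b<a

  module _ (ℓ : Stage) where

    open Stage ℓ

    shallow-leaf : ∀ {b} → β ≅ 𝟙 → P b → Leaf b
    shallow-leaf {b} β≅𝟙 p c c<b = case Lt𝟙⇒Le𝟘 {seg α b}
      (Lt-Le-trans {seg α b} {β} {𝟙} (below p) (≅⇒Le {β} {𝟙} β≅𝟙)) (c , c<b) of λ { (() , _) }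

    some-leaf : 𝟙 ≼ β → ∃ λ b → P b × Leaf b
    some-leaf p =
      let (b , Pb , e) = above (Lt-Le-trans {𝟘} {𝟙} {β} (zero , λ ()) (≼⇒Le {𝟙} {β} p))
      in b , Pb , λ c c<b → case ≅⇒Ge {𝟘} {seg α b} e (c , c<b) of λ { (() , _) }

  leaf? : ∀ a → Dec (Leaf a)
  leaf? a = em

  module _ (ℓ : Stage) (c : ℕ) where

    open Stage ℓ

    private
      record Part (i : ℕ) : Set₁ where
        field
          γ     : Ordinal
          G     : Lang 2
          lower : 𝟙 ≼ γ
          upper : γ ≺ β
          class : Σ⁰ γ (∁ G)
          into  : ∀ {x} → G x → WinBelow P c x
          onto  : ∀ {x b} → P b → f b ≡ snd i → ¬ Win x (child c (fst i) (f b)) b → G x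

    -- The winning moves form a countable union, indexed by number and code of the label; codes of
    -- no label contribute the empty set. The segment of a leaf is empty and hence no level, so the
    -- clopen condition there is placed at level 1.
    winBelow-Σ⁰ : 𝟙 ≼ β → (∀ b → P b → ¬ Leaf b → ∀ z → Σ⁰ (seg α b) (λ x → Win x z b)) →
                  Σ⁰ β (WinBelow P c)
    winBelow-Σ⁰ (inj₂ iso) _ = open-set (≅-sym {𝟙} {β} iso) λ x (i , b , Pb , ¬w) →
      let leaf = shallow-leaf ℓ (≅-sym {𝟙} {β} iso) Pb
          z = child c i (f b)
      in suc z , λ y e → i , b , Pb , λ w → ¬w (Equivalence.from (leaf-win leaf)
           (trans (prefix⇒Agree {σ = x} {y} (suc z) e z ≤-refl) (Equivalence.to (leaf-win leaf) w)))
    winBelow-Σ⁰ (inj₁ 𝟙≺β) ih = union (Part.γ ∘ parts) (Part.G ∘ parts) (Part.lower ∘ parts) (Part.upper ∘ parts)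
      (Part.class ∘ parts)
      ((λ { {x} (i , b , Pb , ¬w) → pair i (f b) , Part.onto (parts (pair i (f b))) Pb (sym (snd-pair i (f b)))
              (subst (λ i → ¬ Win x (child c i (f b)) b) (sym (fst-pair i (f b))) ¬w) }) ,
       λ (i , g) → Part.into (parts i) g)
      where
      parts : ∀ i → Part i
      parts i with em {P = ∃ λ b → P b × f b ≡ snd i}
      ... | no none = record
        { γ = 𝟙 ; G = λ _ → ⊥ ; lower = ≼-refl {𝟙} ; upper = 𝟙≺β
        ; class = open⇒Σ⁰₁ λ _ _ → 0 , λ _ _ ()
        ; into = λ () ; onto = λ {x} {b} Pb e _ → none (b , Pb , e) }
      ... | yes (b , Pb , e) = record
        { γ = proj₁ here′ ; G = λ x → ¬ Win x (child c (fst i) (f b)) b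
        ; lower = proj₁ (proj₂ here′) ; upper = proj₁ (proj₂ (proj₂ here′)) ; class = proj₂ (proj₂ (proj₂ here′))
        ; into = λ ¬w → fst i , b , Pb , ¬w
        ; onto = λ {x} {b′} Pb′ e′ ¬w w → ¬w (win-≈ (f-injective (trans e (sym e′)))
                   (subst (λ d → Win x (child c (fst i) d) b) (trans e (sym e′)) w)) }
        where
        here′ : ∃ λ γ → 𝟙 ≼ γ × γ ≺ β × Σ⁰ γ (∁ λ x → ¬ Win x (child c (fst i) (f b)) b)
        here′ with leaf? b
        ... | no ¬leaf = seg α b , nonleaf⇒𝟙≼ ¬leaf , Lt⇒≺ {seg α b} {β} (below Pb) ,
                Σ⁰-≐ {α = seg α b} ∁∁-≐ (ih b Pb ¬leaf (child c (fst i) (f b)))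
        ... | yes leaf = 𝟙 , ≼-refl {𝟙} , 𝟙≺β , open⇒Σ⁰₁ (open-≐ ∁∁-≐ λ x w →
                let z = child c (fst i) (f b) in suc z , λ y e → Equivalence.from (leaf-win leaf)
                  (trans (sym (prefix⇒Agree {σ = x} {y} (suc z) e z ≤-refl)) (Equivalence.to (leaf-win leaf) w)))

  win-Σ⁰ : ∀ a → ¬ Leaf a → ∀ c → Σ⁰ (seg α a) (λ x → Win x c a)
  win-Σ⁰ = wf-ind {α} {α} _ λ a ih ¬leaf c → Σ⁰-≐ {α = seg α a}
    (Equivalence.from (nonleaf-win ¬leaf) , Equivalence.to (nonleaf-win ¬leaf))
    (winBelow-Σ⁰ (stageOf a) c (nonleaf⇒𝟙≼ ¬leaf) ih)

  leaves-≈ : ∀ {a b} → Leaf a → Leaf b → eq α a b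
  leaves-≈ {a} {b} la lb with STO.compare α a b
  ... | tri< a<b _ _ = ⊥-elim (lb a a<b)
  ... | tri≈ _ e _ = e
  ... | tri> _ _ b<a = ⊥-elim (la b b<a)

  -- `right` holds for every `x` that agrees with the oracle below `c`, whatever it is elsewhere; so
  -- a realization can be planted into a larger tree.
  record Realizes {m} (F : Lang m) (c : ℕ) (W : Lang 2) : Set where
    field
      oracle : ωWord m → ωWord 2
      cont   : ∀ σ y → ∃ λ l → ∀ τ → Agree l σ τ → oracle σ y ≡ oracle τ y
      right  : ∀ σ x → (∀ y → Below c y → x y ≡ oracle σ y) → F σ ⇔ W x

  module RealizeOpen {m} {F : Lang m} (o : IsOpen F) (P : Carrier → Set) (c : ℕ)
    (shallow : ∀ {b} → P b → Leaf b) {a : Carrier} (Pa : P a) (leaf : Leaf a) where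

    Hit : ωWord m → ℕ → Set
    Hit σ y = ∃ λ i → y ≡ child c i (f a) × Cylinder F i σ

    -- Child `i` becomes a lost leaf, and so a winning move, once the first `i` letters guarantee
    -- membership in the open set. All other children are won leaves and useless as moves.
    oracle : ωWord m → ωWord 2
    oracle σ y = bit (not ⌊ em {P = Hit σ y} ⌋)

    oracle-zero : ∀ σ {y} → Hit σ y → oracle σ y ≡ zero
    oracle-zero σ {y} p with em {P = Hit σ y}
    ... | yes _ = refl
    ... | no ¬p = ⊥-elim (¬p p)

    oracle-one : ∀ σ {y} → ¬ Hit σ y → oracle σ y ≡ bit true
    oracle-one σ {y} ¬p with em {P = Hit σ y}
    ... | yes p = ⊥-elim (¬p p)
    ... | no _ = refl

    hit-local : ∀ {i y} → y ≡ child c i (f a) → ∀ {σ τ} → Agree i σ τ → Hit σ y → Hit τ y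
    hit-local {i} e {σ} {τ} ag (j , e′ , cyl) with rank-child (trans (sym e′) e)
    ... | refl = j , e′ , λ υ eq → cyl υ (trans (Agree⇒prefix j ag) eq)

    cont : ∀ σ y → ∃ λ l → ∀ τ → Agree l σ τ → oracle σ y ≡ oracle τ y
    cont σ y with em {P = ∃ λ i → y ≡ child c i (f a)}
    ... | no none = 0 , λ τ _ → trans (oracle-one σ λ (i , e , _) → none (i , e))
                                      (sym (oracle-one τ λ (i , e , _) → none (i , e)))
    ... | yes (i , e) = i , λ τ ag → cong (bit ∘ not)
            (⌊em⌋-cong (hit-local e {σ} {τ} ag) (hit-local e {τ} {σ} λ j j<i → sym (ag j j<i)))

    module _ (σ : ωWord m) (x : ωWord 2) (h : ∀ y → Below c y → x y ≡ oracle σ y) where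

      to : F σ → WinBelow P c x
      to p with proj₁ (open≐⋃Cylinder o) {σ} p
      ... | i , cyl = i , a , Pa , λ w → case trans (sym (Equivalence.to (leaf-win leaf) w)) lost of λ ()
        where
        lost : x (child c i (f a)) ≡ zero
        lost = trans (h _ (there here)) (oracle-zero σ (i , refl , cyl))

      from : WinBelow P c x → F σ
      from (i , b , Pb , ¬w) = dne λ ¬p → ¬w (Equivalence.from (leaf-win (shallow Pb)) (won ¬p))
        where
        won : ¬ F σ → x (child c i (f b)) ≡ bit true
        won ¬p = trans (h _ (there here))
          (oracle-one σ λ (j , e , cyl) → ¬p (proj₂ (open≐⋃Cylinder o) {σ} (j , cyl)))

    realizes : Realizes F c (WinBelow P c)
    realizes = record { oracle = oracle ; cont = cont ; right = λ σ x h → mk⇔ (to σ x h) (from σ x h) }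

  module RealizeUnion {m} {F : Lang m} {G : ℕ → Lang m} (F≐ : F ≐ ⋃ ℕ G) (P : Carrier → Set) (c : ℕ)
    (a : ℕ → Carrier) (Pa : ∀ i → P (a i)) (nonleaf : ∀ i → ¬ Leaf (a i))
    (least : ∀ b → ¬ Leaf b → ∃ λ b₀ → lt α b₀ b × Leaf b₀)
    (sub : ∀ i → Realizes (∁ (G i)) (child c i (f (a i))) (WinBelow (λ b → lt α b (a i)) (child c i (f (a i)))))
    where

    z : ℕ → ℕ
    z i = child c i (f (a i))

    Inside : ℕ → Set
    Inside y = ∃ λ i → Below (z i) y

    -- Any move out of the intended subtrees must be a mistake. A leaf child is won by its own bit
    -- 1, every other child by moving on to a leaf with bit 0; hence 1 at the children of `c` and 0
    -- further down.
    default : ℕ → Fin 2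
    default y = bit (father y ≡ᵇ c)

    oracleAt : ∀ {y} → Dec (Inside y) → ωWord m → Fin 2
    oracleAt {y} (yes (i , _)) σ = Realizes.oracle (sub i) σ y
    oracleAt {y} (no _) σ = default y

    oracle : ωWord m → ωWord 2
    oracle σ y = oracleAt (em {P = Inside y}) σ

    cont : ∀ σ y → ∃ λ l → ∀ τ → Agree l σ τ → oracle σ y ≡ oracle τ y
    cont σ y with em {P = Inside y}
    ... | yes (i , _) = Realizes.cont (sub i) σ y
    ... | no _ = 0 , λ _ _ → refl

    inside : ∀ σ {y} i → Below (z i) y → oracle σ y ≡ Realizes.oracle (sub i) σ y
    inside σ {y} i b with em {P = Inside y}
    ... | no none = ⊥-elim (none (i , b))
    ... | yes (j , b′) with rank-child (siblings-disjoint refl refl b′ b)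
    ... | refl = refl

    outside : ∀ σ {y} → ¬ Inside y → oracle σ y ≡ default y
    outside σ {y} none with em {P = Inside y}
    ... | yes p = ⊥-elim (none p)
    ... | no _ = refl

    not-inside : ∀ i b → ¬ eq α b (a i) → ∀ {y} → Below (child c i (f b)) y → ¬ Inside y
    not-inside i b ne bl (j , bl′) with siblings-disjoint refl refl bl bl′
    ... | e with rank-child e
    ... | refl = ne (f-injective (trans (sym (label-child c i (f b))) (trans (cong label e) (label-child c i (f (a i))))))

    module _ (σ : ωWord m) (x : ωWord 2) (h : ∀ y → Below c y → x y ≡ oracle σ y) where

      right-i : ∀ i → (¬ G i σ) ⇔ Win x (z i) (a i)
      right-i i = mk⇔ (Equivalence.from (nonleaf-win (nonleaf i)) ∘ Equivalence.to e)
                      (Equivalence.from e ∘ Equivalence.to (nonleaf-win (nonleaf i)))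
        where
        e : (¬ G i σ) ⇔ WinBelow (λ b → lt α b (a i)) (z i) x
        e = Realizes.right (sub i) σ x λ y b → trans (h y (below-child b)) (inside σ i b)

      default-leaf : ∀ i b → ¬ eq α b (a i) → x (child c i (f b)) ≡ bit true
      default-leaf i b ne = trans (h _ (there here)) (trans (outside σ (not-inside i b ne here))
        (cong bit (trans (cong (_≡ᵇ c) (father-child c i (f b))) (≡ᵇ-refl c))))

      default-grandchild : ∀ i b d → ¬ eq α b (a i) → x (child (child c i (f b)) 0 d) ≡ zero
      default-grandchild i b d ne = trans (h _ (there (there here)))
        (trans (outside σ (not-inside i b ne (there here)))
          (cong bit (trans (cong (_≡ᵇ c) (father-child (child c i (f b)) 0 d))
            (≢⇒≡ᵇ-false λ e → <⇒≢ (<-child c i (f b)) (sym e)))))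

      default-win : ∀ i b → ¬ eq α b (a i) → Win x (child c i (f b)) b
      default-win i b ne with leaf? b
      ... | yes leaf = Equivalence.from (leaf-win leaf) (default-leaf i b ne)
      ... | no ¬leaf with least b ¬leaf
      ... | b₀ , b₀<b , leaf₀ = Equivalence.from (nonleaf-win ¬leaf) (0 , b₀ , b₀<b , λ w →
            case trans (sym (Equivalence.to (leaf-win leaf₀) w)) (default-grandchild i b (f b₀) ne) of λ ())

      to : F σ → WinBelow P c x
      to p = let (i , g) = proj₁ F≐ {σ} p in i , a i , Pa i , λ w → Equivalence.from (right-i i) w g

      from : WinBelow P c x → F σ
      from (i , b , Pb , ¬w) with em {P = eq α b (a i)}
      ... | no ne = ⊥-elim (¬w (default-win i b ne))
      ... | yes e = proj₂ F≐ {σ} (i , dne λ ¬g → ¬w (win-≈ (STO.Eq.sym α e)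
              (subst (λ d → Win x (child c i d) (a i)) (f-cong (STO.Eq.sym α e)) (Equivalence.to (right-i i) ¬g))))

    realizes : Realizes F c (WinBelow P c)
    realizes = record { oracle = oracle ; cont = cont ; right = λ σ x h → mk⇔ (to σ x h) (from σ x h) }

  -- Recursion on the derivation of the class. Each ordinal `δ i` of a union is located as the
  -- segment below some label, and move number `i` with this label enters a subtree that realizes
  -- the complement of `G i`.
  realize : ∀ {m γ} {F : Lang m} → Σ⁰ γ F → (ℓ : Stage) → γ ≅ Stage.β ℓ → ∀ c →
            Realizes F c (WinBelow (Stage.P ℓ) c)
  realize {γ = γ} (open-set γ≅𝟙 o) ℓ γ≅β c =
    RealizeOpen.realizes o (Stage.P ℓ) c (shallow-leaf ℓ β≅𝟙) (proj₁ (proj₂ bottom)) (proj₂ (proj₂ bottom))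
    where
    β≅𝟙 : Stage.β ℓ ≅ 𝟙
    β≅𝟙 = ≅-trans {Stage.β ℓ} {γ} {𝟙} (≅-sym {γ} {Stage.β ℓ} γ≅β) γ≅𝟙
    bottom : ∃ λ b → Stage.P ℓ b × Leaf b
    bottom = some-leaf ℓ (inj₂ (≅-sym {Stage.β ℓ} {𝟙} β≅𝟙))
  realize {γ = γ} (union δ G lower upper classes F≐) ℓ γ≅β c =
    RealizeUnion.realizes F≐ (Stage.P ℓ) c (proj₁ ∘ found) (proj₁ ∘ proj₂ ∘ found)
      (λ i → 𝟙≼⇒nonleaf (≼-trans {𝟙} {δ i} {seg α (proj₁ (found i))} (lower i) (inj₂ (proj₂ (proj₂ (found i))))))
      (λ b ¬leaf → some-leaf (stageOf b) (nonleaf⇒𝟙≼ ¬leaf))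
      (λ i → realize (classes i) (stageOf (proj₁ (found i))) (proj₂ (proj₂ (found i)))
               (child c i (f (proj₁ (found i)))))
    where
    found : ∀ i → ∃ λ b → Stage.P ℓ b × δ i ≅ seg α b
    found i = Stage.above ℓ {δ i}
      (Lt-Le-trans {δ i} {γ} {Stage.β ℓ} (≺⇒Lt {δ i} {γ} (upper i)) (≅⇒Le {γ} {Stage.β ℓ} γ≅β))

  RootWins : Lang 2
  RootWins = WinBelow (λ _ → ⊤) 0

  rootWins-Σ⁰ : 𝟙 ≼ α → Σ⁰ α RootWins
  rootWins-Σ⁰ p = winBelow-Σ⁰ top 0 p λ b _ ¬leaf z → win-Σ⁰ b ¬leaf z

  rootWins-complete : 𝟙 ≼ α → IsΣ⁰-complete α RootWins
  rootWins-complete p F = mk⇔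
    (λ s → let r = realize s top (Le×Ge⇒≅ {α} {α} (Le-refl {α}) (Le-refl {α})) 0
               h σ = Realizes.right r σ (Realizes.oracle r σ) λ _ _ → refl
           in Realizes.oracle r , pointwise-continuous (Realizes.oracle r) (Realizes.cont r) ,
              (λ {σ} → Equivalence.to (h σ)) , λ {σ} → Equivalence.from (h σ))
    (λ (g , cg , (to , from)) → Σ⁰-≐ {α = α} ((λ {σ} → from) , λ {σ} → to) (Σ⁰-preimage {α = α} cg (rootWins-Σ⁰ p)))

-- Both outcomes of the game are effective analytic

_⇒ᵇ_ : Bool → Bool → Bool
a ⇒ᵇ b = not a ∨ b

infixr 4 _⇒ᵇ_

⇒ᵇ-elim : ∀ {a b} → (a ⇒ᵇ b) ≡ true → a ≡ true → b ≡ true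
⇒ᵇ-elim {true} h _ = h

⇒ᵇ-intro : ∀ {a b} → (a ≡ true → b ≡ true) → (a ⇒ᵇ b) ≡ true
⇒ᵇ-intro {true} h = h refl
⇒ᵇ-intro {false} h = refl

⇒ᵇᶜ : ∀ {k} {B C : Vec ℕ k → Bool} → Decides B → Decides C → Decides (λ xs → B xs ⇒ᵇ C xs)
⇒ᵇᶜ b c = ∨ᶜ (notᶜ b) c

recursive₁ : ∀ {D} → IsRecursive₁ D → ∃ λ (d : ℕ → Bool) →
             Decides {1} (λ xs → d (lookup xs #0)) × (∀ m → d m ≡ true ⇔ D m)
recursive₁ {D} (f , truth) = proj₁ ∘ value , (f , λ { (m ∷ []) → proj₁ (proj₂ (value m)) }) , proj₂ ∘ proj₂ ∘ value
  where
  value : ∀ m → ∃ λ b → f [ m ∷ [] ]⇓ b2n b × (b ≡ true ⇔ D m)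
  value m with truth m
  ... | inj₁ (d , e) = true , e , mk⇔ (λ _ → d) (λ _ → refl)
  ... | inj₂ (¬d , e) = false , e , mk⇔ (λ ()) (λ d → ⊥-elim (¬d d))

recursive₂ : ∀ {R} → IsRecursive₂ R → ∃ λ (r : ℕ → ℕ → Bool) →
             Decides {2} (λ xs → r (lookup xs #0) (lookup xs #1)) × (∀ m n → r m n ≡ true ⇔ R m n)
recursive₂ {R} (f , truth) = (λ m n → proj₁ (value m n)) , (f , λ { (m ∷ n ∷ []) → proj₁ (proj₂ (value m n)) }) ,
                             λ m n → proj₂ (proj₂ (value m n))
  where
  value : ∀ m n → ∃ λ b → f [ m ∷ n ∷ [] ]⇓ b2n b × (b ≡ true ⇔ R m n)
  value m n with truth m n
  ... | inj₁ (d , e) = true , e , mk⇔ (λ _ → d) (λ _ → refl)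
  ... | inj₂ (¬d , e) = false , e , mk⇔ (λ ()) (λ d → ⊥-elim (¬d d))

decides⇒recursiveʷ : ∀ {n} {b : ℕ → ℕ → ℕ → Bool} → Decides {3} (λ xs → b (lookup xs #0) (lookup xs #1) (lookup xs #2)) →
                     IsRecursiveʷ {n} (λ k u v → b k ⌜ u ⌝ ⌜ v ⌝ ≡ true)
decides⇒recursiveʷ {b = b} (f , p) = f , λ k u v → truth (b k ⌜ u ⌝ ⌜ v ⌝) (p (k ∷ ⌜ u ⌝ ∷ ⌜ v ⌝ ∷ []))
  where
  truth : ∀ {xs} b → f [ xs ]⇓ b2n b → ComputesTruth f xs (b ≡ true)
  truth true d = inj₁ (refl , d)
  truth false d = inj₂ ((λ ()) , d)

module _ {n : ℕ} (τ : ωWord n) where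

  digit-< : ∀ {m i} → i < m → digit n i ⌜ prefix τ m ⌝ ≡ suc (toℕ (τ i))
  digit-< {m} {i} i<m = trans (digit-⌜⌝ (prefix τ m) i) (digitOf-prefix-< τ i<m)

  digit⇒letter : ∀ m {i a} → digit n i ⌜ prefix τ m ⌝ ≡ suc (toℕ a) → τ i ≡ a
  digit⇒letter m {i} e with <-≤-connex i m
  ... | inj₁ i<m = FinP.toℕ-injective (suc-injective (trans (sym (digit-< i<m)) e))
  ... | inj₂ m≤i = case trans (sym e) (trans (digit-⌜⌝ (prefix τ m) i) (digitOf-prefix-≥ τ m≤i)) of λ ()

  <⇒<code : ∀ {m i} → i < m → i < ⌜ prefix τ m ⌝
  <⇒<code {m} {i} i<m = ≰⇒> λ le → case trans (sym (digitOf-prefix-< τ i<m)) (digitOf-≥ (prefix τ m) n≢0 le) of λ ()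
    where
    n≢0 : n ≢ 0
    n≢0 refl with τ 0
    ... | ()

bit-dichotomy : ∀ (a : Fin 2) → a ≡ bit true ⊎ a ≡ bit false
bit-dichotomy zero = inj₂ refl
bit-dichotomy (suc zero) = inj₁ refl

module RecursiveGame (em : ∀ {ℓ} → ExcludedMiddle ℓ) (α : Ordinal) (𝟙≼α : 𝟙 ≼ α)
  (D : ℕ → Set) (R : ℕ → ℕ → Set) (D-rec : IsRecursive₁ D) (R-rec : IsRecursive₂ R)
  (f : Ordinal.Carrier α → ℕ) (mono : IsOrderMonomorphism (Ordinal._≈_ α) _≡_ (Ordinal._<_ α) R f)
  (range : ∀ m → D m ⇔ (∃ λ x → f x ≡ m)) where

  open OrdinalComparison em
  open IsOrderMonomorphism mono using () renaming (cong to f-cong; mono to f-mono; injective to f-injective; cancel to f-cancel)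
  open Game em α f f-cong f-injective public
  open Ordinal α using (Carrier)

  domain : ℕ → Bool
  domain = proj₁ (recursive₁ D-rec)

  order : ℕ → ℕ → Bool
  order = proj₁ (recursive₂ R-rec)

  domain⇔ : ∀ m → domain m ≡ true ⇔ D m
  domain⇔ = proj₂ (proj₂ (recursive₁ D-rec))

  order⇔ : ∀ a b → order (f a) (f b) ≡ true ⇔ lt α a b
  order⇔ a b = let e = proj₂ (proj₂ (recursive₂ R-rec)) (f a) (f b) in
    mk⇔ (f-cancel ∘ Equivalence.to e) (Equivalence.from e ∘ f-mono)

  a₀ : Carrier
  a₀ = proj₁ (some-leaf top 𝟙≼α)

  a₀-leaf : Leaf a₀
  a₀-leaf = proj₂ (proj₂ (some-leaf top 𝟙≼α))

  -- `edge` singles out the legal moves, every label being legal at the root. Being a leaf is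
  -- decidable because the least label is a constant of the program.
  ok edge live leafᵇ : ℕ → Bool
  ok z = isChild z ∧ domain (label z)
  edge z = ok z ∧ ((father z ≡ᵇ 0) ∨ (ok (father z) ∧ order (label z) (label (father z))))
  live z = (z ≡ᵇ 0) ∨ ok z
  leafᵇ z = ok z ∧ (label z ≡ᵇ f a₀)

  -- A truth table τ for the game with oracle x, in which the root has the value goal, is checked locally.
  checkLeaf checkTrue checkFalse : ℕ → ℕ → ℕ → Bool
  checkLeaf z u v = leafᵇ z ⇒ᵇ (digit 2 z u ≡ᵇ digit 2 z v)
  checkTrue z u v = (live z ∧ not (leafᵇ z) ∧ (digit 2 z u ≡ᵇ 2)) ⇒ᵇ
    anyUpTo u λ y → (digit 2 y u ≡ᵇ 1) ∧ edge y ∧ (father y ≡ᵇ z)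
  checkFalse z u v = (edge z ∧ (digit 2 z u ≡ᵇ 1)) ⇒ᵇ (digit 2 (father z) u ≡ᵇ 2)

  -- The first two conjuncts say that both prefixes extend beyond `z`. Digit 1 is the bit 0 and
  -- digit 2 the bit 1, digit 0 being the end of a word.
  check : Bool → ℕ → ℕ → ℕ → Bool
  check goal z u v = not (digit 2 z u ≡ᵇ 0) ∧ not (digit 2 z v ≡ᵇ 0) ∧
    (digit 2 0 u ≡ᵇ suc (toℕ (bit goal))) ∧ checkLeaf z u v ∧ checkTrue z u v ∧ checkFalse z u v

  module _ {k : ℕ} {Z : Vec ℕ k → ℕ} (z : Computable Z) where

    okᶜ : Decides (ok ∘ Z)
    okᶜ = ∧ᶜ (isChildᶜ z) (ap₁ {φ = b2n ∘ domain} (proj₁ (proj₂ (recursive₁ D-rec))) (labelᶜ z))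

    leafᶜ : Decides (leafᵇ ∘ Z)
    leafᶜ = ∧ᶜ okᶜ (≡ᵇᶜ (labelᶜ z) (constᶜ (f a₀)))

    liveᶜ : Decides (live ∘ Z)
    liveᶜ = ∨ᶜ (isZeroᶜ z) okᶜ

  edgeᶜ : ∀ {k} {Z : Vec ℕ k → ℕ} → Computable Z → Decides (edge ∘ Z)
  edgeᶜ z = ∧ᶜ (okᶜ z) (∨ᶜ (isZeroᶜ (fatherᶜ z)) (∧ᶜ (okᶜ (fatherᶜ z))
    (ap₂ {φ = λ a b → b2n (order a b)} (proj₁ (proj₂ (recursive₂ R-rec))) (labelᶜ z) (labelᶜ (fatherᶜ z)))))

  checkᶜ : ∀ goal → Decides {3} (λ xs → check goal (lookup xs #0) (lookup xs #1) (lookup xs #2))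
  checkᶜ goal = ∧ᶜ (notᶜ (isZeroᶜ zu)) (∧ᶜ (notᶜ (isZeroᶜ zv))
    (∧ᶜ (≡ᵇᶜ (digitᶜ 2 (constᶜ 0) u) (constᶜ (suc (toℕ (bit goal)))))
    (∧ᶜ (⇒ᵇᶜ (leafᶜ z) (≡ᵇᶜ zu zv))
    (∧ᶜ (⇒ᵇᶜ (∧ᶜ (liveᶜ z) (∧ᶜ (notᶜ (leafᶜ z)) (≡ᵇᶜ zu (constᶜ 2))))
          (anyUpToᶜ (λ y xs → (digit 2 y (lookup xs #1) ≡ᵇ 1) ∧ edge y ∧ (father y ≡ᵇ lookup xs #0))
            (∧ᶜ (≡ᵇᶜ (digitᶜ 2 (projᶜ #0) (weakenᶜ u)) (constᶜ 1))
              (∧ᶜ (edgeᶜ (projᶜ #0)) (≡ᵇᶜ (fatherᶜ (projᶜ #0)) (weakenᶜ z)))) u))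
      (⇒ᵇᶜ (∧ᶜ (edgeᶜ z) (≡ᵇᶜ zu (constᶜ 1))) (≡ᵇᶜ (digitᶜ 2 (fatherᶜ z) u) (constᶜ 2)))))))
    where
    z : Computable {3} (λ xs → lookup xs #0)
    z = projᶜ #0
    u : Computable {3} (λ xs → lookup xs #1)
    u = projᶜ #1
    v : Computable {3} (λ xs → lookup xs #2)
    v = projᶜ #2
    zu = digitᶜ 2 z u
    zv = digitᶜ 2 z v

  record Table (goal : Bool) (τ x : ωWord 2) : Set where
    field
      value₀  : τ 0 ≡ bit goal
      leaves  : ∀ z → leafᵇ z ≡ true → τ z ≡ x z
      trues   : ∀ z → live z ≡ true → leafᵇ z ≡ false → τ z ≡ bit true →
                ∃ λ y → τ y ≡ bit false × edge y ≡ true × father y ≡ z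
      falses  : ∀ z → edge z ≡ true → τ z ≡ bit false → τ (father z) ≡ bit true

  father-< : ∀ {z} → ok z ≡ true → father z < z
  father-< {z} h with isChild⇒ {z} (proj₁ (∧-true h))
  ... | i , e = subst (father z <_) (sym e) (<-child (father z) i (label z))

  table⇔ : ∀ goal τ x → (∀ z → ∃ λ m → check goal z ⌜ prefix τ m ⌝ ⌜ prefix x m ⌝ ≡ true) ⇔ Table goal τ x
  table⇔ goal τ x = mk⇔ to from
    where
    to : (∀ z → ∃ λ m → check goal z ⌜ prefix τ m ⌝ ⌜ prefix x m ⌝ ≡ true) → Table goal τ x
    to h = record
      { value₀ = digit⇒letter τ (proj₁ (h 0)) (≡ᵇ-true⇒≡ (proj₁ (parts 0)))
      ; leaves = λ z l → let (m , u≢0 , v≢0) = inside z in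
          digit⇒letter τ m (trans (≡ᵇ-true⇒≡ (⇒ᵇ-elim (proj₁ (proj₂ (parts z))) l)) (digit-< x v≢0))
      ; trues = λ z li nl t → let (m , u≢0 , v≢0) = inside z
                                  (y , _ , e) = anyUpTo⇒ ⌜ prefix τ (proj₁ (h z)) ⌝ (⇒ᵇ-elim (proj₁ (proj₂ (proj₂ (parts z))))
                                    (cong₂ _∧_ li (cong₂ _∧_ (cong not nl)
                                      (cong (_≡ᵇ 2) (trans (digit-< τ u≢0) (cong (suc ∘ toℕ) t))))))
                                  (e₁ , e₂) = ∧-true e
                                  (e₃ , e₄) = ∧-true e₂
                              in y , digit⇒letter τ m (≡ᵇ-true⇒≡ {k = 1} e₁) , e₃ , ≡ᵇ-true⇒≡ e₄
      ; falses = λ z ed t → let (m , u≢0 , v≢0) = inside z in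
          digit⇒letter τ m (≡ᵇ-true⇒≡ (⇒ᵇ-elim (proj₂ (proj₂ (proj₂ (parts z))))
            (cong₂ _∧_ ed (cong (_≡ᵇ 1) (trans (digit-< τ u≢0) (cong (suc ∘ toℕ) t))))))
      }
      where
      split : ∀ z → _
      split z = ∧-true {not (digit 2 z ⌜ prefix τ (proj₁ (h z)) ⌝ ≡ᵇ 0)} (proj₂ (h z))
      split₂ : ∀ z → _
      split₂ z = ∧-true {not (digit 2 z ⌜ prefix x (proj₁ (h z)) ⌝ ≡ᵇ 0)} (proj₂ (split z))
      nonzero⇒< : ∀ (σ : ωWord 2) {z m} → not (digit 2 z ⌜ prefix σ m ⌝ ≡ᵇ 0) ≡ true → z < m
      nonzero⇒< σ {z} {m} e = ≰⇒> λ m≤z → case trans (sym e)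
        (cong (λ d → not (d ≡ᵇ 0)) (trans (digit-⌜⌝ (prefix σ m) z) (digitOf-prefix-≥ σ m≤z))) of λ ()
      inside : ∀ z → ∃ λ m → z < proj₁ (h z) × z < proj₁ (h z)
      inside z = proj₁ (h z) , nonzero⇒< τ (proj₁ (split z)) , nonzero⇒< x (proj₁ (split₂ z))
      parts : ∀ z → let u = ⌜ prefix τ (proj₁ (h z)) ⌝; v = ⌜ prefix x (proj₁ (h z)) ⌝ in
              (digit 2 0 u ≡ᵇ suc (toℕ (bit goal))) ≡ true × checkLeaf z u v ≡ true ×
              checkTrue z u v ≡ true × checkFalse z u v ≡ true
      parts z = let u = ⌜ prefix τ (proj₁ (h z)) ⌝
                    v = ⌜ prefix x (proj₁ (h z)) ⌝
                    (p , q) = ∧-true {digit 2 0 u ≡ᵇ suc (toℕ (bit goal))} (proj₂ (split₂ z))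
                    (r , s) = ∧-true {checkLeaf z u v} q
                    (t , w) = ∧-true {checkTrue z u v} s
                in p , r , t , w
    from : Table goal τ x → ∀ z → ∃ λ m → check goal z ⌜ prefix τ m ⌝ ⌜ prefix x m ⌝ ≡ true
    from t z = m ,
      cong₂ _∧_ (cong (λ d → not (d ≡ᵇ 0)) (digit-< τ z<m)) (cong₂ _∧_ (cong (λ d → not (d ≡ᵇ 0)) (digit-< x z<m))
      (cong₂ _∧_ (trans (cong (_≡ᵇ _) (trans (digit-< τ (≤-trans z<s z<m)) (cong (suc ∘ toℕ) (value₀ t)))) (≡ᵇ-refl (suc (toℕ (bit goal)))))
      (cong₂ _∧_ (⇒ᵇ-intro λ l → trans (cong₂ _≡ᵇ_ (digit-< τ z<m) (trans (digit-< x z<m) (cong (suc ∘ toℕ) (sym (leaves t z l)))))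
                   (≡ᵇ-refl (suc (toℕ (τ z)))))
      (cong₂ _∧_ (⇒ᵇ-intro true-case) (⇒ᵇ-intro false-case)))))
      where
      open Table
      Moves : Set
      Moves = ∃ λ y → τ y ≡ bit false × edge y ≡ true × father y ≡ z
      -- The prefix must also contain a move that justifies the value 1 at `z`, if there is one.
      reach : Dec Moves → ℕ
      reach (yes (y , _)) = suc z ⊔ suc y
      reach (no _) = suc z
      m : ℕ
      m = reach em
      z<m : z < m
      z<m with em {P = Moves}
      ... | yes (y , _) = m≤m⊔n (suc z) (suc y)
      ... | no _ = ≤-refl
      letter : ∀ {i a} → i < m → (digit 2 i ⌜ prefix τ m ⌝ ≡ᵇ suc (toℕ a)) ≡ true → τ i ≡ a
      letter _ e = digit⇒letter τ m (≡ᵇ-true⇒≡ e)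
      shows : ∀ {i a} → i < m → τ i ≡ a → (digit 2 i ⌜ prefix τ m ⌝ ≡ᵇ suc (toℕ a)) ≡ true
      shows {i} {a} i<m e = trans (cong (_≡ᵇ suc (toℕ a)) (trans (digit-< τ i<m) (cong (suc ∘ toℕ) e))) (≡ᵇ-refl (suc (toℕ a)))
      move-in-reach : Moves → ∃ λ y → y < m × τ y ≡ bit false × edge y ≡ true × father y ≡ z
      move-in-reach mv with em {P = Moves}
      ... | yes (y , p) = y , m≤n⊔m (suc z) (suc y) , p
      ... | no none = ⊥-elim (none mv)
      not-true : ∀ {b} → not b ≡ true → b ≡ false
      not-true {false} _ = refl
      true-case : (live z ∧ not (leafᵇ z) ∧ (digit 2 z ⌜ prefix τ m ⌝ ≡ᵇ 2)) ≡ true → _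
      true-case e =
        let (li , e₁) = ∧-true {live z} e
            (nl , e₂) = ∧-true {not (leafᵇ z)} e₁
            (y , y<m , ty , ed , fa) = move-in-reach (trues t z li (not-true nl) (letter z<m e₂))
        in ⇒anyUpTo (<⇒<code τ y<m) (cong₂ _∧_ (shows y<m ty) (cong₂ _∧_ ed (trans (cong (_≡ᵇ z) fa) (≡ᵇ-refl z))))
      false-case : (edge z ∧ (digit 2 z ⌜ prefix τ m ⌝ ≡ᵇ 1)) ≡ true → _
      false-case e =
        let (ed , e₁) = ∧-true {edge z} e
        in shows (<-trans (father-< {z} (proj₁ (∧-true {ok z} ed))) z<m) (falses t z ed (letter z<m e₁))

  ok-label : ∀ {z} → ok z ≡ true → ∃ λ a → f a ≡ label z
  ok-label {z} h = Equivalence.to (range (label z)) (Equivalence.to (domain⇔ (label z)) (proj₂ (∧-true {isChild z} h)))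

  ok-child : ∀ c i b → ok (child c i (f b)) ≡ true
  ok-child c i b = cong₂ _∧_ (isChild-child c i (f b))
    (Equivalence.from (domain⇔ _) (Equivalence.from (range _) (b , sym (label-child c i (f b)))))

  ok-shape : ∀ {z a} → ok z ≡ true → f a ≡ label z → ∃ λ i → z ≡ child (father z) i (f a)
  ok-shape {z} h e = let (i , e′) = isChild⇒ {z} (proj₁ (∧-true h)) in
    i , trans e′ (cong (child (father z) i) (sym e))

  ok⇒≢0 : ∀ {z} → ok z ≡ true → z ≢ 0
  ok⇒≢0 h refl = case father-< {0} h of λ ()

  ok₀ : ok 0 ≡ false
  ok₀ with ok 0 in e
  ... | false = refl
  ... | true = ⊥-elim (ok⇒≢0 e refl)

  leaf₀ : leafᵇ 0 ≡ false
  leaf₀ = cong (_∧ (label 0 ≡ᵇ f a₀)) ok₀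

  leaf⇔ : ∀ {z a} → ok z ≡ true → f a ≡ label z → leafᵇ z ≡ true ⇔ Leaf a
  leaf⇔ {z} {a} h e = mk⇔
    (λ l b b<a → let e′ = ≡ᵇ-true⇒≡ (proj₂ (∧-true {ok z} l)) in
      a₀-leaf b (STO.<-respʳ-≈ α (f-injective (trans e e′)) b<a))
    (λ leaf → cong₂ _∧_ h (trans (cong (_≡ᵇ f a₀) (trans (sym e) (f-cong (leaves-≈ leaf a₀-leaf)))) (≡ᵇ-refl (f a₀))))

  ¬true⇒false : ∀ {b} → ¬ (b ≡ true) → b ≡ false
  ¬true⇒false {true} h = ⊥-elim (h refl)
  ¬true⇒false {false} _ = refl

  -- Like `Stage`, it unites the root and the inner nodes; `P` holds of the labels of legal moves.
  record At (z : ℕ) : Set₁ where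
    field
      P       : Carrier → Set
      alive   : live z ≡ true
      nonleaf : leafᵇ z ≡ false
      edges   : ∀ y b → ok y ≡ true → father y ≡ z → f b ≡ label y → edge y ≡ true ⇔ P b

  at-root : At 0
  at-root = record { P = λ _ → ⊤ ; alive = refl ; nonleaf = leaf₀ ; edges = λ y b h e _ → mk⇔ (λ _ → tt)
    (λ _ → cong₂ _∧_ h (cong (λ w → (w ≡ᵇ 0) ∨ (ok w ∧ order (label y) (label w))) e)) }

  at-node : ∀ {z a} → ok z ≡ true → f a ≡ label z → ¬ Leaf a → At z
  at-node {z} {a} h e ¬leaf = record
    { P = λ b → lt α b a
    ; alive = trans (cong ((z ≡ᵇ 0) ∨_) h) (∨-zeroʳ (z ≡ᵇ 0))
    ; nonleaf = ¬true⇒false (¬leaf ∘ Equivalence.to (leaf⇔ h e))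
    ; edges = edges
    }
    where
    edges : ∀ y b → ok y ≡ true → father y ≡ z → f b ≡ label y → edge y ≡ true ⇔ lt α b a
    edges y b h′ refl e′ = mk⇔ to (λ b<a → cong₂ _∧_ h′ (trans
        (cong ((father y ≡ᵇ 0) ∨_) (cong₂ _∧_ h (trans (cong₂ order (sym e′) (sym e)) (Equivalence.from (order⇔ b a) b<a))))
        (∨-zeroʳ (father y ≡ᵇ 0))))
      where
      to : edge y ≡ true → lt α b a
      to ed with ∨-true {father y ≡ᵇ 0} (proj₂ (∧-true {ok y} ed))
      ... | inj₁ z≡0 = ⊥-elim (ok⇒≢0 h (≡ᵇ-true⇒≡ z≡0))
      ... | inj₂ o = Equivalence.to (order⇔ b a)
              (trans (cong₂ order e′ e) (proj₂ (∧-true {ok (father y)} o)))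

  Decided : ωWord 2 → ωWord 2 → ℕ → Carrier → Set
  Decided τ x z a = ok z ≡ true → f a ≡ label z → τ z ≡ bit true ⇔ Win x z a

  module _ {goal : Bool} {τ x : ωWord 2} (t : Table goal τ x) where

    open Table t

    table-step : ∀ {z} (A : At z) → (∀ b → At.P A b → ∀ y → Decided τ x y b) → τ z ≡ bit true ⇔ WinBelow (At.P A) z x
    table-step {z} A ih = mk⇔ to from
      where
      open At A
      to : τ z ≡ bit true → WinBelow P z x
      to tz with trues z alive nonleaf tz
      ... | y , ty , ed , refl with proj₁ (∧-true {ok y} ed)
      ... | h with ok-label {y} h
      ... | b , e with ok-shape {y} h e
      ... | i , e′ = i , b , Pb , λ w → case trans (sym ty) (Equivalence.from (ih b Pb y h e)
                       (subst (λ y → Win x y b) (sym e′) w)) of λ ()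
        where
        Pb = Equivalence.to (edges y b h refl e) ed
      from : WinBelow P z x → τ z ≡ bit true
      from (i , b , Pb , ¬w) = trans (cong τ (sym (father-child z i (f b)))) (falses y ed ty)
        where
        y = child z i (f b)
        h = ok-child z i b
        e = sym (label-child z i (f b))
        ed : edge y ≡ true
        ed = Equivalence.from (edges y b h (father-child z i (f b)) e) Pb
        ty : τ y ≡ bit false
        ty with bit-dichotomy (τ y)
        ... | inj₂ q = q
        ... | inj₁ q = ⊥-elim (¬w (Equivalence.to (ih b Pb y h e) q))

    -- The local rules determine the table by induction on the label. As it can only record the true
    -- winners, either outcome is expressed by the existence of a table.
    table-sound : ∀ a z → Decided τ x z a
    table-sound = wf-ind {α} {α} _ λ a ih z h e → case leaf? a of λ where
      (yes leaf) → let s = leaves z (Equivalence.from (leaf⇔ h e) leaf) in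
        mk⇔ (λ q → Equivalence.from (leaf-win leaf) (trans (sym s) q))
            (λ w → trans s (Equivalence.to (leaf-win leaf) w))
      (no ¬leaf) → let s = table-step (at-node h e ¬leaf) ih in
        mk⇔ (Equivalence.from (nonleaf-win ¬leaf) ∘ Equivalence.to s)
            (Equivalence.from s ∘ Equivalence.to (nonleaf-win ¬leaf))

    table-root : τ 0 ≡ bit true ⇔ RootWins x
    table-root = table-step at-root λ b _ y → table-sound b y

  module _ (x : ωWord 2) where

    Truth : ℕ → Set
    Truth z = (z ≡ 0 × RootWins x) ⊎ (z ≢ 0 × ∃ λ a → f a ≡ label z × Win x z a)

    values : ωWord 2
    values z = bit ⌊ em {P = Truth z} ⌋

    values⇔ : ∀ z → values z ≡ bit true ⇔ Truth z
    values⇔ z with em {P = Truth z}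
    ... | yes p = mk⇔ (λ _ → p) (λ _ → refl)
    ... | no ¬p = mk⇔ (λ ()) (⊥-elim ∘ ¬p)

    values-node : ∀ a z → Decided values x z a
    values-node a z h e = mk⇔
      (λ q → case Equivalence.to (values⇔ z) q of λ where
        (inj₁ (z≡0 , _)) → ⊥-elim (ok⇒≢0 h z≡0)
        (inj₂ (_ , b , e′ , w)) → win-≈ (f-injective (trans e′ (sym e))) w)
      (λ w → Equivalence.from (values⇔ z) (inj₂ (ok⇒≢0 h , a , e , w)))

    stage-at : ∀ z → live z ≡ true → leafᵇ z ≡ false → ∃ λ (A : At z) → values z ≡ bit true ⇔ WinBelow (At.P A) z x
    stage-at z li nl with ∨-true {z ≡ᵇ 0} li
    ... | inj₁ z≡0 with ≡ᵇ-true⇒≡ {z} {0} z≡0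
    ... | refl = at-root , mk⇔
          (λ q → case Equivalence.to (values⇔ 0) q of λ where
            (inj₁ (_ , w)) → w
            (inj₂ (ne , _)) → ⊥-elim (ne refl))
          (λ w → Equivalence.from (values⇔ 0) (inj₁ (refl , w)))
    stage-at z li nl | inj₂ h with ok-label {z} h
    ... | a , e = at-node h e ¬leaf , mk⇔
          (Equivalence.to (nonleaf-win ¬leaf) ∘ Equivalence.to (values-node a z h e))
          (Equivalence.from (values-node a z h e) ∘ Equivalence.from (nonleaf-win ¬leaf))
      where
      ¬leaf : ¬ Leaf a
      ¬leaf leaf = case trans (sym nl) (Equivalence.from (leaf⇔ h e) leaf) of λ ()

    values-table : ∀ goal → values 0 ≡ bit goal → Table goal values x
    values-table goal e₀ = record
      { value₀ = e₀
      ; leaves = λ z l → let h = proj₁ (∧-true {ok z} l); (a , e) = ok-label {z} h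
                             leaf = Equivalence.to (leaf⇔ h e) l
                         in same-bits (λ q → Equivalence.to (leaf-win leaf) (Equivalence.to (values-node a z h e) q))
                                      (λ q → Equivalence.from (values-node a z h e) (Equivalence.from (leaf-win leaf) q))
      ; trues = λ z li nl q → let (A , eqv) = stage-at z li nl
                                  (i , b , Pb , ¬w) = Equivalence.to eqv q
                                  h = ok-child z i b
                                  e = sym (label-child z i (f b))
                              in child z i (f b) , not-true (λ q → ¬w (Equivalence.to (values-node b _ h e) q)) ,
                                 Equivalence.from (At.edges A _ b h (father-child z i (f b)) e) Pb , father-child z i (f b)
      ; falses = falses
      }
      where
      not-true : ∀ {a : Fin 2} → ¬ (a ≡ bit true) → a ≡ bit false
      not-true {a} h with bit-dichotomy a
      ... | inj₁ e = ⊥-elim (h e)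
      ... | inj₂ e = e
      same-bits : ∀ {a b : Fin 2} → (a ≡ bit true → b ≡ bit true) → (b ≡ bit true → a ≡ bit true) → a ≡ b
      same-bits {a} {b} g h with bit-dichotomy a | bit-dichotomy b
      ... | inj₁ p | _ = trans p (sym (g p))
      ... | inj₂ _ | inj₁ q = trans (h q) (sym q)
      ... | inj₂ p | inj₂ q = trans p (sym q)
      falses : ∀ y → edge y ≡ true → values y ≡ bit false → values (father y) ≡ bit true
      falses y ed q with ∧-true {ok y} ed
      ... | h , rest with ok-label {y} h
      ... | b , e with ok-shape {y} h e
      ... | i , shape = Equivalence.from (proj₂ stage)
            (i , b , Equivalence.to (At.edges (proj₁ stage) y b h refl e) ed ,
             λ w → case trans (sym q) (Equivalence.from (values-node b y h e) (subst (λ y → Win x y b) (sym shape) w)) of λ ())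
        where
        w = father y
        alive : live w ≡ true
        alive with ∨-true {w ≡ᵇ 0} rest
        ... | inj₁ z rewrite z = refl
        ... | inj₂ o = trans (cong ((w ≡ᵇ 0) ∨_) (proj₁ (∧-true {ok w} o))) (∨-zeroʳ (w ≡ᵇ 0))
        nonleaf : leafᵇ w ≡ false
        nonleaf with ∨-true {w ≡ᵇ 0} rest
        ... | inj₁ z = trans (cong leafᵇ (≡ᵇ-true⇒≡ z)) leaf₀
        ... | inj₂ o = ¬true⇒false λ l → a₀-leaf b (Equivalence.to (order⇔ b a₀)
                (trans (cong₂ order e (sym (≡ᵇ-true⇒≡ (proj₂ (∧-true {ok w} l))))) (proj₂ (∧-true {ok w} o))))
        stage = stage-at w alive nonleaf

  game-Σ¹₁ : ∀ goal {K : Lang 2} → (∀ τ x → Table goal τ x → K x) → (∀ x → K x → values x 0 ≡ bit goal) → IsΣ¹₁ K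
  game-Σ¹₁ goal sound complete =
    (λ k u v → check goal k ⌜ u ⌝ ⌜ v ⌝ ≡ true) , decides⇒recursiveʷ {b = check goal} (checkᶜ goal) ,
    (λ {x} k → values x , Equivalence.from (table⇔ goal (values x) x) (values-table x goal (complete x k))) ,
    λ {x} (τ , h) → sound τ x (Equivalence.to (table⇔ goal τ x) h)

  rootWins-Σ¹₁ : IsΣ¹₁ RootWins
  rootWins-Σ¹₁ = game-Σ¹₁ true (λ τ x t → Equivalence.to (table-root t) (Table.value₀ t))
    λ x w → Equivalence.from (values⇔ x 0) (inj₁ (refl , w))

  ∁rootWins-Σ¹₁ : IsΣ¹₁ (∁ RootWins)
  ∁rootWins-Σ¹₁ = game-Σ¹₁ false
    (λ τ x t w → case trans (sym (Table.value₀ t)) (Equivalence.from (table-root t) w) of λ ())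
    λ x ¬w → case bit-dichotomy (values x 0) of λ where
      (inj₂ e) → e
      (inj₁ e) → case Equivalence.to (values⇔ x 0) e of λ where
        (inj₁ (_ , w)) → ⊥-elim (¬w w)
        (inj₂ (ne , _)) → ⊥-elim (ne refl)

-- Languages of automata are effective analytic

countUpTo : ℕ → (ℕ → Bool) → ℕ
countUpTo zero p = 0
countUpTo (suc m) p = countUpTo m p + b2n (p m)

countUpTo-cong : ∀ {p q} m → (∀ i → i < m → p i ≡ q i) → countUpTo m p ≡ countUpTo m q
countUpTo-cong zero h = refl
countUpTo-cong (suc m) h = cong₂ (λ c b → c + b2n b) (countUpTo-cong m λ i i<m → h i (m<n⇒m<1+n i<m)) (h m ≤-refl)

countUpTo-< : ∀ v m → countUpTo m (λ i → i <ᵇ v) ≡ m ⊓ v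
countUpTo-< v zero = refl
countUpTo-< v (suc m) with <-≤-connex m v
... | inj₁ m<v rewrite countUpTo-< v m | <⇒<ᵇ≡true m<v | m≤n⇒m⊓n≡m (<⇒≤ m<v) | m≤n⇒m⊓n≡m m<v = +-comm m 1
... | inj₂ v≤m rewrite countUpTo-< v m | ≥⇒<ᵇ≡false v≤m | m≥n⇒m⊓n≡n v≤m | m≥n⇒m⊓n≡n (m≤n⇒m≤1+n v≤m) = +-identityʳ v

countUpToᶜ : ∀ {k} m {P : ℕ → Vec ℕ k → Bool} → (∀ i → Decides (P i)) → Computable (λ xs → countUpTo m (λ i → P i xs))
countUpToᶜ zero p = constᶜ 0
countUpToᶜ (suc m) p = +ᶜ (countUpToᶜ m p) (p m)

positiveᶜ : ∀ {k} {F : Vec ℕ k → ℕ} → Computable F → Decides (positive ∘ F)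
positiveᶜ {F = F} f = Decides-resp (λ xs → eq (F xs)) (notᶜ (isZeroᶜ f))
  where
  eq : ∀ m → not (m ≡ᵇ 0) ≡ positive m
  eq zero = refl
  eq (suc m) = refl

boolTableᶜ : ∀ {k} l (T : Vec Bool l → Bool) {P : Fin l → Vec ℕ k → Bool} → (∀ i → Decides (P i)) →
             Decides (λ xs → T (tabulate λ i → P i xs))
boolTableᶜ zero T p = constᶜ (b2n (T []))
boolTableᶜ (suc l) T {P} p = Computable-resp (λ xs → eq xs (P zero xs))
  (ifᶜ (p zero) (boolTableᶜ l (T ∘ (true ∷_)) (p ∘ suc)) (boolTableᶜ l (T ∘ (false ∷_)) (p ∘ suc)))
  where
  eq : ∀ xs b → (if b then b2n (T (true ∷ tabulate λ i → P (suc i) xs)) else b2n (T (false ∷ tabulate λ i → P (suc i) xs)))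
               ≡ b2n (T (b ∷ tabulate λ i → P (suc i) xs))
  eq xs true = refl
  eq xs false = refl

applyMove : Move → ℕ → ℕ
applyMove stay c = c
applyMove up c = suc c
applyMove down c = pred c

applyMoveᶜ : ∀ {k} {F : Vec ℕ k → ℕ} j → Computable F → Computable (applyMove j ∘ F)
applyMoveᶜ stay f = f
applyMoveᶜ up f = sucᶜ f
applyMoveᶜ down f = predᶜ f

tabulate-replicate : ∀ {A : Set} (a : A) k → tabulate {n = k} (λ _ → a) ≡ replicate k a
tabulate-replicate a zero = refl
tabulate-replicate a (suc k) = cong (a ∷_) (tabulate-replicate a k)

-- A run is guessed as the sequence of its steps (state, moves), numbered by a finite type of size M; the
-- number of the i-th step is the number of ones among the bits pair i q with q < M.
module RunGuess (em : ∀ {ℓ} → ExcludedMiddle ℓ) {k n : ℕ} (A : BüchiBlindCounterAutomaton k n) where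

  open BüchiBlindCounterAutomaton A
  open Pigeonhole em

  Y : Set
  Y = Fin states × Vec Move k

  finY : Finite Y
  finY = ×-finite (Fin-finite states) (Vec-finite Move-finite k)

  M : ℕ
  M = size finY

  stepOf : ℕ → Y
  stepOf c with c <? M
  ... | yes c<M = dec finY (fromℕ< c<M)
  ... | no _ = q₀ , replicate k stay

  stepOf-enc : ∀ y → stepOf (toℕ (enc finY y)) ≡ y
  stepOf-enc y with toℕ (enc finY y) <? M
  ... | yes lt = trans (cong (dec finY) (FinP.fromℕ<-toℕ (enc finY y) lt)) (dec-enc finY y)
  ... | no ¬lt = ⊥-elim (¬lt (FinP.toℕ<n (enc finY y)))

  stateOf : ℕ → Fin states
  stateOf = proj₁ ∘ stepOf

  movesOf : ℕ → Vec Move k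
  movesOf = proj₂ ∘ stepOf

  module Guess (guess : ℕ → Bool) where

    number : ℕ → ℕ
    -- The truncation gives the number the shape to which `casesᶜ` applies.
    number i = countUpTo M (λ q → guess (pair i q)) ⊓ M

    counter : Fin k → ℕ → ℕ
    counter j zero = 0
    counter j (suc i) = applyMove (lookup (movesOf (number i)) j) (counter j i)

  open Guess

  number-cong : ∀ {g h} i → (∀ q → q < M → g (pair i q) ≡ h (pair i q)) → number g i ≡ number h i
  number-cong i e = cong (_⊓ M) (countUpTo-cong M e)

  counter-cong : ∀ {g h} j i → (∀ i′ q → i′ < i → q < M → g (pair i′ q) ≡ h (pair i′ q)) → counter g j i ≡ counter h j i
  counter-cong j zero e = refl
  counter-cong {g} {h} j (suc i) e = cong₂ (λ m c → applyMove (lookup (movesOf m) j) c)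
    (number-cong {g} {h} i λ q → e i q ≤-refl) (counter-cong {g} {h} j i λ i′ q lt → e i′ q (m<n⇒m<1+n lt))

  Transition : ℕ → ℕ → ℕ → Vec Bool k → Set
  Transition m m′ d bs = ∃ λ a → suc (toℕ a) ≡ d × Δ (stateOf m) a bs (stateOf m′) (movesOf m)

  -- `Δ` is an arbitrary relation, decided by excluded middle. The result is computable all the
  -- same, since step numbers, letters and signs range over finite sets and give a finite table.
  transition : ℕ → ℕ → ℕ → Vec Bool k → Bool
  transition m m′ d bs = ⌊ em {P = Transition m m′ d bs} ⌋

  accepting starting : ℕ → Bool
  accepting m = ⌊ em {P = stateOf m Subset.∈ F} ⌋
  starting m = ⌊ em {P = stateOf m ≡ q₀} ⌋

  ⌊em⌋⇒ : ∀ {P : Set} → ⌊ em {P = P} ⌋ ≡ true → P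
  ⌊em⌋⇒ {P} e with em {P = P}
  ... | yes p = p

  ⇒⌊em⌋ : ∀ {P : Set} → P → ⌊ em {P = P} ⌋ ≡ true
  ⇒⌊em⌋ {P} p with em {P = P}
  ... | yes _ = refl
  ... | no ¬p = ⊥-elim (¬p p)

  ones : ℕ → ℕ → Bool
  ones u i = digit 2 i u ≡ᵇ 2

  -- Pairing is monotone, so the presence of this one digit guarantees that of all bits of the steps
  -- up to `i`.
  written : ℕ → ℕ → Bool
  written u i = not (digit 2 (pair i M) u ≡ᵇ 0)

  check : ℕ → ℕ → ℕ → Bool
  check i u v = written u (suc i) ∧ starting (number (ones u) 0) ∧
    transition (number (ones u) i) (number (ones u) (suc i)) (digit n i v ⊓ n)
               (tabulate λ j → positive (counter (ones u) j i)) ∧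
    anyUpTo u (λ i′ → (i ≤ᵇ i′) ∧ written u i′ ∧ accepting (number (ones u) i′))

  module _ {l : ℕ} {U I : Vec ℕ l → ℕ} (u : Computable U) (i : Computable I) where

    writtenᶜ : Decides (λ xs → written (U xs) (I xs))
    writtenᶜ = notᶜ (isZeroᶜ (digitᶜ 2 (pairᶜ i (constᶜ M)) u))

    countᶜ : Computable (λ xs → countUpTo M (λ q → ones (U xs) (pair (I xs) q)))
    countᶜ = countUpToᶜ M λ q → ≡ᵇᶜ (digitᶜ 2 (pairᶜ i (constᶜ q)) u) (constᶜ 2)

    onNumberᶜ : (H : ℕ → Vec ℕ l → ℕ) → (∀ m → Computable (H m)) → Computable (λ xs → H (number (ones (U xs)) (I xs)) xs)
    onNumberᶜ H h = casesᶜ M H countᶜ h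

  counterᶜ : ∀ {l} {U I : Vec ℕ l → ℕ} j → Computable U → Computable I → Computable (λ xs → counter (ones (U xs)) j (I xs))
  counterᶜ {U = U} j u i = recᶜ (λ m xs → counter (ones (U xs)) j m)
    {G = λ v → applyMove (lookup (movesOf (number (ones (U (Vec.tail (Vec.tail v)))) (lookup v #0))) j) (lookup v #1)}
    (λ _ → refl) (λ _ _ → refl) (constᶜ 0)
    (onNumberᶜ (weakenᶜ (weakenᶜ u)) (projᶜ #0) (λ m v → applyMove (lookup (movesOf m) j) (lookup v #1))
      λ m → applyMoveᶜ (lookup (movesOf m) j) (projᶜ #1)) i

  checkᶜ : Decides {3} (λ xs → check (lookup xs #0) (lookup xs #1) (lookup xs #2))
  checkᶜ = ∧ᶜ (writtenᶜ u (sucᶜ i)) (∧ᶜ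
    (onNumberᶜ u (constᶜ 0) (λ m _ → b2n (starting m)) λ m → constᶜ (b2n (starting m))) (∧ᶜ
    (onNumberᶜ u i (λ m xs → b2n (transition m (number (ones (lookup xs #1)) (suc (lookup xs #0)))
        (digit n (lookup xs #0) (lookup xs #2) ⊓ n) (tabulate λ j → positive (counter (ones (lookup xs #1)) j (lookup xs #0))))) λ m →
      onNumberᶜ u (sucᶜ i) (λ m′ xs → b2n (transition m m′
        (digit n (lookup xs #0) (lookup xs #2) ⊓ n) (tabulate λ j → positive (counter (ones (lookup xs #1)) j (lookup xs #0))))) λ m′ →
      casesᶜ n (λ d xs → b2n (transition m m′ d (tabulate λ j → positive (counter (ones (lookup xs #1)) j (lookup xs #0)))))
        (digitᶜ n i (projᶜ #2)) λ d →
      boolTableᶜ k (transition m m′ d) λ j → positiveᶜ (counterᶜ j u i))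
    (anyUpToᶜ (λ i′ xs → (lookup xs #0 ≤ᵇ i′) ∧ written (lookup xs #1) i′ ∧ accepting (number (ones (lookup xs #1)) i′))
      (∧ᶜ (≤ᵇᶜ (weakenᶜ i) (projᶜ #0)) (∧ᶜ (writtenᶜ (weakenᶜ u) (projᶜ #0))
        (onNumberᶜ (weakenᶜ u) (projᶜ #0) (λ m _ → b2n (accepting m)) λ m → constᶜ (b2n (accepting m))))) u)))
    where
    i : Computable {3} (λ xs → lookup xs #0)
    i = projᶜ #0
    u : Computable {3} (λ xs → lookup xs #1)
    u = projᶜ #1

  record Checked (i u v : ℕ) : Set where
    field
      writtenUp : written u (suc i) ≡ true
      startsAt  : stateOf (number (ones u) 0) ≡ q₀
      transits  : Transition (number (ones u) i) (number (ones u) (suc i)) (digit n i v ⊓ n)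
                             (tabulate λ j → positive (counter (ones u) j i))
      later     : ∃ λ i′ → i ≤ i′ × written u i′ ≡ true × stateOf (number (ones u) i′) Subset.∈ F

  check⇒ : ∀ i u v → check i u v ≡ true → Checked i u v
  check⇒ i u v e =
    let (w , e₁) = ∧-true {written u (suc i)} e
        (s , e₂) = ∧-true {starting (number (ones u) 0)} e₁
        (t , e₃) = ∧-true {transition (number (ones u) i) (number (ones u) (suc i)) (digit n i v ⊓ n)
                             (tabulate λ j → positive (counter (ones u) j i))} e₂
        (i′ , _ , e₄) = anyUpTo⇒ u e₃
        (le , e₅) = ∧-true {i ≤ᵇ i′} e₄
        (w′ , a) = ∧-true {written u i′} e₅
    in record { writtenUp = w ; startsAt = ⌊em⌋⇒ s ; transits = ⌊em⌋⇒ t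
              ; later = i′ , ≤ᵇ≡true⇒≤ le , w′ , ⌊em⌋⇒ a }

  ⇒check : ∀ i u v (c : Checked i u v) → proj₁ (Checked.later c) < u → check i u v ≡ true
  ⇒check i u v c i′<u = cong₂ _∧_ writtenUp (cong₂ _∧_ (⇒⌊em⌋ startsAt) (cong₂ _∧_ (⇒⌊em⌋ transits)
    (⇒anyUpTo i′<u (cong₂ _∧_ (T⇒true (≤⇒≤ᵇ (proj₁ (proj₂ later))))
      (cong₂ _∧_ (proj₁ (proj₂ (proj₂ later))) (⇒⌊em⌋ (proj₂ (proj₂ (proj₂ later)))))))))
    where
    open Checked c
    T⇒true : ∀ {b} → T b → b ≡ true
    T⇒true {true} _ = refl

  transition-resp : ∀ {a a′ b b′ d d′ bs bs′} → a ≡ a′ → b ≡ b′ → d ≡ d′ → bs ≡ bs′ →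
                    Transition a b d bs → Transition a′ b′ d′ bs′
  transition-resp refl refl refl refl t = t

  record Plausible (g : ℕ → Bool) (σ : ωWord n) : Set where
    field
      starts : stateOf (number g 0) ≡ q₀
      steps  : ∀ i → Transition (number g i) (number g (suc i)) (suc (toℕ (σ i))) (tabulate λ j → positive (counter g j i))
      repeats : InfinitelyOften λ i → stateOf (number g i) Subset.∈ F

  module _ (τ : ωWord 2) (σ : ωWord n) where

    private
      g : ℕ → Bool
      g = isOne ∘ τ

    ones-prefix : ∀ {m i} → i < m → ones ⌜ prefix τ m ⌝ i ≡ g i
    ones-prefix {m} {i} i<m = trans (cong (_≡ᵇ 2) (digit-< τ i<m)) (eq (τ i))
      where
      eq : ∀ a → (suc (toℕ a) ≡ᵇ 2) ≡ isOne a
      eq zero = refl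
      eq (suc zero) = refl

    below-written : ∀ {m i i′ q} → pair i M < m → i′ ≤ i → q < M → pair i′ q < m
    below-written lt i′≤i q<M = ≤-<-trans (pair-mono i′≤i (<⇒≤ q<M)) lt

    number-prefix : ∀ {m i i′} → pair i M < m → i′ ≤ i → number (ones ⌜ prefix τ m ⌝) i′ ≡ number g i′
    number-prefix {m} lt i′≤i = number-cong {ones ⌜ prefix τ m ⌝} {g} _ λ q q<M → ones-prefix (below-written lt i′≤i q<M)

    counter-prefix : ∀ {m i i′} j → pair i M < m → i′ ≤ i → counter (ones ⌜ prefix τ m ⌝) j i′ ≡ counter g j i′
    counter-prefix {m} {i} {i′} j lt i′≤i = counter-cong {ones ⌜ prefix τ m ⌝} {g} j i′ λ l q l<i′ q<M →
      ones-prefix (below-written lt (≤-trans (<⇒≤ l<i′) i′≤i) q<M)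

    written⇒< : ∀ {m i} → written ⌜ prefix τ m ⌝ i ≡ true → pair i M < m
    written⇒< {m} {i} e = ≰⇒> λ le → case trans (sym e) (cong (λ d → not (d ≡ᵇ 0))
      (trans (digit-⌜⌝ (prefix τ m) (pair i M)) (digitOf-prefix-≥ τ le))) of λ ()

    <⇒written : ∀ {m i} → pair i M < m → written ⌜ prefix τ m ⌝ i ≡ true
    <⇒written lt = cong (λ d → not (d ≡ᵇ 0)) (digit-< τ lt)

    plausible⇔ : (∀ i → ∃ λ m → check i ⌜ prefix τ m ⌝ ⌜ prefix σ m ⌝ ≡ true) ⇔ Plausible g σ
    plausible⇔ = mk⇔ to from
      where
      module _ {i m : ℕ} (w< : pair (suc i) M < m) where
        i<m : i < m
        i<m = ≤-trans (fst-≤-pair (suc i) M) (<⇒≤ w<)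
        digit≡ : digit n i ⌜ prefix σ m ⌝ ⊓ n ≡ suc (toℕ (σ i))
        digit≡ = trans (cong (_⊓ n) (digit-< σ i<m)) (m≤n⇒m⊓n≡m (FinP.toℕ<n (σ i)))
        signs≡ : (tabulate λ j → positive (counter (ones ⌜ prefix τ m ⌝) j i)) ≡ (tabulate λ j → positive (counter g j i))
        signs≡ = tabulate-cong λ j → cong positive (counter-prefix j w< (n≤1+n i))
      to : (∀ i → ∃ λ m → check i ⌜ prefix τ m ⌝ ⌜ prefix σ m ⌝ ≡ true) → Plausible g σ
      to h = record
        { starts = subst (λ c → stateOf c ≡ q₀) (number-prefix (w< 0) z≤n) (Checked.startsAt (c 0))
        ; steps = λ i → transition-resp (number-prefix (w< i) (n≤1+n i)) (number-prefix (w< i) ≤-refl)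
                    (digit≡ (w< i)) (signs≡ (w< i)) (Checked.transits (c i))
        ; repeats = λ i → let (i′ , le , w′ , a) = Checked.later (c i) in
            i′ , le , subst (λ c → stateOf c Subset.∈ F) (number-prefix {proj₁ (h i)} (written⇒< w′) ≤-refl) a
        }
        where
        c : ∀ i → Checked i ⌜ prefix τ (proj₁ (h i)) ⌝ ⌜ prefix σ (proj₁ (h i)) ⌝
        c i = check⇒ i _ _ (proj₂ (h i))
        w< : ∀ i → pair (suc i) M < proj₁ (h i)
        w< i = written⇒< (Checked.writtenUp (c i))
      from : Plausible g σ → ∀ i → ∃ λ m → check i ⌜ prefix τ m ⌝ ⌜ prefix σ m ⌝ ≡ true
      from p i = m , ⇒check i ⌜ prefix τ m ⌝ ⌜ prefix σ m ⌝ (record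
        { writtenUp = <⇒written w<
        ; startsAt = subst (λ c → stateOf c ≡ q₀) (sym (number-prefix w< z≤n)) starts
        ; transits = transition-resp (sym (number-prefix w< (n≤1+n i))) (sym (number-prefix w< ≤-refl))
                     (sym (digit≡ w<)) (sym (signs≡ w<)) (steps i)
        ; later = i′ , proj₁ (proj₂ (repeats i)) , <⇒written w′< ,
            subst (λ c → stateOf c Subset.∈ F) (sym (number-prefix w′< ≤-refl)) (proj₂ (proj₂ (repeats i)))
        }) (<⇒<code τ (≤-<-trans (fst-≤-pair i′ M) w′<))
        where
        open Plausible p
        i′ = proj₁ (repeats i)
        m = suc (pair (suc i) M) ⊔ suc (pair i′ M)
        w< : pair (suc i) M < m
        w< = m≤m⊔n (suc (pair (suc i) M)) (suc (pair i′ M))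
        w′< : pair i′ M < m
        w′< = m≤n⊔m (suc (pair (suc i) M)) (suc (pair i′ M))

  applyMove-Moved : ∀ j c → (positive c ≡ false → j ≢ down) → Moved j c (applyMove j c)
  applyMove-Moved stay c _ = refl
  applyMove-Moved up c _ = refl
  applyMove-Moved down zero ok = ⊥-elim (ok refl refl)
  applyMove-Moved down (suc c) _ = refl

  Moved-unique : ∀ j {c c₁ c₂} → Moved j c c₁ → Moved j c c₂ → c₁ ≡ c₂
  Moved-unique stay refl refl = refl
  Moved-unique up refl refl = refl
  Moved-unique down refl refl = refl

  plausible⇒accepts : ∀ {g σ} → Plausible g σ → Accepts σ
  plausible⇒accepts {g} {σ} p =
    let (q , inf) = pigeonhole (stateOf ∘ number g) (λ i → stateOf (number g i) Subset.∈ F) repeats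
        (_ , _ , q∈ , e) = inf 0
    in r , (cong₂ _,_ starts (tabulate-replicate 0 k) , step) , q , subst (Subset._∈ F) e q∈ ,
       λ N → let (i , N≤i , _ , e) = inf N in i , N≤i , e
    where
    open Plausible p
    cs : ℕ → Vec ℕ k
    cs i = tabulate λ j → counter g j i
    r : ℕ → Config
    r i = stateOf (number g i) , cs i
    step : ∀ i → Step (σ i) (r i) (r (suc i))
    step i with steps i
    ... | a , e , δ with FinP.toℕ-injective (suc-injective e)
    ... | refl = movesOf (number g i) , subst (λ bs → Δ (stateOf (number g i)) a bs (stateOf (number g (suc i))) (movesOf (number g i))) (tabulate-∘ positive (λ j → counter g j i)) δ , λ j →
          subst₂ (λ c c′ → ℤ.+ c′ ≡ ℤ.+ c ℤ.+ ⟦ lookup (movesOf (number g i)) j ⟧)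
            (sym (lookup∘tabulate (λ j → counter g j i) j)) (sym (lookup∘tabulate (λ j → counter g j (suc i)) j))
            (Moved⇒ℤ (lookup (movesOf (number g i)) j) (applyMove-Moved _ (counter g j i)
              λ e → no-down δ j (trans (lookup∘tabulate (λ j → positive (counter g j i)) j) e)))

  accepts⇒plausible : ∀ {σ} → Accepts σ → ∃ λ (τ : ωWord 2) → Plausible (isOne ∘ τ) σ
  accepts⇒plausible {σ} (r , (r0 , step) , q , q∈ , inf) = τ , record
    { starts = trans (cong proj₁ (step≡ 0)) (cong proj₁ r0)
    ; steps = λ i → σ i , refl , transfer (sym (cong proj₁ (step≡ i)))
        (trans (map-positive i) (sym (tabulate-∘ positive (λ j → counter g j i))))
        (sym (cong proj₁ (step≡ (suc i)))) (sym (cong proj₂ (step≡ i))) (proj₁ (proj₂ (step i)))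
    ; repeats = λ N → let (i , N≤i , e) = inf N in
        i , N≤i , subst (Subset._∈ F) (sym (trans (cong proj₁ (step≡ i)) e)) q∈
    }
    where
    y : ℕ → Y
    y i = proj₁ (r i) , proj₁ (step i)
    τ : ωWord 2
    -- Step `i` is written in unary: as many ones as its number says, then zeros.
    τ z = bit (snd z <ᵇ toℕ (enc finY (y (fst z))))
    g = isOne ∘ τ
    number≡ : ∀ i → number g i ≡ toℕ (enc finY (y i))
    number≡ i = trans (cong (_⊓ M) (trans (countUpTo-cong M λ q _ → trans (isOne-bit _)
        (cong₂ (λ q i → q <ᵇ toℕ (enc finY (y i))) (snd-pair i q) (fst-pair i q)))
        (countUpTo-< (toℕ (enc finY (y i))) M)))
      (trans (cong (_⊓ M) (m≥n⇒m⊓n≡n y≤M)) (m≤n⇒m⊓n≡m y≤M))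
      where
      y≤M : toℕ (enc finY (y i)) ≤ M
      y≤M = <⇒≤ (FinP.toℕ<n (enc finY (y i)))
    step≡ : ∀ i → stepOf (number g i) ≡ y i
    step≡ i = trans (cong stepOf (number≡ i)) (stepOf-enc (y i))
    transfer : ∀ {p p′ bs bs′ s s′ js js′ a} → p ≡ p′ → bs ≡ bs′ → s ≡ s′ → js ≡ js′ → Δ p a bs s js → Δ p′ a bs′ s′ js′
    transfer refl refl refl refl δ = δ
    counter≡ : ∀ j i → lookup (proj₂ (r i)) j ≡ counter g j i
    counter≡ j zero = trans (cong (λ c → lookup (proj₂ c) j) r0) (lookup-replicate j 0)
    counter≡ j (suc i) with step i | step≡ i
    ... | js , δ , h | e rewrite e | sym (counter≡ j i) =
      let ok = λ z → no-down δ j (trans (lookup-map j positive (proj₂ (r i))) z)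
          c = lookup (proj₂ (r i)) j
      in Moved-unique (lookup js j) {c} (ℤ⇒Moved (lookup js j) ok (h j)) (applyMove-Moved (lookup js j) c ok)
    map-positive : ∀ i → Vec.map positive (proj₂ (r i)) ≡ Vec.map positive (tabulate λ j → counter g j i)
    map-positive i = cong (Vec.map positive) (trans (sym (tabulate∘lookup (proj₂ (r i)))) (tabulate-cong λ j → counter≡ j i))

  accepts-Σ¹₁ : IsΣ¹₁ Accepts
  accepts-Σ¹₁ = (λ i u v → check i ⌜ u ⌝ ⌜ v ⌝ ≡ true) , decides⇒recursiveʷ {b = check} checkᶜ ,
    (λ {σ} a → let (τ , p) = accepts⇒plausible a in τ , Equivalence.from (plausible⇔ τ σ) p) ,
    λ {σ} (τ , h) → plausible⇒accepts (Equivalence.to (plausible⇔ τ σ) h)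

-- Auxiliary facts on computations and continuous maps

⇓-deterministic : ∀ {k} {f : PR k} {xs y z} → f [ xs ]⇓ y → f [ xs ]⇓ z → y ≡ z
⇓-deterministicᵛ : ∀ {k l} {gs : Vec (PR k) l} {xs ys zs} → Pointwise (λ g z → g [ xs ]⇓ z) gs ys →
                   Pointwise (λ g z → g [ xs ]⇓ z) gs zs → ys ≡ zs

⇓-deterministic ⇓zero ⇓zero = refl
⇓-deterministic ⇓suc ⇓suc = refl
⇓-deterministic ⇓proj ⇓proj = refl
⇓-deterministic (⇓comp ds d) (⇓comp es e) with ⇓-deterministicᵛ ds es
... | refl = ⇓-deterministic d e
⇓-deterministic (⇓rec₀ d) (⇓rec₀ e) = ⇓-deterministic d e
⇓-deterministic (⇓rec₊ d d′) (⇓rec₊ e e′) with ⇓-deterministic d e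
... | refl = ⇓-deterministic d′ e′
⇓-deterministic (⇓μ {y = y} d h) (⇓μ {y = z} e g) with <-cmp y z
... | tri≈ _ y≡z _ = y≡z
... | tri< y<z _ _ = case ⇓-deterministic d (proj₂ (g y y<z)) of λ ()
... | tri> _ _ z<y = case ⇓-deterministic (proj₂ (h z z<y)) e of λ ()

⇓-deterministicᵛ [] [] = refl
⇓-deterministicᵛ (d ∷ ds) (e ∷ es) = cong₂ _∷_ (⇓-deterministic d e) (⇓-deterministicᵛ ds es)

continuous-∘ : ∀ {l m n} {g : ωWord m → ωWord n} {f : ωWord l → ωWord m} →
               IsContinuous g → IsContinuous f → IsContinuous (g ∘ f)
continuous-∘ {f = f} cg cf σ k =
  let (j , h) = cg (f σ) k; (i , h′) = cf σ j in i , λ τ e → h (f τ) (h′ τ e)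

-- Complete languages at the first level

module FirstLevel (em : ∀ {ℓ} → ExcludedMiddle ℓ) where

  open OrdinalComparison em
  open BorelClasses em

  seen : ωWord 2 → ℕ → Bool
  seen w i = anyUpTo i (isOne ∘ w)

  SomeOne : Lang 2
  SomeOne w = ∃ λ i → seen w i ≡ true

  seen-mono : ∀ w {i j} → i ℕ.≤′ j → seen w i ≡ true → seen w j ≡ true
  seen-mono w ≤′-refl e = e
  seen-mono w (≤′-step p) e rewrite seen-mono w p e = refl

  scanner : (Bool → Bool) → CounterAutomaton 4 (Fin 2)
  scanner accept = record
    { Q = Bool ; finiteQ = Bool-finite ; initial = false ; accepting = accept
    ; Trans = λ b a b′ js → b′ ≡ b ∨ isOne a × js ≡ replicate 4 stay }

  module _ (accept : Bool → Bool) where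

    open CounterAutomaton (scanner accept)

    recognised⇔ : ∀ w → Recognised (Fin-finite 2) w ⇔ InfinitelyOften (λ i → accept (seen w i) ≡ true)
    recognised⇔ w = mk⇔
      (λ (r , follows , inf) N → let (i , N≤i , a) = inf N in i , N≤i , trans (cong accept (sym (state≡ follows i))) a)
      (λ inf → (λ i → seen w i , replicate 4 0) , (refl , λ i → moving (refl , refl) λ m →
          subst₂ (λ j c → Moved j c c) (sym (lookup-replicate m stay)) (sym (lookup-replicate m 0)) refl) , inf)
      where
      step-state : ∀ {a c c′} → Step a c c′ → proj₁ c′ ≡ proj₁ c ∨ isOne a
      step-state (moving (e , _) _) = e
      state≡ : ∀ {r} → Run (Fin-finite 2) w r → ∀ i → proj₁ (r i) ≡ seen w i
      state≡ (r0 , step) zero = cong proj₁ r0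
      state≡ {r} follows@(r0 , step) (suc i) = trans (step-state (step i)) (cong (_∨ isOne (w i)) (state≡ {r} follows i))

  someOne-r-BCL : r-BCLω 4 SomeOne
  someOne-r-BCL =
    let (A , to , from) = CounterAutomaton.recognised-r-BCL (scanner id) (Fin-finite 2) em
        e = recognised⇔ id
    in A , (λ {w} (i , s) → to {w} (Equivalence.from (e w) λ N → N ⊔ i , m≤m⊔n N i ,
              seen-mono w (≤⇒≤′ (m≤n⊔m N i)) s)) ,
           (λ {w} a → let (i , _ , s) = Equivalence.to (e w) (from {w} a) 0 in i , s)

  ∁someOne-r-BCL : r-BCLω 4 (∁ SomeOne)
  ∁someOne-r-BCL =
    let (A , to , from) = CounterAutomaton.recognised-r-BCL (scanner not) (Fin-finite 2) em
        e = recognised⇔ not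
    in A , (λ {w} none → to {w} (Equivalence.from (e w) λ N → N , ≤-refl , unseen w none N)) ,
           (λ {w} a (i , s) → let (j , i≤j , u) = Equivalence.to (e w) (from {w} a) i in
             case trans (sym u) (cong not (seen-mono w (≤⇒≤′ i≤j) s)) of λ ())
    where
    unseen : ∀ w → ¬ SomeOne w → ∀ N → not (seen w N) ≡ true
    unseen w none N with seen w N in s
    ... | true = ⊥-elim (none (N , s))
    ... | false = refl

  seen-local : ∀ {w w′} i → Agree i w w′ → seen w i ≡ seen w′ i
  seen-local zero _ = refl
  seen-local (suc i) a = cong₂ _∨_ (seen-local i λ j j<i → a j (m<n⇒m<1+n j<i)) (cong isOne (a i ≤-refl))

  someOne-open : IsOpen SomeOne
  someOne-open w (i , s) = i , λ w′ e → i , trans (sym (seen-local i (prefix⇒Agree {σ = w} {w′} i e))) s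

  -- The reduction writes 1 in place `i` as soon as the first `i` letters guarantee membership in
  -- the open set.
  someOne-complete : ∀ {α} → α ≅ 𝟙 → IsΣ⁰-complete α SomeOne
  someOne-complete {α} iso {m} F = mk⇔ to
    (λ (f , cf , (h , k)) → Σ⁰-≐ {α = α} ((λ {σ} → k) , λ {σ} → h) (Σ⁰-preimage {α = α} cf (open-set iso someOne-open)))
    where
    to : Σ⁰ α F → ∃ λ f → IsContinuous f × F ≐ (f ⊢ SomeOne)
    to (union β G l u _ _) = ⊥-elim (Lt-irrefl {𝟙} (Lt-Le-trans {𝟙} {α} {𝟙}
      (≺⇒Lt {𝟙} {α} (≼-≺-trans {𝟙} {β 0} {α} (l 0) (u 0))) (≅⇒Le {α} {𝟙} iso)))
    to (open-set _ o) = f , pointwise-continuous f local , into , outof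
      where
      f : ωWord m → ωWord 2
      f σ i = bit ⌊ em {P = Cylinder F i σ} ⌋
      local : ∀ σ i → ∃ λ l → ∀ τ → Agree l σ τ → f σ i ≡ f τ i
      local σ i = i , λ τ a → cong bit (⌊em⌋-cong (λ c υ e → c υ (trans (Agree⇒prefix i a) e))
                                            (λ c υ e → c υ (trans (sym (Agree⇒prefix i a)) e)))
      into : ∀ {σ} → F σ → SomeOne (f σ)
      into {σ} p with o σ p
      ... | i , c = suc i , trans (cong (seen (f σ) i ∨_) hit) (∨-zeroʳ (seen (f σ) i))
        where
        hit : isOne (f σ i) ≡ true
        hit with em {P = Cylinder F i σ}
        ... | yes _ = refl
        ... | no ¬c = ⊥-elim (¬c c)
      outof : ∀ {σ} → SomeOne (f σ) → F σ
      outof {σ} (i , s) with anyUpTo⇒ i s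
      ... | j , _ , e with em {P = Cylinder F j σ}
      ... | yes c = c σ refl

-- The supremum of the Borel ranks

module Suprema (em : ∀ {ℓ} → ExcludedMiddle ℓ) where

  open OrdinalComparison em
  open OrdinalConstructions em
  open BorelClasses em
  open Simulation em

  Σ¹₁-≐ : ∀ {n} {E E′ : Lang n} → E ≐ E′ → IsΣ¹₁ E → IsΣ¹₁ E′
  Σ¹₁-≐ (f , g) (R , R-rec , to , from) = R , R-rec , to ∘ g , f ∘ from

  rank-≐ : ∀ {n} {E E′ : Lang n} {α} → E ≐ E′ → HasBorelRank E α → HasBorelRank E′ α
  rank-≐ {E = E} {E′} {α} e (l , c , least) = l , Sum.map (Σ⁰-≐ {α = α} e) (Σ⁰-≐ {α = α} (∁-≐ e)) c ,
    λ β 𝟙≼β c → least β 𝟙≼β (Sum.map (Σ⁰-≐ {α = β} (≐-sym e)) (Σ⁰-≐ {α = β} (∁-≐ (≐-sym e))) c)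

  rank-∁ : ∀ {n} {E : Lang n} {α} → HasBorelRank E α → HasBorelRank (∁ E) α
  rank-∁ {E = E} {α} (l , c , least) = l , Sum.swap (Sum.map₁ (Σ⁰-≐ {α = α} ∁∁-≐) c) ,
    λ β 𝟙≼β c → least β 𝟙≼β (Sum.swap (Sum.map₂ (Σ⁰-≐ {α = β} (≐-sym ∁∁-≐)) c))

  -- Languages form a large type, while a supremum needs an index in `Set`: so the relation is
  -- replaced by the output 1 of the program that decides it, and programs serve as the index.
  Coded : ∀ {n} → PR 3 → Lang n
  Coded f σ = ∃ λ (τ : ωWord 2) → ∀ k → ∃ λ m → f [ k ∷ ⌜ prefix τ m ⌝ ∷ ⌜ prefix σ m ⌝ ∷ [] ]⇓ 1

  Total : ℕ → PR 3 → Set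
  Total n f = ∀ k (u : Word 2) (v : Word n) →
    ComputesTruth f (k ∷ ⌜ u ⌝ ∷ ⌜ v ⌝ ∷ []) (f [ k ∷ ⌜ u ⌝ ∷ ⌜ v ⌝ ∷ [] ]⇓ 1)

  Coded-Σ¹₁ : ∀ {n f} → Total n f → IsΣ¹₁ (Coded {n} f)
  Coded-Σ¹₁ {f = f} t = _ , (f , t) , id , id

  Σ¹₁⇒Coded : ∀ {n} {E : Lang n} → IsΣ¹₁ E → ∃ λ f → Total n f × E ≐ Coded f
  Σ¹₁⇒Coded {n} (R , (f , t) , to , from) = f , total ,
    (λ e → let (τ , h) = to e in τ , λ k → let (m , r) = h k in m , Equivalence.to (code k _ _) r) ,
    λ (τ , h) → from (τ , λ k → let (m , d) = h k in m , Equivalence.from (code k _ _) d)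
    where
    code : ∀ k u v → R k u v ⇔ f [ k ∷ ⌜ u ⌝ ∷ ⌜ v ⌝ ∷ [] ]⇓ 1
    code k u v with t k u v
    ... | inj₁ (r , d) = mk⇔ (λ _ → d) (λ _ → r)
    ... | inj₂ (¬r , d) = mk⇔ (λ r → ⊥-elim (¬r r)) (λ d′ → case ⇓-deterministic d d′ of λ ())
    total : Total n f
    total k u v with t k u v
    ... | inj₁ (_ , d) = inj₁ (d , d)
    ... | inj₂ (_ , d) = inj₂ ((λ d′ → case ⇓-deterministic d d′ of λ ()) , d)

  Code : Set
  Code = ℕ × PR 3

  Ranked : Code → Ordinal → Set₁
  Ranked (n , f) α = Total n f × HasBorelRank (∁ (Coded {n} f)) α

  rankOf : ∀ {i} → Dec (∃ (Ranked i)) → Ordinal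
  rankOf (yes (α , _)) = α
  rankOf (no _) = 𝟘

  open Supremum (λ i → rankOf {i} em) using (sup; sup-upper; sup-least)

  -- Every program contributes a rank of its language, if there is one, and the empty ordinal
  -- otherwise. Minimality of ranks makes it immaterial which representative excluded middle
  -- supplies.
  sup-isγ¹₂ : Isγ¹₂ sup
  sup-isγ¹₂ = upper , least
    where
    upper : ∀ α → BorelRanks IsΠ¹₁ α → α ≼ sup
    upper α (n , E , s , rank) with Σ¹₁⇒Coded s
    ... | f , total , E≐ = Le⇒≼ {α} {sup} (Le-trans {α} {rankOf {n , f} em} {sup} α≤ (sup-upper (n , f)))
      where
      ranked : Ranked (n , f) α
      ranked = total , rank-≐ {α = α} (≐-trans ∁∁-≐ (∁-≐ E≐)) rank
      α≤ : Le α (rankOf {n , f} em)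
      α≤ with em {P = ∃ (Ranked (n , f))}
      ... | no none = ⊥-elim (none (α , ranked))
      ... | yes (β , _ , 𝟙≼β , c , _) = ≼⇒Le {α} {β} (proj₂ (proj₂ (proj₂ ranked)) β 𝟙≼β c)
    least : ∀ δ → (∀ α → BorelRanks IsΠ¹₁ α → α ≼ δ) → sup ≼ δ
    least δ h = Le⇒≼ {sup} {δ} (sup-least {δ} below)
      where
      below : ∀ i → Le (rankOf {i} em) δ
      below i@(n , f) with em {P = ∃ (Ranked i)}
      ... | no _ = 𝟘-Le {δ}
      ... | yes (α , total , rank) = ≼⇒Le {α} {δ} (h α (n , ∁ (Coded f) , Σ¹₁-≐ ∁∁-≐ (Coded-Σ¹₁ total) , rank))

  -- Classes pass from `K` to `L` only beyond the first level. It is enough that they show `L` to be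
  -- Borel.
  raise : ∀ α → 𝟙 ≼ α → ∃ λ α′ → 𝟙 ≺ α′ × α ≼ α′
  raise α (inj₁ 𝟙≺α) = α , 𝟙≺α , ≼-refl {α}
  raise α (inj₂ iso) = 𝟚 , Lt⇒≺ {𝟙} {𝟚} 𝟙-Lt-𝟚 ,
    inj₁ (Lt⇒≺ {α} {𝟚} (Le-Lt-trans {α} {𝟙} {𝟚} (≅⇒Ge {𝟙} {α} iso) 𝟙-Lt-𝟚))

  sup-isSupremum : IsSupremum (BorelRanks (r-BCLω 4)) sup
  sup-isSupremum = upper , least
    where
    upper : ∀ α → BorelRanks (r-BCLω 4) α → α ≼ sup
    upper α (n , E , (A , E≐) , rank) = proj₁ sup-isγ¹₂ α
      (n , ∁ E , Σ¹₁-≐ (≐-trans (≐-sym E≐) ∁∁-≐) (RunGuess.accepts-Σ¹₁ em A) , rank-∁ {α = α} rank)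
    least : ∀ δ → (∀ α → BorelRanks (r-BCLω 4) α → α ≼ δ) → sup ≼ δ
    least δ h = proj₂ sup-isγ¹₂ δ λ α (n , E , s , rank) → below α E s rank
      where
      -- The simulating language `L` may have a larger rank than `E`, but not a smaller one, as the
      -- complement of `E` is a continuous preimage of `L`. For an upper bound `δ` of the ranks of
      -- automata this is the right direction.
      below : ∀ α {n} (E : Lang n) → IsΠ¹₁ E → HasBorelRank E α → α ≼ δ
      below α E s (𝟙≼α , c , minimal) with simulate s
      ... | N , L , bcl , (g , cg , E≐) , sigma , pi = ≼-trans {α} {β} {δ}
            (minimal β 𝟙≼β (Sum.swap (Sum.map
              (λ q → Σ⁰-≐ {α = β} (≐-sym E≐) (Σ⁰-preimage {α = β} cg q))
              (λ q → Σ⁰-≐ {α = β} (≐-trans (∁-≐ (≐-sym E≐)) (≐-sym ∁∁-≐)) (Σ⁰-preimage {α = β} cg q)) classL)))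
            (h β (N , L , bcl , 𝟙≼β , classL , leastL))
        where
        α′ = proj₁ (raise α 𝟙≼α)
        𝟙≺α′ = proj₁ (proj₂ (raise α 𝟙≼α))
        α≼α′ = proj₂ (proj₂ (raise α 𝟙≼α))
        rankL : ∃ (HasBorelRank L)
        rankL = borel-rank {α = α′} (Sum.swap (Sum.map
          (λ q → pi α′ 𝟙≺α′ (Σ⁰-mono {α = α} {α′} α≼α′ (Σ⁰-≐ {α = α} ∁∁-≐ q)))
          (λ q → sigma α′ 𝟙≺α′ (Σ⁰-mono {α = α} {α′} α≼α′ q)) c))
        β = proj₁ rankL
        𝟙≼β = proj₁ (proj₂ rankL)
        classL = proj₁ (proj₂ (proj₂ rankL))
        leastL = proj₂ (proj₂ (proj₂ rankL))

-- Complete languages for all recursive ordinals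

module Completeness (em : ∀ {ℓ} → ExcludedMiddle ℓ) where

  open OrdinalComparison em
  open BorelClasses em
  open Simulation em

  -- Hardness passes along the reduction of `K` to `L`, membership in the class along the transfer
  -- beyond the first level.
  simulates-Σ⁰-complete : ∀ {α m n} {K : Lang m} {L : Lang n} → 𝟙 ≺ α → Simulates K L →
    Σ⁰ α K → IsΣ⁰-complete α K → IsΣ⁰-complete α L
  simulates-Σ⁰-complete {α} 𝟙≺α ((g , cg , (to , from)) , sigma , _) k complete F = mk⇔
    (λ s → let (f , cf , (h , h′)) = Equivalence.to (complete F) s in
       g ∘ f , continuous-∘ cg cf , (λ {σ} → to ∘ h) , λ {σ} → h′ ∘ from)
    (λ (f , cf , e) → Σ⁰-≐ {α = α} (≐-sym e) (Σ⁰-preimage {α = α} cf (sigma α 𝟙≺α k)))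

  simulates-Π⁰-complete : ∀ {α m n} {K : Lang m} {L : Lang n} → 𝟙 ≺ α → Simulates K L →
    Π⁰ α K → IsΠ⁰-complete α K → IsΠ⁰-complete α L
  simulates-Π⁰-complete {α} 𝟙≺α ((g , cg , (to , from)) , _ , pi) k complete F = mk⇔
    (λ s → let (f , cf , (h , h′)) = Equivalence.to (complete F) s in
       g ∘ f , continuous-∘ cg cf , (λ {σ} → to ∘ h) , λ {σ} → h′ ∘ from)
    (λ (f , cf , e) → Σ⁰-≐ {α = α} (∁-≐ (≐-sym e)) (Σ⁰-preimage {α = α} cf (pi α 𝟙≺α k)))

  -- For the second language the opposite outcome of the game is simulated, rather than the first
  -- language complemented: an automaton is obtained from effective analyticity, which both outcomes
  -- have.
  complete-languages : ∀ α → 𝟙 ≼ α → IsRecursiveOrdinal α →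
    (∃₂ λ n (L : Lang n) → r-BCLω 4 L × IsΣ⁰-complete α L) ×
    (∃₂ λ n (L : Lang n) → r-BCLω 4 L × IsΠ⁰-complete α L)
  complete-languages α (inj₂ iso) _ =
    (2 , SomeOne , someOne-r-BCL , someOne-complete {α} α≅𝟙) ,
    (2 , ∁ SomeOne , ∁someOne-r-BCL , complete {α} {K = SomeOne} (someOne-complete {α} α≅𝟙))
    where
    open FirstLevel em
    α≅𝟙 = ≅-sym {𝟙} {α} iso
  complete-languages α 𝟙≼α@(inj₁ 𝟙≺α) (D , R , D-rec , R-rec , f , mono , range) =
    (let (n , L , bcl , sim) = simulate rootWins-Σ¹₁ in
      n , L , bcl , simulates-Σ⁰-complete {α} 𝟙≺α sim (rootWins-Σ⁰ 𝟙≼α) (rootWins-complete 𝟙≼α)) ,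
    (let (n , L , bcl , sim) = simulate ∁rootWins-Σ¹₁ in
      n , L , bcl , simulates-Π⁰-complete {α} 𝟙≺α sim (Σ⁰-≐ {α = α} ∁∁-≐ (rootWins-Σ⁰ 𝟙≼α))
        (complete {α} {K = RootWins} (rootWins-complete 𝟙≼α)))
    where open RecursiveGame em α 𝟙≼α D R D-rec R-rec f mono range

corollary4p15 : (∀ {ℓ} → ExcludedMiddle ℓ) →
    (∀ α → 𝟙 ≼ α → IsRecursiveOrdinal α →
    (∃₂ λ n (L : Lang n) → r-BCLω 4 L × IsΣ⁰-complete α L) ×
    (∃₂ λ n (L : Lang n) → r-BCLω 4 L × IsΠ⁰-complete α L)) ×
    (∃ λ γ → Isγ¹₂ γ × IsSupremum (BorelRanks (r-BCLω 4)) γ)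
corollary4p15 em = complete-languages , sup , sup-isγ¹₂ , sup-isSupremum
  where
  open Completeness em
  open Suprema em
  open OrdinalConstructions.Supremum em (λ i → Suprema.rankOf em {i} em) using (sup)
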